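{- The interpretation $(\|-\|_t,\|-\|_T)$ described in the context is an interpretation of the type theory $\mathbf{mTT}_{cind}+\mathbf{AC}+\mathbf{CT}$ into the type theory $\mathbf{MLtt}_{cind}+\mathbf{CT}$, so that the consistency of $\mathbf{mTT}_{cind}+\mathbf{AC}+\mathbf{CT}$ is reduced to the consistency of $\mathbf{MLtt}_{cind}+\mathbf{CT}$ (if $\mathbf{MLtt}_{cind}+\mathbf{CT}$ is consistent, then so is $\mathbf{mTT}_{cind}+\mathbf{AC}+\mathbf{CT}$).
   Context: General conventions. All type theories are dependent type theories with judgements $A\ type\ [\Gamma]$, $A=B\ type\ [\Gamma]$, $a\in A\ [\Gamma]$, $a=b\in A\ [\Gamma]$. In place of the usual congruence rules for terms (in particular without the $\xi$-rule "$c=c'\in C\ [x\in B]$ implies $\lambda x.c=\lambda x.c'\in(\Pi x\in B)C$") only the replacement rule is postulated: from $c(x_1,\dots,x_n)\in C(x_1,\dots,x_n)\ [x_1\in A_1,\dots,x_n\in A_n(x_1,\dots,x_{n-1})]$ and $a_1=b_1\in A_1,\dots,a_n=b_n\in A_n(a_1,\dots,a_{n-1})$ infer $c(a_1,\dots,a_n)=c(b_1,\dots,b_n)\in C(a_1,\dots,a_n)$. Consistent means that the falsum $\bot$ (respectively the empty type $\mathsf N_0$) has no closed element. $\mathsf{Ap}$ is function application. The theory $\mathbf{mTT}_{cind}$. $\mathbf{mTT}$ is the intensional level of the Minimalist Foundation. It has four kinds of types: collections, sets, propositions, small propositions; small propositions are sets and propositions, sets and propositions are collections. Sets: $\mathsf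 N_0$, $\mathsf N_1$, $\mathsf{List}(A)$, $A+B$, $(\Sigma x\in A)B$, $(\Pi x\in A)B$ with the usual rules of intensional Martin-Löf type theory (eliminations towards collections); $\mathsf N$ is the set of natural numbers. Propositions: $\bot$, $\wedge$, $\vee$, $\to$, $\forall_{x\in A}$, $\exists_{x\in A}$, $\mathsf{Id}(A,a,b)$ for collections $A$, with proof-terms as in intensional Martin-Löf type theory, but with eliminations only towards propositions not depending on proof-terms. Small propositions: those propositions built with quantifiers and equalities restricted to sets. Collections: also the universe à la Russell $\mathsf{prop_s}$ of small propositions, function collections $A\to\mathsf{prop_s}$ ($A$ a set), and $\Sigma$-types of collections. For $V\in A\to\mathsf{prop_s}$, $a\,\epsilon\,V$ means $\mathsf{Ap}(V,a)$. An axiom set is: $A\ set$, $I(x)\ set\ [x\in A]$, $C(x,j)\in A\to\mathsf{prop_s}\ [x\in A,j\in I(x)]$. $\mathbf{mTT}_{ind}$ adds, for each axiom set, $V\in A\to\mathsf{prop_s}$ and $a\in A$, a small proposition $a\triangleleft_{I,C}V$ with: $\mathsf{rf}(a,r)\in a\triangleleft_{I,C}V$ for $r\in a\,\epsilon\,V$; $\mathsf{tr}(a,j,r)\in a\triangleleft_{I,C}V$ for $j\in I(a)$, $r\in\forall_{z\in A}(z\,\epsilon\,C(a,j)\to z\triangleleft_{I,C}V)$; and, for $P(x)\ prop\ [x\in A]$, $m\in a\triangleleft_{I,C}V$, $q_1(x,w)\in P(x)\ [x\in A,w\in x\,\epsilon\,V]$, $q_2(x,h,k,f)\in P(x)\ [x\in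 A,h\in I(x),k\in\forall_{z\in A}(z\,\epsilon\,C(x,h)\to z\triangleleft_{I,C}V),f\in\forall_{z\in A}(z\,\epsilon\,C(x,h)\to P(z))]$, an eliminator $\mathsf{ind}(m,q_1,q_2)\in P(a)$ with $\mathsf{ind}(\mathsf{rf}(a,r),q_1,q_2)=q_1(a,r)$ and $\mathsf{ind}(\mathsf{tr}(a,j,r),q_1,q_2)=q_2(a,j,r,\lambda z.\lambda u.\mathsf{ind}(\mathsf{Ap}(\mathsf{Ap}(r,z),u),q_1,q_2))$. $\mathbf{mTT}_{cind}$ adds, for each axiom set, $V\in A\to\mathsf{prop_s}$ and $a\in A$, a small proposition $a\ltimes_{I,C}V$ with (no equality rules): $\mathsf{ax_1}(a,q)\in a\,\epsilon\,V$ for $q\in a\ltimes_{I,C}V$; $\mathsf{ax_2}(a,i,q)\in\exists_{y\in A}(y\,\epsilon\,C(a,i)\wedge y\ltimes_{I,C}V)$ for $i\in I(a)$, $q\in a\ltimes_{I,C}V$; and, for $P(x)\ prop\ [x\in A]$, $m\in P(a)$, $q_1(x,z)\in V(x)\ [x\in A,z\in P(x)]$, $q_2(x,j,z)\in\exists_{y\in A}(P(y)\wedge y\,\epsilon\,C(x,j))\ [x\in A,j\in I(x),z\in P(x)]$, a term $\mathsf{ax_3}(a,m,q_1,q_2)\in a\ltimes_{I,C}V$. The axioms. $\mathbf{AC}$: $(\forall x\in A)(\exists y\in B)R(x,y)\to(\exists f\in(\Pi x\in A)B)(\forall x\in A)R(x,\mathsf{Ap}(f,x))$ for collections $A,B$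 (for which the function type $(\Pi x\in A)B$ is available) and any relation $R$. $\mathbf{CT}$: $(\forall f\in\mathsf N\to\mathsf N)(\exists e\in\mathsf N)(\forall x\in\mathsf N)(\exists z\in\mathsf N)(T(e,x,z)\wedge\mathsf{Ap}(f,x)=_{\mathsf N}U(z))$, with $T$ Kleene's predicate and $U$ the result-extracting function; in Martin-Löf type theories it is read via propositions-as-types. The theory $\mathbf{MLtt}_{cind}$. It is intensional Martin-Löf type theory with types $\mathsf N_0,\mathsf N_1,\mathsf N,\mathsf{List}(A),A+B,(\Sigma x\in A)B,(\Pi x\in A)B,\mathsf{Id}(A,a,b)$ and one universe $\mathsf U_0$ à la Tarski with decoding $\mathsf T$, closed under codes for all these type constructors and under the following. Write $t\,\epsilon\,v$ for $\mathsf T(\mathsf{Ap}(v,t))$. An axiom-set is $s\in\mathsf U_0$, $i(x)\in\mathsf U_0\ [x\in\mathsf T(s)]$, $c(x,j)\in\mathsf T(s)\to\mathsf U_0\ [x\in\mathsf T(s),j\in\mathsf T(i(x))]$. For $v\in\mathsf T(s)\to\mathsf U_0$, $a\in\mathsf T(s)$ there are codes $a\,\widehat\triangleleft_{s,i,c}v\in\mathsf U_0$ and $a\,\widehat\ltimes_{s,i,c}v\in\mathsf U_0$, with decodings $a\triangleleft_{s,i,c}v$ and $a\ltimes_{s,i,c}v$. Covers: constructors $\mathsf{rf}(a,r)$ ($r\in a\,\epsilon\,v$) and $\mathsf{tr}(a,j,r)$ ($j\in\mathsf T(i(a))$, $r\in(\Pi z\in\mathsf T(s))(z\,\epsilon\,c(a,j)\to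 z\triangleleft_{s,i,c}v)$) of $a\triangleleft_{s,i,c}v$; for any $P(x,u)\ type\ [x\in\mathsf T(s),u\in x\triangleleft_{s,i,c}v]$, $m\in a\triangleleft_{s,i,c}v$, $q_1(x,w)\in P(x,\mathsf{rf}(x,w))\ [x\in \mathsf T(s),w\in x\,\epsilon\,v]$ and $q_2(x,h,k,f)\in P(x,\mathsf{tr}(x,h,k))\ [x\in\mathsf T(s),h\in\mathsf T(i(x)),k\in(\Pi z\in\mathsf T(s))(z\,\epsilon\,c(x,h)\to z\triangleleft_{s,i,c}v),f\in(\Pi z\in\mathsf T(s))(\Pi u\in z\,\epsilon\,c(x,h))P(z,\mathsf{Ap}(\mathsf{Ap}(k,z),u))]$, an eliminator $\mathsf{ind}(m,q_1,q_2)\in P(a,m)$, with the two computation rules $\mathsf{ind}(\mathsf{rf}(a,r),q_1,q_2)=q_1(a,r)$ and $\mathsf{ind}(\mathsf{tr}(a,j,r),q_1,q_2)=q_2(a,j,r,\lambda z.\lambda u.\mathsf{ind}(\mathsf{Ap}(\mathsf{Ap}(r,z),u),q_1,q_2))$. Positivity: $\mathsf{ax_1}(a,q)\in a\,\epsilon\,v$ for $q\in a\ltimes_{s,i,c}v$; $\mathsf{ax_2}(a,j,q)\in(\Sigma y\in\mathsf T(s))(y\,\epsilon\,c(a,j)\times y\ltimes_{s,i,c}v)$ for $j\in\mathsf T(i(a))$, $q\in a\ltimes_{s,i,c}v$; and, for $P(x)\ type\ [x\in\mathsf T(s)]$, $m\in P(a)$, $q_1(x,z)\in\mathsf T(v(x))\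 [x\in\mathsf T(s),z\in P(x)]$, $q_2(x,j,z)\in(\Sigma y\in\mathsf T(s))(y\,\epsilon\,c(x,j)\times P(y))\ [x\in\mathsf T(s),j\in\mathsf T(i(x)),z\in P(x)]$, a term $\mathsf{ax_3}(m,q_1,q_2)\in a\ltimes_{s,i,c}v$. The interpretation. On a pre-syntax of $\mathbf{mTT}_{cind}$ in which pre-types contained in $\mathsf{prop_s}$ are also pre-terms, define by mutual recursion $\|-\|_t$ (pre-terms to pre-terms) and $\|-\|_T$ (pre-types to pre-types), following propositions-as-types ($\bot\mapsto\mathsf N_0$, $\wedge\mapsto\times$, $\vee\mapsto+$, implication to function type, $\forall\mapsto\Pi$, $\exists\mapsto\Sigma$, $\mathsf{Id}\mapsto\mathsf{Id}$, set constructors to the corresponding type constructors, proof-terms to the corresponding terms), sending $\mathsf{prop_s}$ to $\mathsf U_0$, sending covers and positivity relations with their terms to the corresponding types and terms of $\mathbf{MLtt}_{cind}$, and sending a small proposition regarded as a pre-term to the code in $\mathsf U_0$ of its interpretation as a pre-type. A judgement is interpreted by applying $\|-\|_t$ or $\|-\|_T$ according as an expression plays the role of a term or of a type; e.g. $a\in\varphi$ becomes $\|a\|_t\in\|\varphi\|_T$ and $\varphi\in\mathsf{prop_s}$ becomes $\|\varphi\|_t\in\mathsf U_0$. -}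

module Defs where

open import Data.Fin.Base using (Fin; zero; suc; _↑ʳ_)
open import Data.List.Base using ([]; _∷_; map)
import Data.List.Base as Lists
open import Data.Nat.Base using (ℕ; zero; suc; _+_)
open import Data.Product.Base using (_×_; _,_)
open import Data.Unit.Base using (⊤; tt)
open import Data.Vec.Base using (Vec; []; _∷_; lookup)
open import Relation.Nullary.Negation.Core using (¬_)

-- Expressions with binding over a signature: an operator of arity
-- (k₁ , s₁) ∷ (k₂ , s₂) ∷ … takes arguments of sorts s₁, s₂, …, binding
-- k₁, k₂, … variables in them; variables are of sort tm.  In a context of
-- length n, de Bruijn index 0 is the last assumption.
module Syntax (Sort : Set) (tm : Sort)
              (Op : Sort → Set) (arity : ∀ {s} → Op s → Lists.List (ℕ × Sort)) where

  infixr 5 _◂_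
  infixl 5 _▷_ _▸_ _‼_
  infix  9 _[_] _[_]ᵃ

  data Args : Lists.List (ℕ × Sort) → ℕ → Set

  data Exp : Sort → ℕ → Set where
    var : ∀ {n} → Fin n → Exp tm n
    op  : ∀ {s n} (o : Op s) → Args (arity o) n → Exp s n

  data Args where
    ⟨⟩  : ∀ {n} → Args [] n
    _◂_ : ∀ {n k s ks} → Exp s (k + n) → Args ks n → Args ((k , s) ∷ ks) n

  Ren : ℕ → ℕ → Set
  Ren n m = Fin n → Fin m

  liftᴿ₁ : ∀ {n m} → Ren n m → Ren (suc n) (suc m)
  liftᴿ₁ ρ zero    = zero
  liftᴿ₁ ρ (suc i) = suc (ρ i)

  liftᴿ : ∀ {n m} k → Ren n m → Ren (k + n) (k + m)
  liftᴿ zero    ρ = ρ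
  liftᴿ (suc k) ρ = liftᴿ₁ (liftᴿ k ρ)

  ren  : ∀ {n m s} → Ren n m → Exp s n → Exp s m
  renᵃ : ∀ {n m ks} → Ren n m → Args ks n → Args ks m
  ren ρ (var i)  = var (ρ i)
  ren ρ (op o a) = op o (renᵃ ρ a)
  renᵃ ρ ⟨⟩                = ⟨⟩
  renᵃ ρ (_◂_ {k = k} e a) = ren (liftᴿ k ρ) e ◂ renᵃ ρ a

  Sub : ℕ → ℕ → Set
  Sub n m = Fin n → Exp tm m

  ids : ∀ {n} → Sub n n
  ids = var

  ↑ : ∀ {n} k → Sub n (k + n)
  ↑ k i = var (k ↑ʳ i)

  _▷_ : ∀ {n m} → Sub n m → Exp tm m → Sub (suc n) m
  (σ ▷ a) zero    = a
  (σ ▷ a) (suc i) = σ i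

  lift₁ : ∀ {n m} → Sub n m → Sub (suc n) (suc m)
  lift₁ σ = (λ i → ren suc (σ i)) ▷ var zero

  lift : ∀ {n m} k → Sub n m → Sub (k + n) (k + m)
  lift zero    σ = σ
  lift (suc k) σ = lift₁ (lift k σ)

  _[_]  : ∀ {n m s} → Exp s n → Sub n m → Exp s m
  _[_]ᵃ : ∀ {n m ks} → Args ks n → Sub n m → Args ks m
  var i  [ σ ] = σ i
  op o a [ σ ] = op o (a [ σ ]ᵃ)
  ⟨⟩                [ σ ]ᵃ = ⟨⟩
  (_◂_ {k = k} e a) [ σ ]ᵃ = e [ lift k σ ] ◂ a [ σ ]ᵃ

  v₀ : ∀ {n} → Exp tm (1 + n)
  v₀ = var zero

  v₁ : ∀ {n} → Exp tm (2 + n)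
  v₁ = var (suc zero)

  v₂ : ∀ {n} → Exp tm (3 + n)
  v₂ = var (suc (suc zero))

  v₃ : ∀ {n} → Exp tm (4 + n)
  v₃ = var (suc (suc (suc zero)))

  data Ctx (s : Sort) : ℕ → Set where
    ∙   : Ctx s 0
    _▸_ : ∀ {n} → Ctx s n → Exp s n → Ctx s (suc n)

  _‼_ : ∀ {n s} → Ctx s n → Fin n → Exp s n
  (Γ ▸ A) ‼ zero  = A [ ↑ 1 ]
  (Γ ▸ A) ‼ suc i = (Γ ‼ i) [ ↑ 1 ]

-- Kleene's predicate and the result-extracting function, as primitive
-- recursive functions, for Turing machines over the alphabet {0 , 1} (0 is the
-- blank) on a two-way infinite tape.
module Kleene where

  infix 9 _⟨_⟩

  -- Primitive recursive functions of arguments # 0, …, # (n - 1).  In the step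
  -- of rec t b s the previous value is # 0, the predecessor of the recursion
  -- argument is # 1, and the arguments of the whole function are # 2, # 3, ….
  data PR (n : ℕ) : Set where
    #    : Fin n → PR n
    zero : PR n
    suc  : PR n → PR n
    rec  : PR n → PR n → PR (2 + n) → PR n
    comp : ∀ {k} → PR k → (Fin k → PR n) → PR n

  _⟨_⟩ : ∀ {k n} → PR k → Vec (PR n) k → PR n
  f ⟨ ts ⟩ = comp f (lookup ts)

  #0 : ∀ {n} → PR (1 + n)
  #0 = # zero

  #1 : ∀ {n} → PR (2 + n)
  #1 = # (suc zero)

  #2 : ∀ {n} → PR (3 + n)
  #2 = # (suc (suc zero))

  #3 : ∀ {n} → PR (4 + n)
  #3 = # (suc (suc (suc zero)))

  #4 : ∀ {n} → PR (5 + n)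
  #4 = # (suc (suc (suc (suc zero))))

  pred isZero sg : PR 1
  pred   = rec #0 zero #1
  isZero = rec #0 (suc zero) zero
  sg     = rec #0 zero (suc zero)

  add monus mul eq : PR 2
  add   = rec #1 #0 (suc #0)
  monus = rec #1 #0 (pred ⟨ #0 ∷ [] ⟩)
  mul   = rec #1 zero (add ⟨ #0 ∷ #2 ∷ [] ⟩)
  eq    = isZero ⟨ add ⟨ monus ⟨ #0 ∷ #1 ∷ [] ⟩ ∷ monus ⟨ #1 ∷ #0 ∷ [] ⟩ ∷ [] ⟩ ∷ [] ⟩

  parity half double 2^ : PR 1
  parity = rec #0 zero (isZero ⟨ #0 ∷ [] ⟩)
  half   = rec #0 zero (add ⟨ #0 ∷ parity ⟨ #1 ∷ [] ⟩ ∷ [] ⟩)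
  double = add ⟨ #0 ∷ #0 ∷ [] ⟩
  2^     = rec #0 (suc zero) (double ⟨ #0 ∷ [] ⟩)

  -- if-then-else: second argument if the first is positive, third otherwise.
  cond : PR 3
  cond = rec #0 #2 #3

  -- Cantor pairing pair(a , b) = (a + b)(a + b + 1)/2 + b.
  triangle root fst snd : PR 1
  triangle = rec #0 zero (add ⟨ #0 ∷ suc #1 ∷ [] ⟩)
  -- The largest r with triangle(r) ≤ n.
  root     = rec #0 zero (cond ⟨ eq ⟨ suc #1 ∷ triangle ⟨ suc #0 ∷ [] ⟩ ∷ [] ⟩ ∷ suc #0 ∷ #0 ∷ [] ⟩)
  snd      = monus ⟨ #0 ∷ triangle ⟨ root ⟨ #0 ∷ [] ⟩ ∷ [] ⟩ ∷ [] ⟩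
  fst      = monus ⟨ root ⟨ #0 ∷ [] ⟩ ∷ snd ⟨ #0 ∷ [] ⟩ ∷ [] ⟩

  pair : PR 2
  pair = add ⟨ triangle ⟨ add ⟨ #0 ∷ #1 ∷ [] ⟩ ∷ [] ⟩ ∷ #1 ∷ [] ⟩

  -- Every number codes a list: 0 is the empty list, 1 + pair(a , l) is a ∷ l.
  -- Beyond its end a list reads as 0.
  cons : PR 2
  cons = suc (pair ⟨ #0 ∷ #1 ∷ [] ⟩)

  head tail length : PR 1
  head = fst ⟨ pred ⟨ #0 ∷ [] ⟩ ∷ [] ⟩
  tail = snd ⟨ pred ⟨ #0 ∷ [] ⟩ ∷ [] ⟩

  drop nth : PR 2
  drop = rec #0 #1 (tail ⟨ #0 ∷ [] ⟩)
  nth  = head ⟨ drop ⟨ #0 ∷ #1 ∷ [] ⟩ ∷ [] ⟩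

  length = rec #0 zero (add ⟨ #0 ∷ sg ⟨ drop ⟨ #1 ∷ #2 ∷ [] ⟩ ∷ [] ⟩ ∷ [] ⟩)

  -- The number of binary digits 1.
  ones : PR 1
  ones = rec #0 zero (add ⟨ #0 ∷ parity ⟨ rec #1 #2 (half ⟨ #0 ∷ [] ⟩) ∷ [] ⟩ ∷ [] ⟩)

  -- A configuration is pair(q , pair(l , r)): q is the state; the binary digits
  -- of r, least significant first, are the scanned cell and the cells to its
  -- right, and those of l are the cells to its left, read away from the head.
  state left right : PR 1
  state = fst ⟨ #0 ∷ [] ⟩
  left  = fst ⟨ snd ⟨ #0 ∷ [] ⟩ ∷ [] ⟩
  right = snd ⟨ snd ⟨ #0 ∷ [] ⟩ ∷ [] ⟩

  -- A machine e is a list whose entry 2q + b is the instruction for state q and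
  -- scanned digit b.  Entry 0 means that the machine halts; entry
  -- 1 + pair(w , pair(d , q')) means: write the parity of w, move left if d = 0
  -- and right otherwise, and go to state q'.
  instruction : PR 2
  instruction = nth ⟨ add ⟨ double ⟨ state ⟨ #1 ∷ [] ⟩ ∷ [] ⟩ ∷ parity ⟨ right ⟨ #1 ∷ [] ⟩ ∷ [] ⟩ ∷ [] ⟩ ∷ #0 ∷ [] ⟩

  halted : PR 2
  halted = isZero ⟨ instruction ⟨ #0 ∷ #1 ∷ [] ⟩ ∷ [] ⟩

  -- moveRight(q' , w , l , r) and moveLeft(q' , w , l , r).
  moveRight moveLeft : PR 4
  moveRight = pair ⟨ #0 ∷ pair ⟨ add ⟨ double ⟨ #2 ∷ [] ⟩ ∷ #1 ∷ [] ⟩ ∷ half ⟨ #3 ∷ [] ⟩ ∷ [] ⟩ ∷ [] ⟩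
  moveLeft  = pair ⟨ #0 ∷ pair ⟨ half ⟨ #2 ∷ [] ⟩
                              ∷ add ⟨ double ⟨ add ⟨ double ⟨ half ⟨ #3 ∷ [] ⟩ ∷ [] ⟩ ∷ #1 ∷ [] ⟩ ∷ [] ⟩
                                    ∷ parity ⟨ #2 ∷ [] ⟩ ∷ [] ⟩
                              ∷ [] ⟩ ∷ [] ⟩

  -- execute(pair(w , pair(d , q')) , c).
  execute : PR 2
  execute = cond ⟨ fst ⟨ snd ⟨ #0 ∷ [] ⟩ ∷ [] ⟩ ∷ moveRight ⟨ args ⟩ ∷ moveLeft ⟨ args ⟩ ∷ [] ⟩
    where
    args : Vec (PR 2) 4
    args = snd ⟨ snd ⟨ #0 ∷ [] ⟩ ∷ [] ⟩ ∷ parity ⟨ fst ⟨ #0 ∷ [] ⟩ ∷ [] ⟩ ∷ left ⟨ #1 ∷ [] ⟩ ∷ right ⟨ #1 ∷ [] ⟩ ∷ []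

  -- step(e , c); a halted configuration is left unchanged.
  step : PR 2
  step = cond ⟨ instruction ⟨ #0 ∷ #1 ∷ [] ⟩
              ∷ execute ⟨ pred ⟨ instruction ⟨ #0 ∷ #1 ∷ [] ⟩ ∷ [] ⟩ ∷ #1 ∷ [] ⟩
              ∷ #1 ∷ [] ⟩

  -- Input x: x + 1 consecutive digits 1, the head on the leftmost, state 0.
  initial : PR 1
  initial = pair ⟨ zero ∷ pair ⟨ zero ∷ pred ⟨ 2^ ⟨ suc #0 ∷ [] ⟩ ∷ [] ⟩ ∷ [] ⟩ ∷ [] ⟩

  -- history(e , x , k): the first k + 1 configurations, latest first.
  history : PR 3
  history = rec #2 (cons ⟨ initial ⟨ #1 ∷ [] ⟩ ∷ zero ∷ [] ⟩)
                   (cons ⟨ step ⟨ #2 ∷ head ⟨ #0 ∷ [] ⟩ ∷ [] ⟩ ∷ #0 ∷ [] ⟩)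

  -- Opaque, as the expressions representing these functions are very large.
  opaque
    -- 1 if z is the whole computation of machine e on input x, up to the first
    -- halted configuration, and 0 otherwise.
    kleeneT : PR 3
    kleeneT = mul ⟨ isHistory ∷ mul ⟨ halted ⟨ #0 ∷ head ⟨ #2 ∷ [] ⟩ ∷ [] ⟩ ∷ notBefore ∷ [] ⟩ ∷ [] ⟩
      where
      isHistory notBefore : PR 3
      isHistory = eq ⟨ #2 ∷ history ⟨ #0 ∷ #1 ∷ pred ⟨ length ⟨ #2 ∷ [] ⟩ ∷ [] ⟩ ∷ [] ⟩ ∷ [] ⟩
      notBefore = cond ⟨ tail ⟨ #2 ∷ [] ⟩
                       ∷ isZero ⟨ halted ⟨ #0 ∷ head ⟨ tail ⟨ #2 ∷ [] ⟩ ∷ [] ⟩ ∷ [] ⟩ ∷ [] ⟩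
                       ∷ suc zero ∷ [] ⟩

    -- The number of digits 1 on the tape in the last configuration.
    kleeneU : PR 1
    kleeneU = add ⟨ ones ⟨ left ⟨ head ⟨ #0 ∷ [] ⟩ ∷ [] ⟩ ∷ [] ⟩ ∷ ones ⟨ right ⟨ head ⟨ #0 ∷ [] ⟩ ∷ [] ⟩ ∷ [] ⟩ ∷ [] ⟩

-- mTT_cind + AC + CT.
--
-- Conventions for this module and the next.  The rules spell out the formation
-- premises which are usually left implicit, and context validity is a separate
-- judgement.  Substitution (and so weakening) is a rule; σ : Δ → Γ is given by
-- its components.  Definitional equality of terms is generated by computation
-- and replacement alone, so there is no ξ-rule.  The usual type constructors
-- preserve equality of types, but an equality of small propositions as types is
-- not one of terms of prop_s, since that would be a ξ-rule for prop_s.  Equality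
-- of covers and positivity relations is by replacement only: in MLtt_cind they
-- are decodings of terms of U₀.
module mTT where

  open Kleene using (PR; #; zero; suc; rec; comp; kleeneT; kleeneU)

  data Operator : ⊤ → Set where
    `N₀ `N₁ `N `List `⊕ `Σ `Π `⊥ `∧ `∨ `⇒ `∀ `∃ `Id `Propₛ `cover `positive    : Operator tt
    `abort `⋆ `ElN₁ `ze `su `ElN `nil `cons `ElList `inl `inr `case            : Operator tt
    `pair `split `λ `ap `rfl `ElId `rf `tr `ind `ax₁ `ax₂ `ax₃ `choice `church : Operator tt

  binds : ∀ {s} → Operator s → Lists.List ℕ
  binds `N₀       = []
  binds `N₁       = []
  binds `N        = []
  binds `List     = 0 ∷ []
  binds `⊕        = 0 ∷ 0 ∷ []
  binds `Σ        = 0 ∷ 1 ∷ []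
  binds `Π        = 0 ∷ 1 ∷ []
  binds `⊥        = []
  binds `∧        = 0 ∷ 0 ∷ []
  binds `∨        = 0 ∷ 0 ∷ []
  binds `⇒        = 0 ∷ 0 ∷ []
  binds `∀        = 0 ∷ 1 ∷ []
  binds `∃        = 0 ∷ 1 ∷ []
  binds `Id       = 0 ∷ 0 ∷ 0 ∷ []
  binds `Propₛ    = []
  binds `cover    = 0 ∷ 1 ∷ 2 ∷ 0 ∷ 0 ∷ []
  binds `positive = 0 ∷ 1 ∷ 2 ∷ 0 ∷ 0 ∷ []
  binds `abort    = 0 ∷ []
  binds `⋆        = []
  binds `ElN₁     = 0 ∷ 0 ∷ []
  binds `ze       = []
  binds `su       = 0 ∷ []
  binds `ElN      = 0 ∷ 0 ∷ 2 ∷ []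
  binds `nil      = []
  binds `cons     = 0 ∷ 0 ∷ []
  binds `ElList   = 0 ∷ 0 ∷ 3 ∷ []
  binds `inl      = 0 ∷ []
  binds `inr      = 0 ∷ []
  binds `case     = 0 ∷ 1 ∷ 1 ∷ []
  binds `pair     = 0 ∷ 0 ∷ []
  binds `split    = 0 ∷ 2 ∷ []
  binds `λ        = 1 ∷ []
  binds `ap       = 0 ∷ 0 ∷ []
  binds `rfl      = 0 ∷ []
  binds `ElId     = 0 ∷ 1 ∷ []
  binds `rf       = 0 ∷ 0 ∷ []
  binds `tr       = 0 ∷ 0 ∷ 0 ∷ []
  binds `ind      = 0 ∷ 2 ∷ 4 ∷ []
  binds `ax₁      = 0 ∷ 0 ∷ []
  binds `ax₂      = 0 ∷ 0 ∷ 0 ∷ []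
  binds `ax₃      = 0 ∷ 0 ∷ 2 ∷ 3 ∷ []
  binds `choice   = []
  binds `church   = []

  arity : ∀ {s} → Operator s → Lists.List (ℕ × ⊤)
  arity o = map (_, tt) (binds o)

  -- Types and terms form one class of expressions, as prop_s is a universe
  -- à la Russell.
  open Syntax ⊤ tt Operator arity public

  Expr : ℕ → Set
  Expr = Exp tt

  Context : ℕ → Set
  Context = Ctx tt

  infixr 7 _∧_ _∨_ _⇒_

  pattern N₀             = op `N₀ ⟨⟩
  pattern N₁             = op `N₁ ⟨⟩
  pattern N              = op `N ⟨⟩
  pattern List A         = op `List (A ◂ ⟨⟩)
  pattern _⊕_ A B        = op `⊕ (A ◂ B ◂ ⟨⟩)
  pattern Σ A B          = op `Σ (A ◂ B ◂ ⟨⟩)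
  pattern Π A B          = op `Π (A ◂ B ◂ ⟨⟩)
  pattern ⊥              = op `⊥ ⟨⟩
  pattern _∧_ φ ψ        = op `∧ (φ ◂ ψ ◂ ⟨⟩)
  pattern _∨_ φ ψ        = op `∨ (φ ◂ ψ ◂ ⟨⟩)
  pattern _⇒_ φ ψ        = op `⇒ (φ ◂ ψ ◂ ⟨⟩)
  pattern All A φ        = op `∀ (A ◂ φ ◂ ⟨⟩)
  pattern Ex A φ         = op `∃ (A ◂ φ ◂ ⟨⟩)
  pattern Id A a b       = op `Id (A ◂ a ◂ b ◂ ⟨⟩)
  pattern Propₛ          = op `Propₛ ⟨⟩
  -- a ◁_{I,C} V and a ⋉_{I,C} V
  pattern cover A I C V a    = op `cover (A ◂ I ◂ C ◂ V ◂ a ◂ ⟨⟩)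
  pattern positive A I C V a = op `positive (A ◂ I ◂ C ◂ V ◂ a ◂ ⟨⟩)

  -- Sets and propositions share the term constructors of intensional
  -- Martin-Löf type theory; the typing rules tell them apart.
  pattern abort c        = op `abort (c ◂ ⟨⟩)
  pattern ⋆              = op `⋆ ⟨⟩
  pattern ElN₁ t c       = op `ElN₁ (t ◂ c ◂ ⟨⟩)
  pattern ze             = op `ze ⟨⟩
  pattern su t           = op `su (t ◂ ⟨⟩)
  pattern ElN t c l      = op `ElN (t ◂ c ◂ l ◂ ⟨⟩)
  pattern nil            = op `nil ⟨⟩
  pattern cons a s       = op `cons (a ◂ s ◂ ⟨⟩)
  pattern ElList t c l   = op `ElList (t ◂ c ◂ l ◂ ⟨⟩)
  pattern inl a          = op `inl (a ◂ ⟨⟩)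
  pattern inr b          = op `inr (b ◂ ⟨⟩)
  pattern case d c₁ c₂   = op `case (d ◂ c₁ ◂ c₂ ◂ ⟨⟩)
  pattern pair a b       = op `pair (a ◂ b ◂ ⟨⟩)
  pattern split d c      = op `split (d ◂ c ◂ ⟨⟩)
  pattern ƛ b            = op `λ (b ◂ ⟨⟩)
  pattern ap f a         = op `ap (f ◂ a ◂ ⟨⟩)
  pattern rfl a          = op `rfl (a ◂ ⟨⟩)
  pattern ElId p c       = op `ElId (p ◂ c ◂ ⟨⟩)
  pattern rf a r         = op `rf (a ◂ r ◂ ⟨⟩)
  pattern tr a j r       = op `tr (a ◂ j ◂ r ◂ ⟨⟩)
  pattern ind m q₁ q₂    = op `ind (m ◂ q₁ ◂ q₂ ◂ ⟨⟩)
  pattern ax₁ a q        = op `ax₁ (a ◂ q ◂ ⟨⟩)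
  pattern ax₂ a i q      = op `ax₂ (a ◂ i ◂ q ◂ ⟨⟩)
  pattern ax₃ a m q₁ q₂  = op `ax₃ (a ◂ m ◂ q₁ ◂ q₂ ◂ ⟨⟩)
  pattern choice         = op `choice ⟨⟩
  pattern church         = op `church ⟨⟩

  infix 8 _ε_

  _ε_ : ∀ {n} → Expr n → Expr n → Expr n
  a ε V = ap V a

  -- t ◁_{I,C} V and t ⋉_{I,C} V with A, I, C and V moved along σ.
  coverₛ positiveₛ : ∀ {n m} → Sub n m → Expr n → Expr (1 + n) → Expr (2 + n) → Expr n → Expr m → Expr m
  coverₛ    σ A I C V t = cover    (A [ σ ]) (I [ lift 1 σ ]) (C [ lift 2 σ ]) (V [ σ ]) t
  positiveₛ σ A I C V t = positive (A [ σ ]) (I [ lift 1 σ ]) (C [ lift 2 σ ]) (V [ σ ]) t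

  -- (∀ z ∈ A) (z ε D → φ(z))
  below : ∀ {n} → Expr n → Expr n → Expr (1 + n) → Expr n
  below A D φ = All A (v₀ ε D [ ↑ 1 ] ⇒ φ)

  ⌜_⌝ : ∀ {k n} → PR k → (Fin k → Expr n) → Expr n
  ⌜ # i ⌝       ρ = ρ i
  ⌜ zero ⌝      ρ = ze
  ⌜ suc t ⌝     ρ = su (⌜ t ⌝ ρ)
  ⌜ rec t b s ⌝ ρ = ElN (⌜ t ⌝ ρ) (⌜ b ⌝ ρ) (⌜ s ⌝ ((λ i → ρ i [ ↑ 2 ]) ▷ v₁ ▷ v₀))
  ⌜ comp f ts ⌝ ρ = ⌜ f ⌝ (λ i → ⌜ ts i ⌝ ρ)

  CT : ∀ {n} → Expr n
  CT = All (Π N N) (Ex N (All N (Ex N (Kleene-T ∧ Id N (ap v₃ v₁) Kleene-U))))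
    where
    Kleene-T Kleene-U : ∀ {n} → Expr (4 + n)
    Kleene-T = Id N (⌜ kleeneT ⌝ (lookup (v₂ ∷ v₁ ∷ v₀ ∷ []))) (su ze)
    Kleene-U = ⌜ kleeneU ⌝ (lookup (v₀ ∷ []))

  AC : ∀ {n} → Expr n → Expr (1 + n) → Expr (2 + n) → Expr n
  AC A B R = All A (Ex B R) ⇒ Ex (Π A B) (All (A [ ↑ 1 ]) (R [ ↑ 2 ▷ v₀ ▷ ap v₁ v₀ ]))

  data Size : Set where
    small large : Size

  data Kind : Set where
    ty pr : Size → Kind

  pattern set   = ty small
  pattern col   = ty large
  pattern propₛ = pr small
  pattern prop  = pr large

  infix 4 _is_ _≐_is_ _∈_ _≐_∈_
  infix 3 _⊢_ _ctx
  infix 9 _[_]ᴶ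

  data Judgement (n : ℕ) : Set where
    _is_   : Expr n → Kind → Judgement n
    _≐_is_ : Expr n → Expr n → Kind → Judgement n
    _∈_    : Expr n → Expr n → Judgement n
    _≐_∈_  : Expr n → Expr n → Expr n → Judgement n

  _[_]ᴶ : ∀ {n m} → Judgement n → Sub n m → Judgement m
  (A is k)     [ σ ]ᴶ = A [ σ ] is k
  (A ≐ B is k) [ σ ]ᴶ = A [ σ ] ≐ B [ σ ] is k
  (a ∈ A)      [ σ ]ᴶ = a [ σ ] ∈ A [ σ ]
  (a ≐ b ∈ A)  [ σ ]ᴶ = a [ σ ] ≐ b [ σ ] ∈ A [ σ ]

  private variable
    n m : ℕ
    Γ : Context n
    Δ : Context m
    J : Judgement n
    k : Kind
    z : Size
    A A' A″ D D' φ φ' ψ ψ' V a a' a″ b b' d f i j p q r s t : Expr n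
    B B' I M P χ χ' b₁ c₁ c₂ : Expr (1 + n)
    C Q R c₃ q₁ : Expr (2 + n)
    l q₃ : Expr (3 + n)
    q₂ : Expr (4 + n)

  data _ctx : Context n → Set
  data _⊢_  : Context n → Judgement n → Set

  data AxiomSet (Γ : Context n) (A : Expr n) (I : Expr (1 + n)) (C : Expr (2 + n)) : Set where
    axiomSet : Γ ⊢ A is set → Γ ▸ A ⊢ I is set → Γ ▸ A ▸ I ⊢ C ∈ Π (A [ ↑ 2 ]) Propₛ → AxiomSet Γ A I C

  data _ctx where
    ∙-ctx : ∙ ctx
    ▸-ctx : Γ ctx → Γ ⊢ A is col → Γ ▸ A ctx

  data _⊢_ where
    pr⊆ty   : Γ ⊢ A is pr z → Γ ⊢ A is ty z
    set⊆col : Γ ⊢ A is set → Γ ⊢ A is col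
    prₛ⊆pr  : Γ ⊢ A is propₛ → Γ ⊢ A is prop
    pr⊆ty-≐   : Γ ⊢ A ≐ A' is pr z → Γ ⊢ A ≐ A' is ty z
    set⊆col-≐ : Γ ⊢ A ≐ A' is set → Γ ⊢ A ≐ A' is col
    prₛ⊆pr-≐  : Γ ⊢ A ≐ A' is propₛ → Γ ⊢ A ≐ A' is prop

    is-refl  : Γ ⊢ A is k → Γ ⊢ A ≐ A is k
    is-sym   : Γ ⊢ A ≐ A' is k → Γ ⊢ A' ≐ A is k
    is-trans : Γ ⊢ A ≐ A' is k → Γ ⊢ A' ≐ A″ is k → Γ ⊢ A ≐ A″ is k
    ∈-refl   : Γ ⊢ a ∈ A → Γ ⊢ a ≐ a ∈ A
    ∈-sym    : Γ ⊢ a ≐ a' ∈ A → Γ ⊢ a' ≐ a ∈ A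
    ∈-trans  : Γ ⊢ a ≐ a' ∈ A → Γ ⊢ a' ≐ a″ ∈ A → Γ ⊢ a ≐ a″ ∈ A
    conv     : Γ ⊢ a ∈ A → Γ ⊢ A ≐ A' is col → Γ ⊢ a ∈ A'
    conv-≐   : Γ ⊢ a ≐ a' ∈ A → Γ ⊢ A ≐ A' is col → Γ ⊢ a ≐ a' ∈ A'

    var-∈ : Γ ctx → (x : Fin n) → Γ ⊢ var x ∈ Γ ‼ x
    subst : (σ : Sub n m) → Γ ⊢ J → Δ ctx → (∀ x → Δ ⊢ σ x ∈ (Γ ‼ x) [ σ ]) → Δ ⊢ J [ σ ]ᴶ
    repl-is : (σ τ : Sub n m) → Γ ⊢ A is k → Δ ctx →
      (∀ x → Δ ⊢ σ x ∈ (Γ ‼ x) [ σ ]) → (∀ x → Δ ⊢ τ x ∈ (Γ ‼ x) [ τ ]) →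
      (∀ x → Δ ⊢ σ x ≐ τ x ∈ (Γ ‼ x) [ σ ]) → Δ ⊢ A [ σ ] ≐ A [ τ ] is k
    repl-∈ : (σ τ : Sub n m) → Γ ⊢ a ∈ A → Δ ctx →
      (∀ x → Δ ⊢ σ x ∈ (Γ ‼ x) [ σ ]) → (∀ x → Δ ⊢ τ x ∈ (Γ ‼ x) [ τ ]) →
      (∀ x → Δ ⊢ σ x ≐ τ x ∈ (Γ ‼ x) [ σ ]) → Δ ⊢ a [ σ ] ≐ a [ τ ] ∈ A [ σ ]

    N₀-F : Γ ctx → Γ ⊢ N₀ is set
    N₀-E : Γ ▸ N₀ ⊢ M is col → Γ ⊢ t ∈ N₀ → Γ ⊢ abort t ∈ M [ ids ▷ t ]

    N₁-F : Γ ctx → Γ ⊢ N₁ is set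
    N₁-I : Γ ctx → Γ ⊢ ⋆ ∈ N₁
    N₁-E : Γ ▸ N₁ ⊢ M is col → Γ ⊢ t ∈ N₁ → Γ ⊢ a ∈ M [ ids ▷ ⋆ ] → Γ ⊢ ElN₁ t a ∈ M [ ids ▷ t ]
    N₁-β : Γ ▸ N₁ ⊢ M is col → Γ ⊢ a ∈ M [ ids ▷ ⋆ ] → Γ ⊢ ElN₁ ⋆ a ≐ a ∈ M [ ids ▷ ⋆ ]

    N-F   : Γ ctx → Γ ⊢ N is set
    N-I₀  : Γ ctx → Γ ⊢ ze ∈ N
    N-Iₛ  : Γ ⊢ t ∈ N → Γ ⊢ su t ∈ N
    N-E   : Γ ▸ N ⊢ M is col → Γ ⊢ t ∈ N → Γ ⊢ a ∈ M [ ids ▷ ze ] →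
      Γ ▸ N ▸ M ⊢ c₃ ∈ M [ ↑ 2 ▷ su v₁ ] → Γ ⊢ ElN t a c₃ ∈ M [ ids ▷ t ]
    N-β₀  : Γ ▸ N ⊢ M is col → Γ ⊢ a ∈ M [ ids ▷ ze ] →
      Γ ▸ N ▸ M ⊢ c₃ ∈ M [ ↑ 2 ▷ su v₁ ] → Γ ⊢ ElN ze a c₃ ≐ a ∈ M [ ids ▷ ze ]
    N-βₛ  : Γ ▸ N ⊢ M is col → Γ ⊢ t ∈ N → Γ ⊢ a ∈ M [ ids ▷ ze ] →
      Γ ▸ N ▸ M ⊢ c₃ ∈ M [ ↑ 2 ▷ su v₁ ] →
      Γ ⊢ ElN (su t) a c₃ ≐ c₃ [ ids ▷ t ▷ ElN t a c₃ ] ∈ M [ ids ▷ su t ]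

    List-F  : Γ ⊢ A is set → Γ ⊢ List A is set
    List-≐  : Γ ⊢ A ≐ A' is set → Γ ⊢ List A ≐ List A' is set
    List-I₀ : Γ ⊢ A is set → Γ ⊢ nil ∈ List A
    List-Iₛ : Γ ⊢ A is set → Γ ⊢ a ∈ A → Γ ⊢ s ∈ List A → Γ ⊢ cons a s ∈ List A
    List-E  : Γ ⊢ A is set → Γ ▸ List A ⊢ M is col → Γ ⊢ t ∈ List A → Γ ⊢ a ∈ M [ ids ▷ nil ] →
      Γ ▸ A ▸ List A [ ↑ 1 ] ▸ M [ ↑ 2 ▷ v₀ ] ⊢ l ∈ M [ ↑ 3 ▷ cons v₂ v₁ ] →
      Γ ⊢ ElList t a l ∈ M [ ids ▷ t ]
    List-β₀ : Γ ⊢ A is set → Γ ▸ List A ⊢ M is col → Γ ⊢ a ∈ M [ ids ▷ nil ] →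
      Γ ▸ A ▸ List A [ ↑ 1 ] ▸ M [ ↑ 2 ▷ v₀ ] ⊢ l ∈ M [ ↑ 3 ▷ cons v₂ v₁ ] →
      Γ ⊢ ElList nil a l ≐ a ∈ M [ ids ▷ nil ]
    List-βₛ : Γ ⊢ A is set → Γ ▸ List A ⊢ M is col → Γ ⊢ b ∈ A → Γ ⊢ s ∈ List A → Γ ⊢ a ∈ M [ ids ▷ nil ] →
      Γ ▸ A ▸ List A [ ↑ 1 ] ▸ M [ ↑ 2 ▷ v₀ ] ⊢ l ∈ M [ ↑ 3 ▷ cons v₂ v₁ ] →
      Γ ⊢ ElList (cons b s) a l ≐ l [ ids ▷ b ▷ s ▷ ElList s a l ] ∈ M [ ids ▷ cons b s ]

    ⊕-F  : Γ ⊢ A is set → Γ ⊢ A' is set → Γ ⊢ A ⊕ A' is set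
    ⊕-≐  : Γ ⊢ A ≐ D is set → Γ ⊢ A' ≐ D' is set → Γ ⊢ A ⊕ A' ≐ D ⊕ D' is set
    ⊕-I₁ : Γ ⊢ A is set → Γ ⊢ A' is set → Γ ⊢ a ∈ A → Γ ⊢ inl a ∈ A ⊕ A'
    ⊕-I₂ : Γ ⊢ A is set → Γ ⊢ A' is set → Γ ⊢ a ∈ A' → Γ ⊢ inr a ∈ A ⊕ A'
    ⊕-E  : Γ ⊢ A is set → Γ ⊢ A' is set → Γ ▸ A ⊕ A' ⊢ M is col → Γ ⊢ d ∈ A ⊕ A' →
      Γ ▸ A ⊢ c₁ ∈ M [ ↑ 1 ▷ inl v₀ ] → Γ ▸ A' ⊢ c₂ ∈ M [ ↑ 1 ▷ inr v₀ ] →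
      Γ ⊢ case d c₁ c₂ ∈ M [ ids ▷ d ]
    ⊕-β₁ : Γ ⊢ A is set → Γ ⊢ A' is set → Γ ▸ A ⊕ A' ⊢ M is col → Γ ⊢ a ∈ A →
      Γ ▸ A ⊢ c₁ ∈ M [ ↑ 1 ▷ inl v₀ ] → Γ ▸ A' ⊢ c₂ ∈ M [ ↑ 1 ▷ inr v₀ ] →
      Γ ⊢ case (inl a) c₁ c₂ ≐ c₁ [ ids ▷ a ] ∈ M [ ids ▷ inl a ]
    ⊕-β₂ : Γ ⊢ A is set → Γ ⊢ A' is set → Γ ▸ A ⊕ A' ⊢ M is col → Γ ⊢ a ∈ A' →
      Γ ▸ A ⊢ c₁ ∈ M [ ↑ 1 ▷ inl v₀ ] → Γ ▸ A' ⊢ c₂ ∈ M [ ↑ 1 ▷ inr v₀ ] →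
      Γ ⊢ case (inr a) c₁ c₂ ≐ c₂ [ ids ▷ a ] ∈ M [ ids ▷ inr a ]

    Σ-F : Γ ⊢ A is ty z → Γ ▸ A ⊢ B is ty z → Γ ⊢ Σ A B is ty z
    Σ-≐ : Γ ⊢ A ≐ A' is ty z → Γ ▸ A ⊢ B ≐ B' is ty z → Γ ⊢ Σ A B ≐ Σ A' B' is ty z
    Σ-I : Γ ⊢ A is col → Γ ▸ A ⊢ B is col → Γ ⊢ a ∈ A → Γ ⊢ b ∈ B [ ids ▷ a ] → Γ ⊢ pair a b ∈ Σ A B
    Σ-E : Γ ⊢ A is col → Γ ▸ A ⊢ B is col → Γ ▸ Σ A B ⊢ M is col → Γ ⊢ d ∈ Σ A B →
      Γ ▸ A ▸ B ⊢ c₃ ∈ M [ ↑ 2 ▷ pair v₁ v₀ ] → Γ ⊢ split d c₃ ∈ M [ ids ▷ d ]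
    Σ-β : Γ ⊢ A is col → Γ ▸ A ⊢ B is col → Γ ▸ Σ A B ⊢ M is col → Γ ⊢ a ∈ A → Γ ⊢ b ∈ B [ ids ▷ a ] →
      Γ ▸ A ▸ B ⊢ c₃ ∈ M [ ↑ 2 ▷ pair v₁ v₀ ] →
      Γ ⊢ split (pair a b) c₃ ≐ c₃ [ ids ▷ a ▷ b ] ∈ M [ ids ▷ pair a b ]

    -- Products of sets over sets, and the function collections A → prop_s.
    Π-F      : Γ ⊢ A is set → Γ ▸ A ⊢ B is set → Γ ⊢ Π A B is set
    Π-F-prop : Γ ⊢ A is set → Γ ⊢ Π A Propₛ is col
    Π-≐      : Γ ⊢ A ≐ A' is set → Γ ▸ A ⊢ B ≐ B' is set → Γ ⊢ Π A B ≐ Π A' B' is set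
    Π-≐-prop : Γ ⊢ A ≐ A' is set → Γ ⊢ Π A Propₛ ≐ Π A' Propₛ is col
    Π-I      : Γ ⊢ A is col → Γ ▸ A ⊢ B is col → Γ ⊢ Π A B is col → Γ ▸ A ⊢ b₁ ∈ B → Γ ⊢ ƛ b₁ ∈ Π A B
    Π-E      : Γ ⊢ A is col → Γ ▸ A ⊢ B is col → Γ ⊢ Π A B is col → Γ ⊢ f ∈ Π A B → Γ ⊢ a ∈ A →
      Γ ⊢ ap f a ∈ B [ ids ▷ a ]
    Π-β      : Γ ⊢ A is col → Γ ▸ A ⊢ B is col → Γ ⊢ Π A B is col → Γ ▸ A ⊢ b₁ ∈ B → Γ ⊢ a ∈ A →
      Γ ⊢ ap (ƛ b₁) a ≐ b₁ [ ids ▷ a ] ∈ B [ ids ▷ a ]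

    Prop-F   : Γ ctx → Γ ⊢ Propₛ is col
    Prop-I   : Γ ⊢ φ is propₛ → Γ ⊢ φ ∈ Propₛ
    Prop-E   : Γ ⊢ φ ∈ Propₛ → Γ ⊢ φ is propₛ
    Prop-E-≐ : Γ ⊢ φ ≐ ψ ∈ Propₛ → Γ ⊢ φ ≐ ψ is propₛ

    ⊥-F : Γ ctx → Γ ⊢ ⊥ is propₛ
    ⊥-E : Γ ⊢ φ is prop → Γ ⊢ t ∈ ⊥ → Γ ⊢ abort t ∈ φ

    ∧-F : Γ ⊢ φ is pr z → Γ ⊢ ψ is pr z → Γ ⊢ φ ∧ ψ is pr z
    ∧-≐ : Γ ⊢ φ ≐ φ' is pr z → Γ ⊢ ψ ≐ ψ' is pr z → Γ ⊢ φ ∧ ψ ≐ φ' ∧ ψ' is pr z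
    ∧-I : Γ ⊢ φ is prop → Γ ⊢ ψ is prop → Γ ⊢ a ∈ φ → Γ ⊢ b ∈ ψ → Γ ⊢ pair a b ∈ φ ∧ ψ
    ∧-E : Γ ⊢ φ is prop → Γ ⊢ ψ is prop → Γ ⊢ A is prop → Γ ⊢ d ∈ φ ∧ ψ →
      Γ ▸ φ ▸ ψ [ ↑ 1 ] ⊢ c₃ ∈ A [ ↑ 2 ] → Γ ⊢ split d c₃ ∈ A
    ∧-β : Γ ⊢ φ is prop → Γ ⊢ ψ is prop → Γ ⊢ A is prop → Γ ⊢ a ∈ φ → Γ ⊢ b ∈ ψ →
      Γ ▸ φ ▸ ψ [ ↑ 1 ] ⊢ c₃ ∈ A [ ↑ 2 ] → Γ ⊢ split (pair a b) c₃ ≐ c₃ [ ids ▷ a ▷ b ] ∈ A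

    ∨-F  : Γ ⊢ φ is pr z → Γ ⊢ ψ is pr z → Γ ⊢ φ ∨ ψ is pr z
    ∨-≐  : Γ ⊢ φ ≐ φ' is pr z → Γ ⊢ ψ ≐ ψ' is pr z → Γ ⊢ φ ∨ ψ ≐ φ' ∨ ψ' is pr z
    ∨-I₁ : Γ ⊢ φ is prop → Γ ⊢ ψ is prop → Γ ⊢ a ∈ φ → Γ ⊢ inl a ∈ φ ∨ ψ
    ∨-I₂ : Γ ⊢ φ is prop → Γ ⊢ ψ is prop → Γ ⊢ a ∈ ψ → Γ ⊢ inr a ∈ φ ∨ ψ
    ∨-E  : Γ ⊢ φ is prop → Γ ⊢ ψ is prop → Γ ⊢ A is prop → Γ ⊢ d ∈ φ ∨ ψ →
      Γ ▸ φ ⊢ c₁ ∈ A [ ↑ 1 ] → Γ ▸ ψ ⊢ c₂ ∈ A [ ↑ 1 ] → Γ ⊢ case d c₁ c₂ ∈ A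
    ∨-β₁ : Γ ⊢ φ is prop → Γ ⊢ ψ is prop → Γ ⊢ A is prop → Γ ⊢ a ∈ φ →
      Γ ▸ φ ⊢ c₁ ∈ A [ ↑ 1 ] → Γ ▸ ψ ⊢ c₂ ∈ A [ ↑ 1 ] → Γ ⊢ case (inl a) c₁ c₂ ≐ c₁ [ ids ▷ a ] ∈ A
    ∨-β₂ : Γ ⊢ φ is prop → Γ ⊢ ψ is prop → Γ ⊢ A is prop → Γ ⊢ a ∈ ψ →
      Γ ▸ φ ⊢ c₁ ∈ A [ ↑ 1 ] → Γ ▸ ψ ⊢ c₂ ∈ A [ ↑ 1 ] → Γ ⊢ case (inr a) c₁ c₂ ≐ c₂ [ ids ▷ a ] ∈ A

    ⇒-F : Γ ⊢ φ is pr z → Γ ⊢ ψ is pr z → Γ ⊢ φ ⇒ ψ is pr z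
    ⇒-≐ : Γ ⊢ φ ≐ φ' is pr z → Γ ⊢ ψ ≐ ψ' is pr z → Γ ⊢ φ ⇒ ψ ≐ φ' ⇒ ψ' is pr z
    ⇒-I : Γ ⊢ φ is prop → Γ ⊢ ψ is prop → Γ ▸ φ ⊢ b₁ ∈ ψ [ ↑ 1 ] → Γ ⊢ ƛ b₁ ∈ φ ⇒ ψ
    ⇒-E : Γ ⊢ φ is prop → Γ ⊢ ψ is prop → Γ ⊢ f ∈ φ ⇒ ψ → Γ ⊢ a ∈ φ → Γ ⊢ ap f a ∈ ψ
    ⇒-β : Γ ⊢ φ is prop → Γ ⊢ ψ is prop → Γ ▸ φ ⊢ b₁ ∈ ψ [ ↑ 1 ] → Γ ⊢ a ∈ φ →
      Γ ⊢ ap (ƛ b₁) a ≐ b₁ [ ids ▷ a ] ∈ ψ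

    All-F : Γ ⊢ A is ty z → Γ ▸ A ⊢ χ is pr z → Γ ⊢ All A χ is pr z
    All-≐ : Γ ⊢ A ≐ A' is ty z → Γ ▸ A ⊢ χ ≐ χ' is pr z → Γ ⊢ All A χ ≐ All A' χ' is pr z
    All-I : Γ ⊢ A is col → Γ ▸ A ⊢ χ is prop → Γ ▸ A ⊢ b₁ ∈ χ → Γ ⊢ ƛ b₁ ∈ All A χ
    All-E : Γ ⊢ A is col → Γ ▸ A ⊢ χ is prop → Γ ⊢ f ∈ All A χ → Γ ⊢ a ∈ A → Γ ⊢ ap f a ∈ χ [ ids ▷ a ]
    All-β : Γ ⊢ A is col → Γ ▸ A ⊢ χ is prop → Γ ▸ A ⊢ b₁ ∈ χ → Γ ⊢ a ∈ A →
      Γ ⊢ ap (ƛ b₁) a ≐ b₁ [ ids ▷ a ] ∈ χ [ ids ▷ a ]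

    Ex-F : Γ ⊢ A is ty z → Γ ▸ A ⊢ χ is pr z → Γ ⊢ Ex A χ is pr z
    Ex-≐ : Γ ⊢ A ≐ A' is ty z → Γ ▸ A ⊢ χ ≐ χ' is pr z → Γ ⊢ Ex A χ ≐ Ex A' χ' is pr z
    Ex-I : Γ ⊢ A is col → Γ ▸ A ⊢ χ is prop → Γ ⊢ a ∈ A → Γ ⊢ b ∈ χ [ ids ▷ a ] → Γ ⊢ pair a b ∈ Ex A χ
    Ex-E : Γ ⊢ A is col → Γ ▸ A ⊢ χ is prop → Γ ⊢ φ is prop → Γ ⊢ d ∈ Ex A χ →
      Γ ▸ A ▸ χ ⊢ c₃ ∈ φ [ ↑ 2 ] → Γ ⊢ split d c₃ ∈ φ
    Ex-β : Γ ⊢ A is col → Γ ▸ A ⊢ χ is prop → Γ ⊢ φ is prop → Γ ⊢ a ∈ A → Γ ⊢ b ∈ χ [ ids ▷ a ] →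
      Γ ▸ A ▸ χ ⊢ c₃ ∈ φ [ ↑ 2 ] → Γ ⊢ split (pair a b) c₃ ≐ c₃ [ ids ▷ a ▷ b ] ∈ φ

    Id-F : Γ ⊢ A is ty z → Γ ⊢ a ∈ A → Γ ⊢ b ∈ A → Γ ⊢ Id A a b is pr z
    Id-≐ : Γ ⊢ A ≐ A' is ty z → Γ ⊢ a ≐ a' ∈ A → Γ ⊢ b ≐ b' ∈ A → Γ ⊢ Id A a b ≐ Id A' a' b' is pr z
    Id-I : Γ ⊢ A is col → Γ ⊢ a ∈ A → Γ ⊢ rfl a ∈ Id A a a
    Id-E : Γ ⊢ A is col → Γ ▸ A ▸ A [ ↑ 1 ] ⊢ Q is prop → Γ ⊢ a ∈ A → Γ ⊢ b ∈ A → Γ ⊢ p ∈ Id A a b →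
      Γ ▸ A ⊢ c₁ ∈ Q [ ↑ 1 ▷ v₀ ▷ v₀ ] → Γ ⊢ ElId p c₁ ∈ Q [ ids ▷ a ▷ b ]
    Id-β : Γ ⊢ A is col → Γ ▸ A ▸ A [ ↑ 1 ] ⊢ Q is prop → Γ ⊢ a ∈ A →
      Γ ▸ A ⊢ c₁ ∈ Q [ ↑ 1 ▷ v₀ ▷ v₀ ] → Γ ⊢ ElId (rfl a) c₁ ≐ c₁ [ ids ▷ a ] ∈ Q [ ids ▷ a ▷ a ]

    cover-F : AxiomSet Γ A I C → Γ ⊢ V ∈ Π A Propₛ → Γ ⊢ a ∈ A → Γ ⊢ cover A I C V a is propₛ
    cover-rf : AxiomSet Γ A I C → Γ ⊢ V ∈ Π A Propₛ → Γ ⊢ a ∈ A → Γ ⊢ r ∈ a ε V →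
      Γ ⊢ rf a r ∈ cover A I C V a
    cover-tr : AxiomSet Γ A I C → Γ ⊢ V ∈ Π A Propₛ → Γ ⊢ a ∈ A → Γ ⊢ j ∈ I [ ids ▷ a ] →
      Γ ⊢ r ∈ below A (C [ ids ▷ a ▷ j ]) (coverₛ (↑ 1) A I C V v₀) →
      Γ ⊢ tr a j r ∈ cover A I C V a
    cover-E : AxiomSet Γ A I C → Γ ⊢ V ∈ Π A Propₛ → Γ ▸ A ⊢ P is prop → Γ ⊢ a ∈ A →
      Γ ⊢ t ∈ cover A I C V a →
      Γ ▸ A ▸ v₀ ε V [ ↑ 1 ] ⊢ q₁ ∈ P [ ↑ 2 ▷ v₁ ] →
      Γ ▸ A ▸ I ▸ below (A [ ↑ 2 ]) C (coverₛ (↑ 3) A I C V v₀)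
        ▸ below (A [ ↑ 3 ]) (C [ ↑ 1 ]) (P [ ↑ 4 ▷ v₀ ]) ⊢ q₂ ∈ P [ ↑ 4 ▷ v₃ ] →
      Γ ⊢ ind t q₁ q₂ ∈ P [ ids ▷ a ]
    cover-β-rf : AxiomSet Γ A I C → Γ ⊢ V ∈ Π A Propₛ → Γ ▸ A ⊢ P is prop → Γ ⊢ a ∈ A →
      Γ ⊢ r ∈ a ε V →
      Γ ▸ A ▸ v₀ ε V [ ↑ 1 ] ⊢ q₁ ∈ P [ ↑ 2 ▷ v₁ ] →
      Γ ▸ A ▸ I ▸ below (A [ ↑ 2 ]) C (coverₛ (↑ 3) A I C V v₀)
        ▸ below (A [ ↑ 3 ]) (C [ ↑ 1 ]) (P [ ↑ 4 ▷ v₀ ]) ⊢ q₂ ∈ P [ ↑ 4 ▷ v₃ ] →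
      Γ ⊢ ind (rf a r) q₁ q₂ ≐ q₁ [ ids ▷ a ▷ r ] ∈ P [ ids ▷ a ]
    cover-β-tr : AxiomSet Γ A I C → Γ ⊢ V ∈ Π A Propₛ → Γ ▸ A ⊢ P is prop → Γ ⊢ a ∈ A →
      Γ ⊢ j ∈ I [ ids ▷ a ] → Γ ⊢ r ∈ below A (C [ ids ▷ a ▷ j ]) (coverₛ (↑ 1) A I C V v₀) →
      Γ ▸ A ▸ v₀ ε V [ ↑ 1 ] ⊢ q₁ ∈ P [ ↑ 2 ▷ v₁ ] →
      Γ ▸ A ▸ I ▸ below (A [ ↑ 2 ]) C (coverₛ (↑ 3) A I C V v₀)
        ▸ below (A [ ↑ 3 ]) (C [ ↑ 1 ]) (P [ ↑ 4 ▷ v₀ ]) ⊢ q₂ ∈ P [ ↑ 4 ▷ v₃ ] →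
      Γ ⊢ ind (tr a j r) q₁ q₂
        ≐ q₂ [ ids ▷ a ▷ j ▷ r ▷ ƛ (ƛ (ind (ap (ap (r [ ↑ 2 ]) v₁) v₀) (q₁ [ lift 2 (↑ 2) ]) (q₂ [ lift 4 (↑ 2) ]))) ]
        ∈ P [ ids ▷ a ]

    positive-F : AxiomSet Γ A I C → Γ ⊢ V ∈ Π A Propₛ → Γ ⊢ a ∈ A → Γ ⊢ positive A I C V a is propₛ
    positive-ax₁ : AxiomSet Γ A I C → Γ ⊢ V ∈ Π A Propₛ → Γ ⊢ a ∈ A → Γ ⊢ q ∈ positive A I C V a →
      Γ ⊢ ax₁ a q ∈ a ε V
    positive-ax₂ : AxiomSet Γ A I C → Γ ⊢ V ∈ Π A Propₛ → Γ ⊢ a ∈ A → Γ ⊢ i ∈ I [ ids ▷ a ] →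
      Γ ⊢ q ∈ positive A I C V a →
      Γ ⊢ ax₂ a i q ∈ Ex A (v₀ ε C [ ids ▷ a ▷ i ] [ ↑ 1 ] ∧ positiveₛ (↑ 1) A I C V v₀)
    positive-ax₃ : AxiomSet Γ A I C → Γ ⊢ V ∈ Π A Propₛ → Γ ▸ A ⊢ P is prop → Γ ⊢ a ∈ A →
      Γ ⊢ t ∈ P [ ids ▷ a ] →
      Γ ▸ A ▸ P ⊢ q₁ ∈ v₁ ε V [ ↑ 2 ] →
      Γ ▸ A ▸ I ▸ P [ ↑ 2 ▷ v₁ ] ⊢ q₃ ∈ Ex (A [ ↑ 3 ]) (P [ ↑ 4 ▷ v₀ ] ∧ v₀ ε C [ ↑ 2 ]) →
      Γ ⊢ ax₃ a t q₁ q₃ ∈ positive A I C V a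

    -- Constants for proofs of the instances of AC and of CT; B may depend on A.
    AC-ax : Γ ⊢ A is col → Γ ▸ A ⊢ B is col → Γ ⊢ Π A B is col → Γ ▸ A ▸ B ⊢ R is prop →
      Γ ⊢ choice ∈ AC A B R
    CT-ax : Γ ctx → Γ ⊢ church ∈ CT

  Consistent : Set
  Consistent = ∀ t → ¬ (∙ ⊢ t ∈ ⊥)

-- MLtt_cind + CT.
module MLtt where

  open Kleene using (PR; #; zero; suc; rec; comp; kleeneT; kleeneU)

  data Sort : Set where
    ty tm : Sort

  data Operator : Sort → Set where
    `N₀ `N₁ `N `List `⊕ `Σ `Π `Id `U₀ `T                                              : Operator ty
    `abort `⋆ `ElN₁ `ze `su `ElN `nil `cons `ElList `inl `inr `case                   : Operator tm
    `pair `split `λ `ap `rfl `J `rf `tr `ind `ax₁ `ax₂ `ax₃ `church                   : Operator tm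
    `N₀ᶜ `N₁ᶜ `Nᶜ `Listᶜ `⊕ᶜ `Σᶜ `Πᶜ `Idᶜ `coverᶜ `positiveᶜ                          : Operator tm

  arity : ∀ {s} → Operator s → Lists.List (ℕ × Sort)
  arity `N₀        = []
  arity `N₁        = []
  arity `N         = []
  arity `List      = (0 , ty) ∷ []
  arity `⊕         = (0 , ty) ∷ (0 , ty) ∷ []
  arity `Σ         = (0 , ty) ∷ (1 , ty) ∷ []
  arity `Π         = (0 , ty) ∷ (1 , ty) ∷ []
  arity `Id        = (0 , ty) ∷ (0 , tm) ∷ (0 , tm) ∷ []
  arity `U₀        = []
  arity `T         = (0 , tm) ∷ []
  arity `abort     = (0 , tm) ∷ []
  arity `⋆         = []
  arity `ElN₁      = (0 , tm) ∷ (0 , tm) ∷ []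
  arity `ze        = []
  arity `su        = (0 , tm) ∷ []
  arity `ElN       = (0 , tm) ∷ (0 , tm) ∷ (2 , tm) ∷ []
  arity `nil       = []
  arity `cons      = (0 , tm) ∷ (0 , tm) ∷ []
  arity `ElList    = (0 , tm) ∷ (0 , tm) ∷ (3 , tm) ∷ []
  arity `inl       = (0 , tm) ∷ []
  arity `inr       = (0 , tm) ∷ []
  arity `case      = (0 , tm) ∷ (1 , tm) ∷ (1 , tm) ∷ []
  arity `pair      = (0 , tm) ∷ (0 , tm) ∷ []
  arity `split     = (0 , tm) ∷ (2 , tm) ∷ []
  arity `λ         = (1 , tm) ∷ []
  arity `ap        = (0 , tm) ∷ (0 , tm) ∷ []
  arity `rfl       = (0 , tm) ∷ []
  arity `J         = (0 , tm) ∷ (1 , tm) ∷ []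
  arity `rf        = (0 , tm) ∷ (0 , tm) ∷ []
  arity `tr        = (0 , tm) ∷ (0 , tm) ∷ (0 , tm) ∷ []
  arity `ind       = (0 , tm) ∷ (2 , tm) ∷ (4 , tm) ∷ []
  arity `ax₁       = (0 , tm) ∷ (0 , tm) ∷ []
  arity `ax₂       = (0 , tm) ∷ (0 , tm) ∷ (0 , tm) ∷ []
  arity `ax₃       = (0 , tm) ∷ (2 , tm) ∷ (3 , tm) ∷ []
  arity `church    = []
  arity `N₀ᶜ       = []
  arity `N₁ᶜ       = []
  arity `Nᶜ        = []
  arity `Listᶜ     = (0 , tm) ∷ []
  arity `⊕ᶜ        = (0 , tm) ∷ (0 , tm) ∷ []
  arity `Σᶜ        = (0 , tm) ∷ (1 , tm) ∷ []
  arity `Πᶜ        = (0 , tm) ∷ (1 , tm) ∷ []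
  arity `Idᶜ       = (0 , tm) ∷ (0 , tm) ∷ (0 , tm) ∷ []
  arity `coverᶜ    = (0 , tm) ∷ (1 , tm) ∷ (2 , tm) ∷ (0 , tm) ∷ (0 , tm) ∷ []
  arity `positiveᶜ = (0 , tm) ∷ (1 , tm) ∷ (2 , tm) ∷ (0 , tm) ∷ (0 , tm) ∷ []

  open Syntax Sort tm Operator arity public

  Type : ℕ → Set
  Type = Exp ty

  Term : ℕ → Set
  Term = Exp tm

  Context : ℕ → Set
  Context = Ctx ty

  pattern N₀             = op `N₀ ⟨⟩
  pattern N₁             = op `N₁ ⟨⟩
  pattern N              = op `N ⟨⟩
  pattern List A         = op `List (A ◂ ⟨⟩)
  pattern _⊕_ A B        = op `⊕ (A ◂ B ◂ ⟨⟩)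
  pattern Σ A B          = op `Σ (A ◂ B ◂ ⟨⟩)
  pattern Π A B          = op `Π (A ◂ B ◂ ⟨⟩)
  pattern Id A a b       = op `Id (A ◂ a ◂ b ◂ ⟨⟩)
  pattern U₀             = op `U₀ ⟨⟩
  pattern T a            = op `T (a ◂ ⟨⟩)

  pattern abort c        = op `abort (c ◂ ⟨⟩)
  pattern ⋆              = op `⋆ ⟨⟩
  pattern ElN₁ t c       = op `ElN₁ (t ◂ c ◂ ⟨⟩)
  pattern ze             = op `ze ⟨⟩
  pattern su t           = op `su (t ◂ ⟨⟩)
  pattern ElN t c l      = op `ElN (t ◂ c ◂ l ◂ ⟨⟩)
  pattern nil            = op `nil ⟨⟩
  pattern cons a s       = op `cons (a ◂ s ◂ ⟨⟩)
  pattern ElList t c l   = op `ElList (t ◂ c ◂ l ◂ ⟨⟩)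
  pattern inl a          = op `inl (a ◂ ⟨⟩)
  pattern inr b          = op `inr (b ◂ ⟨⟩)
  pattern case d c₁ c₂   = op `case (d ◂ c₁ ◂ c₂ ◂ ⟨⟩)
  pattern pair a b       = op `pair (a ◂ b ◂ ⟨⟩)
  pattern split d c      = op `split (d ◂ c ◂ ⟨⟩)
  pattern ƛ b            = op `λ (b ◂ ⟨⟩)
  pattern ap f a         = op `ap (f ◂ a ◂ ⟨⟩)
  pattern rfl a          = op `rfl (a ◂ ⟨⟩)
  pattern J p c          = op `J (p ◂ c ◂ ⟨⟩)
  pattern rf a r         = op `rf (a ◂ r ◂ ⟨⟩)
  pattern tr a j r       = op `tr (a ◂ j ◂ r ◂ ⟨⟩)
  pattern ind m q₁ q₂    = op `ind (m ◂ q₁ ◂ q₂ ◂ ⟨⟩)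
  pattern ax₁ a q        = op `ax₁ (a ◂ q ◂ ⟨⟩)
  pattern ax₂ a j q      = op `ax₂ (a ◂ j ◂ q ◂ ⟨⟩)
  pattern ax₃ m q₁ q₂    = op `ax₃ (m ◂ q₁ ◂ q₂ ◂ ⟨⟩)
  pattern church         = op `church ⟨⟩

  pattern N₀ᶜ            = op `N₀ᶜ ⟨⟩
  pattern N₁ᶜ            = op `N₁ᶜ ⟨⟩
  pattern Nᶜ             = op `Nᶜ ⟨⟩
  pattern Listᶜ a        = op `Listᶜ (a ◂ ⟨⟩)
  pattern _⊕ᶜ_ a b       = op `⊕ᶜ (a ◂ b ◂ ⟨⟩)
  pattern Σᶜ a b         = op `Σᶜ (a ◂ b ◂ ⟨⟩)
  pattern Πᶜ a b         = op `Πᶜ (a ◂ b ◂ ⟨⟩)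
  pattern Idᶜ a b c      = op `Idᶜ (a ◂ b ◂ c ◂ ⟨⟩)
  pattern coverᶜ s i c v a    = op `coverᶜ (s ◂ i ◂ c ◂ v ◂ a ◂ ⟨⟩)
  pattern positiveᶜ s i c v a = op `positiveᶜ (s ◂ i ◂ c ◂ v ◂ a ◂ ⟨⟩)

  infix  8 _ε_
  infixr 7 _⊗_ _⇒_

  _⊗_ _⇒_ : ∀ {n} → Type n → Type n → Type n
  A ⊗ B = Σ A (B [ ↑ 1 ])
  A ⇒ B = Π A (B [ ↑ 1 ])

  _ε_ : ∀ {n} → Term n → Term n → Type n
  a ε v = T (ap v a)

  -- t ◁_{s,i,c} v and t ⋉_{s,i,c} v with s, i, c and v moved along σ.
  coverₛ positiveₛ : ∀ {n m} → Sub n m → Term n → Term (1 + n) → Term (2 + n) → Term n → Term m → Type m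
  coverₛ    σ s i c v t = T (coverᶜ    (s [ σ ]) (i [ lift 1 σ ]) (c [ lift 2 σ ]) (v [ σ ]) t)
  positiveₛ σ s i c v t = T (positiveᶜ (s [ σ ]) (i [ lift 1 σ ]) (c [ lift 2 σ ]) (v [ σ ]) t)

  -- (Π z ∈ T(s)) (Π u ∈ z ε d) B(z , u)
  below : ∀ {n} → Term n → Term n → Type (2 + n) → Type n
  below s d B = Π (T s) (Π (v₀ ε d [ ↑ 1 ]) B)

  ⌜_⌝ : ∀ {k n} → PR k → (Fin k → Term n) → Term n
  ⌜ # i ⌝       ρ = ρ i
  ⌜ zero ⌝      ρ = ze
  ⌜ suc t ⌝     ρ = su (⌜ t ⌝ ρ)
  ⌜ rec t b s ⌝ ρ = ElN (⌜ t ⌝ ρ) (⌜ b ⌝ ρ) (⌜ s ⌝ ((λ i → ρ i [ ↑ 2 ]) ▷ v₁ ▷ v₀))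
  ⌜ comp f ts ⌝ ρ = ⌜ f ⌝ (λ i → ⌜ ts i ⌝ ρ)

  CT : ∀ {n} → Type n
  CT = Π (Π N N) (Σ N (Π N (Σ N (Kleene-T ⊗ Id N (ap v₃ v₁) Kleene-U))))
    where
    Kleene-T : ∀ {n} → Type (4 + n)
    Kleene-T = Id N (⌜ kleeneT ⌝ (lookup (v₂ ∷ v₁ ∷ v₀ ∷ []))) (su ze)
    Kleene-U : ∀ {n} → Term (4 + n)
    Kleene-U = ⌜ kleeneU ⌝ (lookup (v₀ ∷ []))

  infix 4 _type _≐_type _∈_ _≐_∈_
  infix 3 _⊢_ _ctx
  infix 9 _[_]ᴶ

  data Judgement (n : ℕ) : Set where
    _type   : Type n → Judgement n
    _≐_type : Type n → Type n → Judgement n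
    _∈_     : Term n → Type n → Judgement n
    _≐_∈_   : Term n → Term n → Type n → Judgement n

  _[_]ᴶ : ∀ {n m} → Judgement n → Sub n m → Judgement m
  (A type)     [ σ ]ᴶ = A [ σ ] type
  (A ≐ B type) [ σ ]ᴶ = A [ σ ] ≐ B [ σ ] type
  (a ∈ A)      [ σ ]ᴶ = a [ σ ] ∈ A [ σ ]
  (a ≐ b ∈ A)  [ σ ]ᴶ = a [ σ ] ≐ b [ σ ] ∈ A [ σ ]

  private variable
    n m : ℕ
    Γ : Context n
    Δ : Context m
    𝒥 : Judgement n
    A A' A″ D D' : Type n
    B B' M P₁ : Type (1 + n)
    P : Type (2 + n)
    Q : Type (3 + n)
    a a' a″ b b' d f j p q r s t v : Term n
    i b₁ c₁ c₂ : Term (1 + n)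
    c q₁ : Term (2 + n)
    l q₃ : Term (3 + n)
    q₂ : Term (4 + n)

  data _ctx : Context n → Set
  data _⊢_  : Context n → Judgement n → Set

  data AxiomSet (Γ : Context n) (s : Term n) (i : Term (1 + n)) (c : Term (2 + n)) : Set where
    axiomSet : Γ ⊢ s ∈ U₀ → Γ ▸ T s ⊢ i ∈ U₀ → Γ ▸ T s ▸ T i ⊢ c ∈ T (s [ ↑ 2 ]) ⇒ U₀ → AxiomSet Γ s i c

  data _ctx where
    ∙-ctx : ∙ ctx
    ▸-ctx : Γ ctx → Γ ⊢ A type → Γ ▸ A ctx

  data _⊢_ where
    type-refl  : Γ ⊢ A type → Γ ⊢ A ≐ A type
    type-sym   : Γ ⊢ A ≐ A' type → Γ ⊢ A' ≐ A type
    type-trans : Γ ⊢ A ≐ A' type → Γ ⊢ A' ≐ A″ type → Γ ⊢ A ≐ A″ type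
    ∈-refl     : Γ ⊢ a ∈ A → Γ ⊢ a ≐ a ∈ A
    ∈-sym      : Γ ⊢ a ≐ a' ∈ A → Γ ⊢ a' ≐ a ∈ A
    ∈-trans    : Γ ⊢ a ≐ a' ∈ A → Γ ⊢ a' ≐ a″ ∈ A → Γ ⊢ a ≐ a″ ∈ A
    conv       : Γ ⊢ a ∈ A → Γ ⊢ A ≐ A' type → Γ ⊢ a ∈ A'
    conv-≐     : Γ ⊢ a ≐ a' ∈ A → Γ ⊢ A ≐ A' type → Γ ⊢ a ≐ a' ∈ A'

    var-∈ : Γ ctx → (x : Fin n) → Γ ⊢ var x ∈ Γ ‼ x
    subst : (σ : Sub n m) → Γ ⊢ 𝒥 → Δ ctx → (∀ x → Δ ⊢ σ x ∈ (Γ ‼ x) [ σ ]) → Δ ⊢ 𝒥 [ σ ]ᴶ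
    repl-type : (σ τ : Sub n m) → Γ ⊢ A type → Δ ctx →
      (∀ x → Δ ⊢ σ x ∈ (Γ ‼ x) [ σ ]) → (∀ x → Δ ⊢ τ x ∈ (Γ ‼ x) [ τ ]) →
      (∀ x → Δ ⊢ σ x ≐ τ x ∈ (Γ ‼ x) [ σ ]) → Δ ⊢ A [ σ ] ≐ A [ τ ] type
    repl-∈ : (σ τ : Sub n m) → Γ ⊢ a ∈ A → Δ ctx →
      (∀ x → Δ ⊢ σ x ∈ (Γ ‼ x) [ σ ]) → (∀ x → Δ ⊢ τ x ∈ (Γ ‼ x) [ τ ]) →
      (∀ x → Δ ⊢ σ x ≐ τ x ∈ (Γ ‼ x) [ σ ]) → Δ ⊢ a [ σ ] ≐ a [ τ ] ∈ A [ σ ]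

    N₀-F : Γ ctx → Γ ⊢ N₀ type
    N₀-E : Γ ▸ N₀ ⊢ M type → Γ ⊢ t ∈ N₀ → Γ ⊢ abort t ∈ M [ ids ▷ t ]

    N₁-F : Γ ctx → Γ ⊢ N₁ type
    N₁-I : Γ ctx → Γ ⊢ ⋆ ∈ N₁
    N₁-E : Γ ▸ N₁ ⊢ M type → Γ ⊢ t ∈ N₁ → Γ ⊢ a ∈ M [ ids ▷ ⋆ ] → Γ ⊢ ElN₁ t a ∈ M [ ids ▷ t ]
    N₁-β : Γ ▸ N₁ ⊢ M type → Γ ⊢ a ∈ M [ ids ▷ ⋆ ] → Γ ⊢ ElN₁ ⋆ a ≐ a ∈ M [ ids ▷ ⋆ ]

    N-F   : Γ ctx → Γ ⊢ N type
    N-I₀  : Γ ctx → Γ ⊢ ze ∈ N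
    N-Iₛ  : Γ ⊢ t ∈ N → Γ ⊢ su t ∈ N
    N-E   : Γ ▸ N ⊢ M type → Γ ⊢ t ∈ N → Γ ⊢ a ∈ M [ ids ▷ ze ] →
      Γ ▸ N ▸ M ⊢ c ∈ M [ ↑ 2 ▷ su v₁ ] → Γ ⊢ ElN t a c ∈ M [ ids ▷ t ]
    N-β₀  : Γ ▸ N ⊢ M type → Γ ⊢ a ∈ M [ ids ▷ ze ] →
      Γ ▸ N ▸ M ⊢ c ∈ M [ ↑ 2 ▷ su v₁ ] → Γ ⊢ ElN ze a c ≐ a ∈ M [ ids ▷ ze ]
    N-βₛ  : Γ ▸ N ⊢ M type → Γ ⊢ t ∈ N → Γ ⊢ a ∈ M [ ids ▷ ze ] →
      Γ ▸ N ▸ M ⊢ c ∈ M [ ↑ 2 ▷ su v₁ ] →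
      Γ ⊢ ElN (su t) a c ≐ c [ ids ▷ t ▷ ElN t a c ] ∈ M [ ids ▷ su t ]

    List-F  : Γ ⊢ A type → Γ ⊢ List A type
    List-≐  : Γ ⊢ A ≐ A' type → Γ ⊢ List A ≐ List A' type
    List-I₀ : Γ ⊢ A type → Γ ⊢ nil ∈ List A
    List-Iₛ : Γ ⊢ A type → Γ ⊢ a ∈ A → Γ ⊢ s ∈ List A → Γ ⊢ cons a s ∈ List A
    List-E  : Γ ⊢ A type → Γ ▸ List A ⊢ M type → Γ ⊢ t ∈ List A → Γ ⊢ a ∈ M [ ids ▷ nil ] →
      Γ ▸ A ▸ List A [ ↑ 1 ] ▸ M [ ↑ 2 ▷ v₀ ] ⊢ l ∈ M [ ↑ 3 ▷ cons v₂ v₁ ] →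
      Γ ⊢ ElList t a l ∈ M [ ids ▷ t ]
    List-β₀ : Γ ⊢ A type → Γ ▸ List A ⊢ M type → Γ ⊢ a ∈ M [ ids ▷ nil ] →
      Γ ▸ A ▸ List A [ ↑ 1 ] ▸ M [ ↑ 2 ▷ v₀ ] ⊢ l ∈ M [ ↑ 3 ▷ cons v₂ v₁ ] →
      Γ ⊢ ElList nil a l ≐ a ∈ M [ ids ▷ nil ]
    List-βₛ : Γ ⊢ A type → Γ ▸ List A ⊢ M type → Γ ⊢ b ∈ A → Γ ⊢ s ∈ List A → Γ ⊢ a ∈ M [ ids ▷ nil ] →
      Γ ▸ A ▸ List A [ ↑ 1 ] ▸ M [ ↑ 2 ▷ v₀ ] ⊢ l ∈ M [ ↑ 3 ▷ cons v₂ v₁ ] →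
      Γ ⊢ ElList (cons b s) a l ≐ l [ ids ▷ b ▷ s ▷ ElList s a l ] ∈ M [ ids ▷ cons b s ]

    ⊕-F  : Γ ⊢ A type → Γ ⊢ A' type → Γ ⊢ A ⊕ A' type
    ⊕-≐  : Γ ⊢ A ≐ D type → Γ ⊢ A' ≐ D' type → Γ ⊢ A ⊕ A' ≐ D ⊕ D' type
    ⊕-I₁ : Γ ⊢ A type → Γ ⊢ A' type → Γ ⊢ a ∈ A → Γ ⊢ inl a ∈ A ⊕ A'
    ⊕-I₂ : Γ ⊢ A type → Γ ⊢ A' type → Γ ⊢ a ∈ A' → Γ ⊢ inr a ∈ A ⊕ A'
    ⊕-E  : Γ ⊢ A type → Γ ⊢ A' type → Γ ▸ A ⊕ A' ⊢ M type → Γ ⊢ d ∈ A ⊕ A' →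
      Γ ▸ A ⊢ c₁ ∈ M [ ↑ 1 ▷ inl v₀ ] → Γ ▸ A' ⊢ c₂ ∈ M [ ↑ 1 ▷ inr v₀ ] →
      Γ ⊢ case d c₁ c₂ ∈ M [ ids ▷ d ]
    ⊕-β₁ : Γ ⊢ A type → Γ ⊢ A' type → Γ ▸ A ⊕ A' ⊢ M type → Γ ⊢ a ∈ A →
      Γ ▸ A ⊢ c₁ ∈ M [ ↑ 1 ▷ inl v₀ ] → Γ ▸ A' ⊢ c₂ ∈ M [ ↑ 1 ▷ inr v₀ ] →
      Γ ⊢ case (inl a) c₁ c₂ ≐ c₁ [ ids ▷ a ] ∈ M [ ids ▷ inl a ]
    ⊕-β₂ : Γ ⊢ A type → Γ ⊢ A' type → Γ ▸ A ⊕ A' ⊢ M type → Γ ⊢ a ∈ A' →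
      Γ ▸ A ⊢ c₁ ∈ M [ ↑ 1 ▷ inl v₀ ] → Γ ▸ A' ⊢ c₂ ∈ M [ ↑ 1 ▷ inr v₀ ] →
      Γ ⊢ case (inr a) c₁ c₂ ≐ c₂ [ ids ▷ a ] ∈ M [ ids ▷ inr a ]

    Σ-F : Γ ⊢ A type → Γ ▸ A ⊢ B type → Γ ⊢ Σ A B type
    Σ-≐ : Γ ⊢ A ≐ A' type → Γ ▸ A ⊢ B ≐ B' type → Γ ⊢ Σ A B ≐ Σ A' B' type
    Σ-I : Γ ⊢ A type → Γ ▸ A ⊢ B type → Γ ⊢ a ∈ A → Γ ⊢ b ∈ B [ ids ▷ a ] → Γ ⊢ pair a b ∈ Σ A B
    Σ-E : Γ ⊢ A type → Γ ▸ A ⊢ B type → Γ ▸ Σ A B ⊢ M type → Γ ⊢ d ∈ Σ A B →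
      Γ ▸ A ▸ B ⊢ c ∈ M [ ↑ 2 ▷ pair v₁ v₀ ] → Γ ⊢ split d c ∈ M [ ids ▷ d ]
    Σ-β : Γ ⊢ A type → Γ ▸ A ⊢ B type → Γ ▸ Σ A B ⊢ M type → Γ ⊢ a ∈ A → Γ ⊢ b ∈ B [ ids ▷ a ] →
      Γ ▸ A ▸ B ⊢ c ∈ M [ ↑ 2 ▷ pair v₁ v₀ ] →
      Γ ⊢ split (pair a b) c ≐ c [ ids ▷ a ▷ b ] ∈ M [ ids ▷ pair a b ]

    Π-F : Γ ⊢ A type → Γ ▸ A ⊢ B type → Γ ⊢ Π A B type
    Π-≐ : Γ ⊢ A ≐ A' type → Γ ▸ A ⊢ B ≐ B' type → Γ ⊢ Π A B ≐ Π A' B' type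
    Π-I : Γ ⊢ A type → Γ ▸ A ⊢ B type → Γ ▸ A ⊢ b₁ ∈ B → Γ ⊢ ƛ b₁ ∈ Π A B
    Π-E : Γ ⊢ A type → Γ ▸ A ⊢ B type → Γ ⊢ f ∈ Π A B → Γ ⊢ a ∈ A → Γ ⊢ ap f a ∈ B [ ids ▷ a ]
    Π-β : Γ ⊢ A type → Γ ▸ A ⊢ B type → Γ ▸ A ⊢ b₁ ∈ B → Γ ⊢ a ∈ A →
      Γ ⊢ ap (ƛ b₁) a ≐ b₁ [ ids ▷ a ] ∈ B [ ids ▷ a ]

    Id-F : Γ ⊢ A type → Γ ⊢ a ∈ A → Γ ⊢ b ∈ A → Γ ⊢ Id A a b type
    Id-≐ : Γ ⊢ A ≐ A' type → Γ ⊢ a ≐ a' ∈ A → Γ ⊢ b ≐ b' ∈ A → Γ ⊢ Id A a b ≐ Id A' a' b' type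
    Id-I : Γ ⊢ A type → Γ ⊢ a ∈ A → Γ ⊢ rfl a ∈ Id A a a
    Id-E : Γ ⊢ A type → Γ ▸ A ▸ A [ ↑ 1 ] ▸ Id (A [ ↑ 2 ]) v₁ v₀ ⊢ Q type →
      Γ ⊢ a ∈ A → Γ ⊢ b ∈ A → Γ ⊢ p ∈ Id A a b →
      Γ ▸ A ⊢ c₁ ∈ Q [ ↑ 1 ▷ v₀ ▷ v₀ ▷ rfl v₀ ] → Γ ⊢ J p c₁ ∈ Q [ ids ▷ a ▷ b ▷ p ]
    Id-β : Γ ⊢ A type → Γ ▸ A ▸ A [ ↑ 1 ] ▸ Id (A [ ↑ 2 ]) v₁ v₀ ⊢ Q type → Γ ⊢ a ∈ A →
      Γ ▸ A ⊢ c₁ ∈ Q [ ↑ 1 ▷ v₀ ▷ v₀ ▷ rfl v₀ ] →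
      Γ ⊢ J (rfl a) c₁ ≐ c₁ [ ids ▷ a ] ∈ Q [ ids ▷ a ▷ a ▷ rfl a ]

    U₀-F : Γ ctx → Γ ⊢ U₀ type
    T-F  : Γ ⊢ a ∈ U₀ → Γ ⊢ T a type
    T-≐  : Γ ⊢ a ≐ b ∈ U₀ → Γ ⊢ T a ≐ T b type
    N₀ᶜ-I   : Γ ctx → Γ ⊢ N₀ᶜ ∈ U₀
    N₁ᶜ-I   : Γ ctx → Γ ⊢ N₁ᶜ ∈ U₀
    Nᶜ-I    : Γ ctx → Γ ⊢ Nᶜ ∈ U₀
    Listᶜ-I : Γ ⊢ a ∈ U₀ → Γ ⊢ Listᶜ a ∈ U₀
    ⊕ᶜ-I    : Γ ⊢ a ∈ U₀ → Γ ⊢ b ∈ U₀ → Γ ⊢ a ⊕ᶜ b ∈ U₀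
    Σᶜ-I    : Γ ⊢ a ∈ U₀ → Γ ▸ T a ⊢ b₁ ∈ U₀ → Γ ⊢ Σᶜ a b₁ ∈ U₀
    Πᶜ-I    : Γ ⊢ a ∈ U₀ → Γ ▸ T a ⊢ b₁ ∈ U₀ → Γ ⊢ Πᶜ a b₁ ∈ U₀
    Idᶜ-I   : Γ ⊢ a ∈ U₀ → Γ ⊢ b ∈ T a → Γ ⊢ d ∈ T a → Γ ⊢ Idᶜ a b d ∈ U₀
    T-N₀   : Γ ctx → Γ ⊢ T N₀ᶜ ≐ N₀ type
    T-N₁   : Γ ctx → Γ ⊢ T N₁ᶜ ≐ N₁ type
    T-N    : Γ ctx → Γ ⊢ T Nᶜ ≐ N type
    T-List : Γ ⊢ a ∈ U₀ → Γ ⊢ T (Listᶜ a) ≐ List (T a) type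
    T-⊕    : Γ ⊢ a ∈ U₀ → Γ ⊢ b ∈ U₀ → Γ ⊢ T (a ⊕ᶜ b) ≐ T a ⊕ T b type
    T-Σ    : Γ ⊢ a ∈ U₀ → Γ ▸ T a ⊢ b₁ ∈ U₀ → Γ ⊢ T (Σᶜ a b₁) ≐ Σ (T a) (T b₁) type
    T-Π    : Γ ⊢ a ∈ U₀ → Γ ▸ T a ⊢ b₁ ∈ U₀ → Γ ⊢ T (Πᶜ a b₁) ≐ Π (T a) (T b₁) type
    T-Id   : Γ ⊢ a ∈ U₀ → Γ ⊢ b ∈ T a → Γ ⊢ d ∈ T a → Γ ⊢ T (Idᶜ a b d) ≐ Id (T a) b d type

    cover-F : AxiomSet Γ s i c → Γ ⊢ v ∈ T s ⇒ U₀ → Γ ⊢ a ∈ T s → Γ ⊢ coverᶜ s i c v a ∈ U₀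
    cover-rf : AxiomSet Γ s i c → Γ ⊢ v ∈ T s ⇒ U₀ → Γ ⊢ a ∈ T s → Γ ⊢ r ∈ a ε v →
      Γ ⊢ rf a r ∈ T (coverᶜ s i c v a)
    cover-tr : AxiomSet Γ s i c → Γ ⊢ v ∈ T s ⇒ U₀ → Γ ⊢ a ∈ T s → Γ ⊢ j ∈ T (i [ ids ▷ a ]) →
      Γ ⊢ r ∈ below s (c [ ids ▷ a ▷ j ]) (coverₛ (↑ 2) s i c v v₁) →
      Γ ⊢ tr a j r ∈ T (coverᶜ s i c v a)
    cover-E : AxiomSet Γ s i c → Γ ⊢ v ∈ T s ⇒ U₀ → Γ ▸ T s ▸ coverₛ (↑ 1) s i c v v₀ ⊢ P type →
      Γ ⊢ a ∈ T s → Γ ⊢ t ∈ T (coverᶜ s i c v a) →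
      Γ ▸ T s ▸ v₀ ε v [ ↑ 1 ] ⊢ q₁ ∈ P [ ↑ 2 ▷ v₁ ▷ rf v₁ v₀ ] →
      Γ ▸ T s ▸ T i ▸ below (s [ ↑ 2 ]) c (coverₛ (↑ 4) s i c v v₁)
        ▸ below (s [ ↑ 3 ]) (c [ ↑ 1 ]) (P [ ↑ 5 ▷ v₁ ▷ ap (ap v₂ v₁) v₀ ]) ⊢ q₂ ∈ P [ ↑ 4 ▷ v₃ ▷ tr v₃ v₂ v₁ ] →
      Γ ⊢ ind t q₁ q₂ ∈ P [ ids ▷ a ▷ t ]
    cover-β-rf : AxiomSet Γ s i c → Γ ⊢ v ∈ T s ⇒ U₀ → Γ ▸ T s ▸ coverₛ (↑ 1) s i c v v₀ ⊢ P type →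
      Γ ⊢ a ∈ T s → Γ ⊢ r ∈ a ε v →
      Γ ▸ T s ▸ v₀ ε v [ ↑ 1 ] ⊢ q₁ ∈ P [ ↑ 2 ▷ v₁ ▷ rf v₁ v₀ ] →
      Γ ▸ T s ▸ T i ▸ below (s [ ↑ 2 ]) c (coverₛ (↑ 4) s i c v v₁)
        ▸ below (s [ ↑ 3 ]) (c [ ↑ 1 ]) (P [ ↑ 5 ▷ v₁ ▷ ap (ap v₂ v₁) v₀ ]) ⊢ q₂ ∈ P [ ↑ 4 ▷ v₃ ▷ tr v₃ v₂ v₁ ] →
      Γ ⊢ ind (rf a r) q₁ q₂ ≐ q₁ [ ids ▷ a ▷ r ] ∈ P [ ids ▷ a ▷ rf a r ]
    cover-β-tr : AxiomSet Γ s i c → Γ ⊢ v ∈ T s ⇒ U₀ → Γ ▸ T s ▸ coverₛ (↑ 1) s i c v v₀ ⊢ P type →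
      Γ ⊢ a ∈ T s → Γ ⊢ j ∈ T (i [ ids ▷ a ]) →
      Γ ⊢ r ∈ below s (c [ ids ▷ a ▷ j ]) (coverₛ (↑ 2) s i c v v₁) →
      Γ ▸ T s ▸ v₀ ε v [ ↑ 1 ] ⊢ q₁ ∈ P [ ↑ 2 ▷ v₁ ▷ rf v₁ v₀ ] →
      Γ ▸ T s ▸ T i ▸ below (s [ ↑ 2 ]) c (coverₛ (↑ 4) s i c v v₁)
        ▸ below (s [ ↑ 3 ]) (c [ ↑ 1 ]) (P [ ↑ 5 ▷ v₁ ▷ ap (ap v₂ v₁) v₀ ]) ⊢ q₂ ∈ P [ ↑ 4 ▷ v₃ ▷ tr v₃ v₂ v₁ ] →
      Γ ⊢ ind (tr a j r) q₁ q₂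
        ≐ q₂ [ ids ▷ a ▷ j ▷ r ▷ ƛ (ƛ (ind (ap (ap (r [ ↑ 2 ]) v₁) v₀) (q₁ [ lift 2 (↑ 2) ]) (q₂ [ lift 4 (↑ 2) ]))) ]
        ∈ P [ ids ▷ a ▷ tr a j r ]

    positive-F : AxiomSet Γ s i c → Γ ⊢ v ∈ T s ⇒ U₀ → Γ ⊢ a ∈ T s → Γ ⊢ positiveᶜ s i c v a ∈ U₀
    positive-ax₁ : AxiomSet Γ s i c → Γ ⊢ v ∈ T s ⇒ U₀ → Γ ⊢ a ∈ T s → Γ ⊢ q ∈ T (positiveᶜ s i c v a) →
      Γ ⊢ ax₁ a q ∈ a ε v
    positive-ax₂ : AxiomSet Γ s i c → Γ ⊢ v ∈ T s ⇒ U₀ → Γ ⊢ a ∈ T s → Γ ⊢ j ∈ T (i [ ids ▷ a ]) →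
      Γ ⊢ q ∈ T (positiveᶜ s i c v a) →
      Γ ⊢ ax₂ a j q ∈ Σ (T s) (v₀ ε c [ ids ▷ a ▷ j ] [ ↑ 1 ] ⊗ positiveₛ (↑ 1) s i c v v₀)
    positive-ax₃ : AxiomSet Γ s i c → Γ ⊢ v ∈ T s ⇒ U₀ → Γ ▸ T s ⊢ P₁ type → Γ ⊢ a ∈ T s →
      Γ ⊢ t ∈ P₁ [ ids ▷ a ] →
      Γ ▸ T s ▸ P₁ ⊢ q₁ ∈ v₁ ε v [ ↑ 2 ] →
      Γ ▸ T s ▸ T i ▸ P₁ [ ↑ 2 ▷ v₁ ] ⊢ q₃ ∈ Σ (T (s [ ↑ 3 ])) (v₀ ε c [ ↑ 2 ] ⊗ P₁ [ ↑ 4 ▷ v₀ ]) →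
      Γ ⊢ ax₃ t q₁ q₃ ∈ T (positiveᶜ s i c v a)

    CT-ax : Γ ctx → Γ ⊢ church ∈ CT

  Consistent : Set
  Consistent = ∀ t → ¬ (∙ ⊢ t ∈ N₀)

module Interpretation where

  module M = mTT
  module L = MLtt

  open L using (v₀; v₁; _[_]; ↑)

  -- (z ∈ (∀ x ∈ A)(∃ y ∈ B) R) ↦ ⟨ λ x. π₁(z x) , λ x. π₂(z x) ⟩
  choiceTerm : ∀ {n} → L.Term n
  choiceTerm = L.ƛ (L.pair (L.ƛ (L.split (L.ap v₁ v₀) v₁)) (L.ƛ (L.split (L.ap v₁ v₀) v₀)))

  -- From (Σ y ∈ A)(B × C) to (Σ y ∈ A)(C × B): the conjuncts in the last
  -- premise of the two rules for ax₃ are in opposite order.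
  swap : ∀ {n} → L.Term n → L.Term n
  swap t = L.split t (L.pair v₁ (L.split v₀ (L.pair v₀ v₁)))

  -- A set or small proposition as a term is its code in U₀.  The clause for
  -- prop_s is arbitrary, as prop_s is never an element of a collection.
  ‖_‖ₜ : ∀ {n} → M.Expr n → L.Term n
  ‖ M.var x ‖ₜ              = L.var x
  ‖ M.N₀ ‖ₜ                 = L.N₀ᶜ
  ‖ M.N₁ ‖ₜ                 = L.N₁ᶜ
  ‖ M.N ‖ₜ                  = L.Nᶜ
  ‖ M.List A ‖ₜ             = L.Listᶜ ‖ A ‖ₜ
  ‖ A M.⊕ B ‖ₜ              = ‖ A ‖ₜ L.⊕ᶜ ‖ B ‖ₜ
  ‖ M.Σ A B ‖ₜ              = L.Σᶜ ‖ A ‖ₜ ‖ B ‖ₜ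
  ‖ M.Π A B ‖ₜ              = L.Πᶜ ‖ A ‖ₜ ‖ B ‖ₜ
  ‖ M.⊥ ‖ₜ                  = L.N₀ᶜ
  ‖ φ M.∧ ψ ‖ₜ              = L.Σᶜ ‖ φ ‖ₜ (‖ ψ ‖ₜ [ ↑ 1 ])
  ‖ φ M.∨ ψ ‖ₜ              = ‖ φ ‖ₜ L.⊕ᶜ ‖ ψ ‖ₜ
  ‖ φ M.⇒ ψ ‖ₜ              = L.Πᶜ ‖ φ ‖ₜ (‖ ψ ‖ₜ [ ↑ 1 ])
  ‖ M.All A φ ‖ₜ            = L.Πᶜ ‖ A ‖ₜ ‖ φ ‖ₜ
  ‖ M.Ex A φ ‖ₜ             = L.Σᶜ ‖ A ‖ₜ ‖ φ ‖ₜ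
  ‖ M.Id A a b ‖ₜ           = L.Idᶜ ‖ A ‖ₜ ‖ a ‖ₜ ‖ b ‖ₜ
  ‖ M.Propₛ ‖ₜ              = L.⋆
  ‖ M.cover A I C V a ‖ₜ    = L.coverᶜ ‖ A ‖ₜ ‖ I ‖ₜ ‖ C ‖ₜ ‖ V ‖ₜ ‖ a ‖ₜ
  ‖ M.positive A I C V a ‖ₜ = L.positiveᶜ ‖ A ‖ₜ ‖ I ‖ₜ ‖ C ‖ₜ ‖ V ‖ₜ ‖ a ‖ₜ
  ‖ M.abort c ‖ₜ            = L.abort ‖ c ‖ₜ
  ‖ M.⋆ ‖ₜ                  = L.⋆
  ‖ M.ElN₁ t c ‖ₜ           = L.ElN₁ ‖ t ‖ₜ ‖ c ‖ₜ
  ‖ M.ze ‖ₜ                 = L.ze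
  ‖ M.su t ‖ₜ               = L.su ‖ t ‖ₜ
  ‖ M.ElN t c l ‖ₜ          = L.ElN ‖ t ‖ₜ ‖ c ‖ₜ ‖ l ‖ₜ
  ‖ M.nil ‖ₜ                = L.nil
  ‖ M.cons a s ‖ₜ           = L.cons ‖ a ‖ₜ ‖ s ‖ₜ
  ‖ M.ElList t c l ‖ₜ       = L.ElList ‖ t ‖ₜ ‖ c ‖ₜ ‖ l ‖ₜ
  ‖ M.inl a ‖ₜ              = L.inl ‖ a ‖ₜ
  ‖ M.inr b ‖ₜ              = L.inr ‖ b ‖ₜ
  ‖ M.case d c₁ c₂ ‖ₜ       = L.case ‖ d ‖ₜ ‖ c₁ ‖ₜ ‖ c₂ ‖ₜ
  ‖ M.pair a b ‖ₜ           = L.pair ‖ a ‖ₜ ‖ b ‖ₜ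
  ‖ M.split d c ‖ₜ          = L.split ‖ d ‖ₜ ‖ c ‖ₜ
  ‖ M.ƛ b ‖ₜ                = L.ƛ ‖ b ‖ₜ
  ‖ M.ap f a ‖ₜ             = L.ap ‖ f ‖ₜ ‖ a ‖ₜ
  ‖ M.rfl a ‖ₜ              = L.rfl ‖ a ‖ₜ
  ‖ M.ElId p c ‖ₜ           = L.J ‖ p ‖ₜ ‖ c ‖ₜ
  ‖ M.rf a r ‖ₜ             = L.rf ‖ a ‖ₜ ‖ r ‖ₜ
  ‖ M.tr a j r ‖ₜ           = L.tr ‖ a ‖ₜ ‖ j ‖ₜ ‖ r ‖ₜ
  ‖ M.ind m q₁ q₂ ‖ₜ        = L.ind ‖ m ‖ₜ ‖ q₁ ‖ₜ ‖ q₂ ‖ₜ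
  ‖ M.ax₁ a q ‖ₜ            = L.ax₁ ‖ a ‖ₜ ‖ q ‖ₜ
  ‖ M.ax₂ a i q ‖ₜ          = L.ax₂ ‖ a ‖ₜ ‖ i ‖ₜ ‖ q ‖ₜ
  ‖ M.ax₃ a m q₁ q₂ ‖ₜ      = L.ax₃ ‖ m ‖ₜ ‖ q₁ ‖ₜ (swap ‖ q₂ ‖ₜ)
  ‖ M.choice ‖ₜ             = choiceTerm
  ‖ M.church ‖ₜ             = L.church

  ‖_‖ᵀ : ∀ {n} → M.Expr n → L.Type n
  ‖ M.N₀ ‖ᵀ       = L.N₀
  ‖ M.N₁ ‖ᵀ       = L.N₁
  ‖ M.N ‖ᵀ        = L.N
  ‖ M.List A ‖ᵀ   = L.List ‖ A ‖ᵀ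
  ‖ A M.⊕ B ‖ᵀ    = ‖ A ‖ᵀ L.⊕ ‖ B ‖ᵀ
  ‖ M.Σ A B ‖ᵀ    = L.Σ ‖ A ‖ᵀ ‖ B ‖ᵀ
  ‖ M.Π A B ‖ᵀ    = L.Π ‖ A ‖ᵀ ‖ B ‖ᵀ
  ‖ M.⊥ ‖ᵀ        = L.N₀
  ‖ φ M.∧ ψ ‖ᵀ    = ‖ φ ‖ᵀ L.⊗ ‖ ψ ‖ᵀ
  ‖ φ M.∨ ψ ‖ᵀ    = ‖ φ ‖ᵀ L.⊕ ‖ ψ ‖ᵀ
  ‖ φ M.⇒ ψ ‖ᵀ    = ‖ φ ‖ᵀ L.⇒ ‖ ψ ‖ᵀ
  ‖ M.All A φ ‖ᵀ  = L.Π ‖ A ‖ᵀ ‖ φ ‖ᵀ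
  ‖ M.Ex A φ ‖ᵀ   = L.Σ ‖ A ‖ᵀ ‖ φ ‖ᵀ
  ‖ M.Id A a b ‖ᵀ = L.Id ‖ A ‖ᵀ ‖ a ‖ₜ ‖ b ‖ₜ
  ‖ M.Propₛ ‖ᵀ    = L.U₀
  -- The covers and positivity relations, whose decodings are written with T,
  -- and the elements of prop_s such as x or Ap(V , a).
  ‖ e ‖ᵀ          = L.T ‖ e ‖ₜ

  ‖_‖ᶜ : ∀ {n} → M.Context n → L.Context n
  ‖ M.∙ ‖ᶜ     = L.∙
  ‖ Γ M.▸ A ‖ᶜ = ‖ Γ ‖ᶜ L.▸ ‖ A ‖ᵀ

  ‖_‖ᴶ : ∀ {n} → M.Judgement n → L.Judgement n
  ‖ A M.is k ‖ᴶ       = ‖ A ‖ᵀ L.type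
  ‖ A M.≐ B is k ‖ᴶ   = ‖ A ‖ᵀ L.≐ ‖ B ‖ᵀ type
  ‖ a M.∈ A ‖ᴶ        = ‖ a ‖ₜ L.∈ ‖ A ‖ᵀ
  ‖ a M.≐ b ∈ A ‖ᴶ    = ‖ a ‖ₜ L.≐ ‖ b ‖ₜ ∈ ‖ A ‖ᵀ

{-# OPTIONS --safe #-}
module Submission where

-- Substituting a small proposition for a variable of type prop_s turns the type
-- T(x) of MLtt_cind into the decoding of a code, whereas the interpretation of
-- the instance is the decoded type itself.  So ‖-‖ᵀ commutes with substitution
-- only up to the equalities T(Σᶜ a b) ≐ Σ (T a) (T b) etc., and these need typing
-- information.  It is read off from the MLtt_cind side alone: from a derivation of
-- Γ ⊢ Σᶜ a b ∈ X one recovers derivations for a and b, hence whenever ‖ e ‖ₜ ∈ U₀ is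
-- derivable, T ‖ e ‖ₜ ≐ ‖ e ‖ᵀ follows by induction on e, provided prop_s is not a
-- part of the type e, which holds for all elements and all small types of
-- mTT_cind.  Together with the presuppositions of MLtt_cind this gives soundness
-- by induction on derivations; AC holds by the strength of Σ.

open import Defs
open import Data.Product.Base using (_×_)
open Interpretation
open import Data.Bool.Base using (Bool; true; false)
open import Data.Fin.Base using (Fin; zero; suc; _↑ʳ_)
import Data.List.Base as Lists
open import Data.Nat.Base using (ℕ; zero; suc; _+_)
open import Data.Product.Base using (_,_; proj₁; proj₂)
open import Data.Unit.Base using (⊤; tt)
open import Function.Base using (_∘_)
import Relation.Binary.PropositionalEquality as ≡
open ≡ using (_≡_; refl; sym; trans; cong; cong₂; _≗_)

-- Substitution is a primitive rule of MLtt_cind, so a code former may enter a derivation only as a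
-- component of a substitution, and the premises recovered by inversion have to be carried through
-- that rule. Inversion goes no further than formation premises: no injectivity of type formers and
-- no normalisation is used. The repair at variables also forces a strengthened induction. The
-- interpreted judgements have to remember that a small type has its code in `U₀` and that every
-- term is of small shape, for these are the facts that `decode` consumes when a term is put for a
-- variable of type prop_s. Renamings are treated before substitutions. They put variables for
-- variables, so nothing is decoded and `‖_‖ᵀ` commutes with them on the nose; this keeps weakenings
-- free of conversions.

-- Renaming and substitution of raw expressions.

module Substitution (Sort : Set) (tm : Sort)
                    (Op : Sort → Set) (arity : ∀ {s} → Op s → Lists.List (ℕ × Sort)) where

  open Syntax Sort tm Op arity

  private variable
    n m l : ℕ
    s : Sort
    ks : Lists.List (ℕ × Sort)

  liftᴿ-∘ : {ρ' : Ren m l} {ρ : Ren n m} {ρ″ : Ren n l} → ρ' ∘ ρ ≗ ρ″ → ∀ k → liftᴿ k ρ' ∘ liftᴿ k ρ ≗ liftᴿ k ρ″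
  liftᴿ-∘ h zero    i       = h i
  liftᴿ-∘ h (suc k) zero    = refl
  liftᴿ-∘ h (suc k) (suc i) = cong suc (liftᴿ-∘ h k i)

  -- Each composition law takes the composite as a separate map with a pointwise equation, since
  -- substitutions are functions and are compared without extensionality; `λ _ → refl` serves when
  -- the composite is definitional. The laws come in four stages because lifting a substitution
  -- under a binder uses a renaming.
  ren-ren  : {ρ' : Ren m l} {ρ : Ren n m} {ρ″ : Ren n l} → ρ' ∘ ρ ≗ ρ″ → (e : Exp s n) → ren ρ' (ren ρ e) ≡ ren ρ″ e
  ren-renᵃ : {ρ' : Ren m l} {ρ : Ren n m} {ρ″ : Ren n l} → ρ' ∘ ρ ≗ ρ″ → (a : Args ks n) → renᵃ ρ' (renᵃ ρ a) ≡ renᵃ ρ″ a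
  ren-ren h (var i)  = cong var (h i)
  ren-ren h (op o a) = cong (op o) (ren-renᵃ h a)
  ren-renᵃ h ⟨⟩                = refl
  ren-renᵃ h (_◂_ {k = k} e a) = cong₂ _◂_ (ren-ren (liftᴿ-∘ h k) e) (ren-renᵃ h a)

  lift-∘ : {σ : Sub m l} {ρ : Ren n m} {τ : Sub n l} → σ ∘ ρ ≗ τ → ∀ k → lift k σ ∘ liftᴿ k ρ ≗ lift k τ
  lift-∘ h zero    i       = h i
  lift-∘ h (suc k) zero    = refl
  lift-∘ h (suc k) (suc i) = cong (ren suc) (lift-∘ h k i)

  ren-sub  : {σ : Sub m l} {ρ : Ren n m} {τ : Sub n l} → σ ∘ ρ ≗ τ → (e : Exp s n) → ren ρ e [ σ ] ≡ e [ τ ]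
  ren-subᵃ : {σ : Sub m l} {ρ : Ren n m} {τ : Sub n l} → σ ∘ ρ ≗ τ → (a : Args ks n) → renᵃ ρ a [ σ ]ᵃ ≡ a [ τ ]ᵃ
  ren-sub h (var i)  = h i
  ren-sub h (op o a) = cong (op o) (ren-subᵃ h a)
  ren-subᵃ h ⟨⟩                = refl
  ren-subᵃ h (_◂_ {k = k} e a) = cong₂ _◂_ (ren-sub (lift-∘ h k) e) (ren-subᵃ h a)

  ren-lift : {ρ : Ren m l} {σ : Sub n m} {τ : Sub n l} → ren ρ ∘ σ ≗ τ → ∀ k → ren (liftᴿ k ρ) ∘ lift k σ ≗ lift k τ
  ren-lift h zero    i    = h i
  ren-lift h (suc k) zero = refl
  ren-lift {ρ = ρ} {σ} h (suc k) (suc i) =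
    trans (trans (ren-ren (λ _ → refl) (lift k σ i)) (sym (ren-ren (λ _ → refl) (lift k σ i))))
          (cong (ren suc) (ren-lift h k i))

  sub-ren  : {ρ : Ren m l} {σ : Sub n m} {τ : Sub n l} → ren ρ ∘ σ ≗ τ → (e : Exp s n) → ren ρ (e [ σ ]) ≡ e [ τ ]
  sub-renᵃ : {ρ : Ren m l} {σ : Sub n m} {τ : Sub n l} → ren ρ ∘ σ ≗ τ → (a : Args ks n) → renᵃ ρ (a [ σ ]ᵃ) ≡ a [ τ ]ᵃ
  sub-ren h (var i)  = h i
  sub-ren h (op o a) = cong (op o) (sub-renᵃ h a)
  sub-renᵃ h ⟨⟩                = refl
  sub-renᵃ h (_◂_ {k = k} e a) = cong₂ _◂_ (sub-ren (ren-lift h k) e) (sub-renᵃ h a)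

  lift-sub : {τ : Sub m l} {σ : Sub n m} {υ : Sub n l} → (_[ τ ]) ∘ σ ≗ υ → ∀ k → (_[ lift k τ ]) ∘ lift k σ ≗ lift k υ
  lift-sub h zero    i    = h i
  lift-sub h (suc k) zero = refl
  lift-sub {τ = τ} {σ} h (suc k) (suc i) =
    trans (trans (ren-sub (λ _ → refl) (lift k σ i)) (sym (sub-ren (λ _ → refl) (lift k σ i))))
          (cong (ren suc) (lift-sub h k i))

  sub-sub  : {τ : Sub m l} {σ : Sub n m} {υ : Sub n l} → (_[ τ ]) ∘ σ ≗ υ → (e : Exp s n) → e [ σ ] [ τ ] ≡ e [ υ ]
  sub-subᵃ : {τ : Sub m l} {σ : Sub n m} {υ : Sub n l} → (_[ τ ]) ∘ σ ≗ υ → (a : Args ks n) → a [ σ ]ᵃ [ τ ]ᵃ ≡ a [ υ ]ᵃ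
  sub-sub h (var i)  = h i
  sub-sub h (op o a) = cong (op o) (sub-subᵃ h a)
  sub-subᵃ h ⟨⟩                = refl
  sub-subᵃ h (_◂_ {k = k} e a) = cong₂ _◂_ (sub-sub (lift-sub h k) e) (sub-subᵃ h a)

  lift-cong : {σ τ : Sub n m} → σ ≗ τ → ∀ k → lift k σ ≗ lift k τ
  lift-cong h zero    i       = h i
  lift-cong h (suc k) zero    = refl
  lift-cong h (suc k) (suc i) = cong (ren suc) (lift-cong h k i)

  sub-cong  : {σ τ : Sub n m} → σ ≗ τ → (e : Exp s n) → e [ σ ] ≡ e [ τ ]
  sub-congᵃ : {σ τ : Sub n m} → σ ≗ τ → (a : Args ks n) → a [ σ ]ᵃ ≡ a [ τ ]ᵃ
  sub-cong h (var i)  = h i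
  sub-cong h (op o a) = cong (op o) (sub-congᵃ h a)
  sub-congᵃ h ⟨⟩                = refl
  sub-congᵃ h (_◂_ {k = k} e a) = cong₂ _◂_ (sub-cong (lift-cong h k) e) (sub-congᵃ h a)

  lift-ids : {σ : Sub n n} → σ ≗ ids → ∀ k → lift k σ ≗ ids
  lift-ids h zero    i       = h i
  lift-ids h (suc k) zero    = refl
  lift-ids h (suc k) (suc i) = cong (ren suc) (lift-ids h k i)

  sub-ids  : {σ : Sub n n} → σ ≗ ids → (e : Exp s n) → e [ σ ] ≡ e
  sub-idsᵃ : {σ : Sub n n} → σ ≗ ids → (a : Args ks n) → a [ σ ]ᵃ ≡ a
  sub-ids h (var i)  = h i
  sub-ids h (op o a) = cong (op o) (sub-idsᵃ h a)
  sub-idsᵃ h ⟨⟩                = refl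
  sub-idsᵃ h (_◂_ {k = k} e a) = cong₂ _◂_ (sub-ids (lift-ids h k) e) (sub-idsᵃ h a)

  ren-as-sub : (ρ : Ren n m) (e : Exp s n) → ren ρ e ≡ e [ var ∘ ρ ]
  ren-as-sub ρ e = trans (sym (sub-ids (λ _ → refl) (ren ρ e))) (ren-sub (λ _ → refl) e)

  sub-square : {m' : ℕ} {τ : Sub m l} {σ : Sub n m} {τ' : Sub m' l} {σ' : Sub n m'} →
    (∀ i → σ i [ τ ] ≡ σ' i [ τ' ]) → (e : Exp s n) → e [ σ ] [ τ ] ≡ e [ σ' ] [ τ' ]
  sub-square h e = trans (sub-sub h e) (sym (sub-sub (λ _ → refl) e))

  sub-section : {τ : Sub m n} {σ : Sub n m} → (∀ i → σ i [ τ ] ≡ var i) → (e : Exp s n) → e [ σ ] [ τ ] ≡ e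
  sub-section h e = trans (sub-sub h e) (sub-ids (λ _ → refl) e)

  lift-↑ʳ : ∀ k (σ : Sub n m) i → lift k σ (k ↑ʳ i) ≡ σ i [ ↑ k ]
  lift-↑ʳ zero    σ i = sym (sub-ids (λ _ → refl) (σ i))
  lift-↑ʳ (suc k) σ i =
    trans (cong (ren suc) (lift-↑ʳ k σ i)) (sub-ren (λ _ → refl) (σ i))

-- Typed substitutions and change of context in MLtt_cind.

module MLttProperties where

  open MLtt
  open Substitution Sort tm Operator arity public
  open Kleene using (PR; #; zero; suc; rec; comp; kleeneT; kleeneU)

  private variable
    n m : ℕ
    so : Sort
    Γ : Context n
    Δ Θ : Context m
    𝒥 : Judgement n
    A A' D : Type n
    B B' : Type (1 + n)
    P : Type (2 + n)
    a a' b d f j p r s s' t u v v' : Term n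
    i i' b₁ : Term (1 + n)
    c c' q₁ : Term (2 + n)
    q₂ : Term (4 + n)
    σ τ υ : Sub n m

  cast : A ≡ A' → Γ ⊢ a ∈ A → Γ ⊢ a ∈ A'
  cast refl d = d

  cast-type : A ≡ A' → Γ ⊢ A type → Γ ⊢ A' type
  cast-type refl d = d

  wk-▷ : (e : Exp so n) → e [ ↑ 1 ] [ σ ▷ a ] ≡ e [ σ ]
  wk-▷ = sub-sub (λ _ → refl)

  wk-inst : (e : Exp so n) → e [ ↑ 1 ] [ ids ▷ a ] ≡ e
  wk-inst = sub-section (λ _ → refl)

  wk-lift : ∀ k (σ : Sub n m) (e : Exp so n) → e [ ↑ k ] [ lift k σ ] ≡ e [ σ ] [ ↑ k ]
  wk-lift k σ = sub-square (lift-↑ʳ k σ)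

  infix 3 _⊢ˢ_∶_
  record _⊢ˢ_∶_ (Δ : Context m) (σ : Sub n m) (Γ : Context n) : Set where
    constructor typedSub
    field
      target : Δ ctx
      terms  : ∀ x → Δ ⊢ σ x ∈ (Γ ‼ x) [ σ ]
  open _⊢ˢ_∶_ public

  sub : Δ ⊢ˢ σ ∶ Γ → Γ ⊢ 𝒥 → Δ ⊢ 𝒥 [ σ ]ᴶ
  sub h d = subst _ d (target h) (terms h)

  ⊢ids : Γ ctx → Γ ⊢ˢ ids ∶ Γ
  ⊢ids g = typedSub g λ x → cast (sym (sub-ids (λ _ → refl) _)) (var-∈ g x)

  ⊢▷ : Δ ⊢ˢ σ ∶ Γ → Δ ⊢ a ∈ A [ σ ] → Δ ⊢ˢ σ ▷ a ∶ Γ ▸ A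
  ⊢▷ {A = A} h d .target = target h
  ⊢▷ {A = A} h d .terms zero    = cast (sym (wk-▷ A)) d
  ⊢▷ {Γ = Γ} h d .terms (suc x) = cast (sym (wk-▷ (Γ ‼ x))) (terms h x)

  ⊢inst : Γ ctx → Γ ⊢ a ∈ A → Γ ⊢ˢ ids ▷ a ∶ Γ ▸ A
  ⊢inst g d = ⊢▷ (⊢ids g) (cast (sym (sub-ids (λ _ → refl) _)) d)

  ⊢↑ : Γ ▸ A ctx → Γ ▸ A ⊢ˢ ↑ 1 ∶ Γ
  ⊢↑ g = typedSub g λ x → var-∈ g (suc x)

  ⊢cong : σ ≗ τ → Δ ⊢ˢ σ ∶ Γ → Δ ⊢ˢ τ ∶ Γ
  ⊢cong {Γ = Γ} e h .target = target h
  ⊢cong {Δ = Δ} {Γ = Γ} e h .terms x =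
    ≡.subst (λ t → Δ ⊢ t ∈ _) (e x) (cast (sub-cong e (Γ ‼ x)) (terms h x))

  ⊢⨟ : Δ ⊢ˢ σ ∶ Γ → Θ ⊢ˢ τ ∶ Δ → Θ ⊢ˢ (λ x → σ x [ τ ]) ∶ Γ
  ⊢⨟ h k .target = target k
  ⊢⨟ {Γ = Γ} h k .terms x = cast (sub-sub (λ _ → refl) (Γ ‼ x)) (sub k (terms h x))

  ⊢↑² : Γ ▸ A ▸ D ctx → Γ ▸ A ctx → Γ ▸ A ▸ D ⊢ˢ ↑ 2 ∶ Γ
  ⊢↑² g g' = ⊢⨟ (⊢↑ g') (⊢↑ g)

  ⊢lift : Δ ⊢ˢ σ ∶ Γ → Γ ⊢ A type → Δ ▸ A [ σ ] ⊢ˢ lift₁ σ ∶ Γ ▸ A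
  ⊢lift {σ = σ} {A = A} h d =
    ⊢▷ (⊢cong (λ x → sym (ren-as-sub suc (σ x))) (⊢⨟ h (⊢↑ g)))
       (cast (trans (sub-sub (λ _ → refl) A) (sub-cong (λ x → sym (ren-as-sub suc (σ x))) A)) (var-∈ g zero))
    where g = ▸-ctx (target h) (sub h d)

  -- Conversion of contexts is an instance of the substitution rule: between contexts whose types
  -- are pairwise equal the identity substitution is typed, and it leaves the judgement unchanged.
  recast : Δ ⊢ˢ ids ∶ Γ → Γ ⊢ 𝒥 → Δ ⊢ 𝒥
  recast {𝒥 = 𝒥} h d = ≡.subst (_ ⊢_) (ids-𝒥 𝒥) (sub h d)
    where
    ids-𝒥 : (𝒥 : Judgement n) → 𝒥 [ ids ]ᴶ ≡ 𝒥
    ids-𝒥 (A type) = cong _type (sub-ids (λ _ → refl) A)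
    ids-𝒥 (A ≐ B type) = cong₂ _≐_type (sub-ids (λ _ → refl) A) (sub-ids (λ _ → refl) B)
    ids-𝒥 (a ∈ A) = cong₂ _∈_ (sub-ids (λ _ → refl) a) (sub-ids (λ _ → refl) A)
    ids-𝒥 (a ≐ b ∈ A) rewrite sub-ids (λ _ → refl) a | sub-ids (λ _ → refl) b | sub-ids (λ _ → refl) A = refl

  ▸-recast : Δ ⊢ˢ ids ∶ Γ → Δ ⊢ D type → Δ ⊢ D ≐ A type → Δ ▸ D ⊢ˢ ids ∶ Γ ▸ A
  ▸-recast {A = A} h d e =
    ⊢cong (λ { zero → refl ; (suc x) → refl })
      (⊢▷ (⊢⨟ h (⊢↑ g)) (conv (var-∈ g zero) (sub (⊢↑ g) e)))
    where g = ▸-ctx (target h) d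

  -- Inversion of codes and of types.

  -- The codes whose decoding equation has typed premises to recover. Nullary codes have no
  -- arguments to invert, and `coverᶜ` and `positiveᶜ` have no decoding equation.
  isCodeFormer : Operator tm → Bool
  isCodeFormer `Listᶜ = true
  isCodeFormer `⊕ᶜ    = true
  isCodeFormer `Σᶜ    = true
  isCodeFormer `Πᶜ    = true
  isCodeFormer `Idᶜ   = true
  isCodeFormer _      = false

  -- As substitution is a rule, a code may be derived as an instance of a variable;
  -- its premises are then those of the term substituted for it.
  data CodePremises (Γ : Context n) : Term n → Set where
    Listᶜ-premises : Γ ⊢ a ∈ U₀ → CodePremises Γ (Listᶜ a)
    ⊕ᶜ-premises    : Γ ⊢ a ∈ U₀ → Γ ⊢ b ∈ U₀ → CodePremises Γ (a ⊕ᶜ b)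
    Σᶜ-premises    : Γ ⊢ a ∈ U₀ → Γ ▸ T a ⊢ b₁ ∈ U₀ → CodePremises Γ (Σᶜ a b₁)
    Πᶜ-premises    : Γ ⊢ a ∈ U₀ → Γ ▸ T a ⊢ b₁ ∈ U₀ → CodePremises Γ (Πᶜ a b₁)
    Idᶜ-premises   : Γ ⊢ a ∈ U₀ → Γ ⊢ b ∈ T a → Γ ⊢ d ∈ T a → CodePremises Γ (Idᶜ a b d)
    variable-term  : ∀ x → CodePremises Γ (var x)
    no-code        : {f : Operator tm} {as : Args (arity f) n} → isCodeFormer f ≡ false → CodePremises Γ (op f as)

  CodePremises-sub : Δ ⊢ˢ σ ∶ Γ → (∀ x → CodePremises Δ (σ x)) → CodePremises Γ t → CodePremises Δ (t [ σ ])
  CodePremises-sub h k (Listᶜ-premises a)   = Listᶜ-premises (sub h a)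
  CodePremises-sub h k (⊕ᶜ-premises a b)    = ⊕ᶜ-premises (sub h a) (sub h b)
  CodePremises-sub h k (Σᶜ-premises a b)    = Σᶜ-premises (sub h a) (sub (⊢lift h (T-F a)) b)
  CodePremises-sub h k (Πᶜ-premises a b)    = Πᶜ-premises (sub h a) (sub (⊢lift h (T-F a)) b)
  CodePremises-sub h k (Idᶜ-premises a b d) = Idᶜ-premises (sub h a) (sub h b) (sub h d)
  CodePremises-sub h k (variable-term x)    = k x
  CodePremises-sub h k (no-code e)          = no-code e

  -- No type of MLtt_cind is a variable, so substitution preserves the head of a type and recursion
  -- on the head suffices, in contrast to `CodePremises`.
  TypePremises : Context n → Type n → Set
  TypePremises Γ N₀         = ⊤
  TypePremises Γ N₁         = ⊤
  TypePremises Γ N          = ⊤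
  TypePremises Γ (List A)   = Γ ⊢ A type
  TypePremises Γ (A ⊕ D)    = Γ ⊢ A type × Γ ⊢ D type
  TypePremises Γ (Σ A B)    = Γ ⊢ A type × Γ ▸ A ⊢ B type
  TypePremises Γ (Π A B)    = Γ ⊢ A type × Γ ▸ A ⊢ B type
  TypePremises Γ (Id A a b) = Γ ⊢ A type × Γ ⊢ a ∈ A × Γ ⊢ b ∈ A
  TypePremises Γ U₀         = ⊤
  TypePremises Γ (T a)      = Γ ⊢ a ∈ U₀

  TypePremises-sub : (A : Type n) → Δ ⊢ˢ σ ∶ Γ → TypePremises Γ A → TypePremises Δ (A [ σ ])
  TypePremises-sub N₀         h _           = tt
  TypePremises-sub N₁         h _           = tt
  TypePremises-sub N          h _           = tt
  TypePremises-sub (List A)   h d           = sub h d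
  TypePremises-sub (A ⊕ D)    h (d , e)     = sub h d , sub h e
  TypePremises-sub (Σ A B)    h (d , e)     = sub h d , sub (⊢lift h d) e
  TypePremises-sub (Π A B)    h (d , e)     = sub h d , sub (⊢lift h d) e
  TypePremises-sub (Id A a b) h (d , e , f) = sub h d , sub h e , sub h f
  TypePremises-sub U₀         h _           = tt
  TypePremises-sub (T a)      h d           = sub h d

  Premises : Context n → Judgement n → Set
  Premises Γ (A type)     = TypePremises Γ A
  Premises Γ (A ≐ B type) = ⊤
  Premises Γ (a ∈ A)      = CodePremises Γ a
  Premises Γ (a ≐ b ∈ A)  = ⊤

  Premises-sub : Δ ⊢ˢ σ ∶ Γ → (∀ x → CodePremises Δ (σ x)) → ∀ 𝒥 → Premises Γ 𝒥 → Premises Δ (𝒥 [ σ ]ᴶ)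
  Premises-sub h k (A type)     p = TypePremises-sub A h p
  Premises-sub h k (A ≐ B type) p = tt
  Premises-sub h k (a ∈ A)      p = CodePremises-sub h k p
  Premises-sub h k (a ≐ b ∈ A)  p = tt

  context : Γ ⊢ 𝒥 → Γ ctx
  context (type-refl g) = context g
  context (type-sym g) = context g
  context (type-trans g _) = context g
  context (∈-refl g) = context g
  context (∈-sym g) = context g
  context (∈-trans g _) = context g
  context (conv g _) = context g
  context (conv-≐ g _) = context g
  context (var-∈ g _) = g
  context (subst σ _ g _) = g
  context (repl-type σ τ _ g _ _ _) = g
  context (repl-∈ σ τ _ g _ _ _) = g
  context (N₀-F g) = g
  context (N₀-E _ g) = context g
  context (N₁-F g) = g
  context (N₁-I g) = g
  context (N₁-E _ g _) = context g
  context (N₁-β _ g) = context g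
  context (N-F g) = g
  context (N-I₀ g) = g
  context (N-Iₛ g) = context g
  context (N-E _ g _ _) = context g
  context (N-β₀ _ g _) = context g
  context (N-βₛ _ g _ _) = context g
  context (List-F g) = context g
  context (List-≐ g) = context g
  context (List-I₀ g) = context g
  context (List-Iₛ g _ _) = context g
  context (List-E g _ _ _ _) = context g
  context (List-β₀ g _ _ _) = context g
  context (List-βₛ g _ _ _ _ _) = context g
  context (⊕-F g _) = context g
  context (⊕-≐ g _) = context g
  context (⊕-I₁ g _ _) = context g
  context (⊕-I₂ g _ _) = context g
  context (⊕-E g _ _ _ _ _) = context g
  context (⊕-β₁ g _ _ _ _ _) = context g
  context (⊕-β₂ g _ _ _ _ _) = context g
  context (Σ-F g _) = context g
  context (Σ-≐ g _) = context g
  context (Σ-I g _ _ _) = context g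
  context (Σ-E g _ _ _ _) = context g
  context (Σ-β g _ _ _ _ _) = context g
  context (Π-F g _) = context g
  context (Π-≐ g _) = context g
  context (Π-I g _ _) = context g
  context (Π-E g _ _ _) = context g
  context (Π-β g _ _ _) = context g
  context (Id-F g _ _) = context g
  context (Id-≐ g _ _) = context g
  context (Id-I g _) = context g
  context (Id-E g _ _ _ _ _) = context g
  context (Id-β g _ _ _) = context g
  context (U₀-F g) = g
  context (T-F g) = context g
  context (T-≐ g) = context g
  context (N₀ᶜ-I g) = g
  context (N₁ᶜ-I g) = g
  context (Nᶜ-I g) = g
  context (Listᶜ-I g) = context g
  context (⊕ᶜ-I g _) = context g
  context (Σᶜ-I g _) = context g
  context (Πᶜ-I g _) = context g
  context (Idᶜ-I g _ _) = context g
  context (T-N₀ g) = g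
  context (T-N₁ g) = g
  context (T-N g) = g
  context (T-List g) = context g
  context (T-⊕ g _) = context g
  context (T-Σ g _) = context g
  context (T-Π g _) = context g
  context (T-Id g _ _) = context g
  context (cover-F (axiomSet g _ _) _ _) = context g
  context (cover-rf (axiomSet g _ _) _ _ _) = context g
  context (cover-tr (axiomSet g _ _) _ _ _ _) = context g
  context (cover-E (axiomSet g _ _) _ _ _ _ _ _) = context g
  context (cover-β-rf (axiomSet g _ _) _ _ _ _ _ _) = context g
  context (cover-β-tr (axiomSet g _ _) _ _ _ _ _ _ _) = context g
  context (positive-F (axiomSet g _ _) _ _) = context g
  context (positive-ax₁ (axiomSet g _ _) _ _ _) = context g
  context (positive-ax₂ (axiomSet g _ _) _ _ _ _) = context g
  context (positive-ax₃ (axiomSet g _ _) _ _ _ _ _ _) = context g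
  context (CT-ax g) = g

  -- Conversion is harmless because `CodePremises` does not mention the type of the term. At the
  -- substitution rule the components of the substitution are inverted recursively, which covers a
  -- code that arises from a variable.
  premises : Γ ⊢ 𝒥 → Premises Γ 𝒥
  premises (type-refl _) = tt
  premises (type-sym _) = tt
  premises (type-trans _ _) = tt
  premises (∈-refl _) = tt
  premises (∈-sym _) = tt
  premises (∈-trans _ _) = tt
  premises (conv d _) = premises d
  premises (conv-≐ _ _) = tt
  premises (var-∈ _ x) = variable-term x
  premises (subst {Γ = Γ} {𝒥 = 𝒥} σ d g h) =
    Premises-sub (typedSub {Γ = Γ} g h) (λ x → premises (h x)) 𝒥 (premises d)
  premises (repl-type _ _ _ _ _ _ _) = tt
  premises (repl-∈ _ _ _ _ _ _ _) = tt
  premises (N₀-F _) = tt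
  premises (N₀-E _ _) = no-code refl
  premises (N₁-F _) = tt
  premises (N₁-I _) = no-code refl
  premises (N₁-E _ _ _) = no-code refl
  premises (N₁-β _ _) = tt
  premises (N-F _) = tt
  premises (N-I₀ _) = no-code refl
  premises (N-Iₛ _) = no-code refl
  premises (N-E _ _ _ _) = no-code refl
  premises (N-β₀ _ _ _) = tt
  premises (N-βₛ _ _ _ _) = tt
  premises (List-F d) = d
  premises (List-≐ _) = tt
  premises (List-I₀ _) = no-code refl
  premises (List-Iₛ _ _ _) = no-code refl
  premises (List-E _ _ _ _ _) = no-code refl
  premises (List-β₀ _ _ _ _) = tt
  premises (List-βₛ _ _ _ _ _ _) = tt
  premises (⊕-F d e) = d , e
  premises (⊕-≐ _ _) = tt
  premises (⊕-I₁ _ _ _) = no-code refl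
  premises (⊕-I₂ _ _ _) = no-code refl
  premises (⊕-E _ _ _ _ _ _) = no-code refl
  premises (⊕-β₁ _ _ _ _ _ _) = tt
  premises (⊕-β₂ _ _ _ _ _ _) = tt
  premises (Σ-F d e) = d , e
  premises (Σ-≐ _ _) = tt
  premises (Σ-I _ _ _ _) = no-code refl
  premises (Σ-E _ _ _ _ _) = no-code refl
  premises (Σ-β _ _ _ _ _ _) = tt
  premises (Π-F d e) = d , e
  premises (Π-≐ _ _) = tt
  premises (Π-I _ _ _) = no-code refl
  premises (Π-E _ _ _ _) = no-code refl
  premises (Π-β _ _ _ _) = tt
  premises (Id-F d e f) = d , e , f
  premises (Id-≐ _ _ _) = tt
  premises (Id-I _ _) = no-code refl
  premises (Id-E _ _ _ _ _ _) = no-code refl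
  premises (Id-β _ _ _ _) = tt
  premises (U₀-F _) = tt
  premises (T-F d) = d
  premises (T-≐ _) = tt
  premises (N₀ᶜ-I _) = no-code refl
  premises (N₁ᶜ-I _) = no-code refl
  premises (Nᶜ-I _) = no-code refl
  premises (Listᶜ-I d) = Listᶜ-premises d
  premises (⊕ᶜ-I d e) = ⊕ᶜ-premises d e
  premises (Σᶜ-I d e) = Σᶜ-premises d e
  premises (Πᶜ-I d e) = Πᶜ-premises d e
  premises (Idᶜ-I d e f) = Idᶜ-premises d e f
  premises (T-N₀ _) = tt
  premises (T-N₁ _) = tt
  premises (T-N _) = tt
  premises (T-List _) = tt
  premises (T-⊕ _ _) = tt
  premises (T-Σ _ _) = tt
  premises (T-Π _ _) = tt
  premises (T-Id _ _ _) = tt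
  premises (cover-F _ _ _) = no-code refl
  premises (cover-rf _ _ _ _) = no-code refl
  premises (cover-tr _ _ _ _ _) = no-code refl
  premises (cover-E _ _ _ _ _ _ _) = no-code refl
  premises (cover-β-rf _ _ _ _ _ _ _) = tt
  premises (cover-β-tr _ _ _ _ _ _ _ _) = tt
  premises (positive-F _ _ _) = no-code refl
  premises (positive-ax₁ _ _ _ _) = no-code refl
  premises (positive-ax₂ _ _ _ _ _) = no-code refl
  premises (positive-ax₃ _ _ _ _ _ _ _) = no-code refl
  premises (CT-ax _) = no-code refl

  -- Admissible rules and the formation of CT.

  inst : Γ ⊢ a ∈ A → Γ ▸ A ⊢ 𝒥 → Γ ⊢ 𝒥 [ ids ▷ a ]ᴶ
  inst d = sub (⊢inst (context d) d)

  wk : Γ ⊢ A type → Γ ⊢ 𝒥 → Γ ▸ A ⊢ 𝒥 [ ↑ 1 ]ᴶ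
  wk d = sub (⊢↑ (▸-ctx (context d) d))

  Π-E-formed : Γ ⊢ Π A B type → Γ ⊢ f ∈ Π A B → Γ ⊢ a ∈ A → Γ ⊢ ap f a ∈ B [ ids ▷ a ]
  Π-E-formed g = Π-E (proj₁ (premises g)) (proj₂ (premises g))

  ⊗-F : Γ ⊢ A type → Γ ⊢ D type → Γ ⊢ A ⊗ D type
  ⊗-F d e = Σ-F d (wk d e)

  ⇒-F : Γ ⊢ A type → Γ ⊢ D type → Γ ⊢ A ⇒ D type
  ⇒-F d e = Π-F d (wk d e)

  ε-F : Γ ⊢ s ∈ U₀ → Γ ⊢ v ∈ T s ⇒ U₀ → Γ ⊢ a ∈ T s → Γ ⊢ a ε v type
  ε-F g d e = T-F (Π-E-formed (⇒-F (T-F g) (U₀-F (context g))) d e)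

  ⌜⌝-N : ∀ {k} (p : PR k) {ρ : Fin k → Term n} → Γ ctx → (∀ x → Γ ⊢ ρ x ∈ N) → Γ ⊢ ⌜ p ⌝ ρ ∈ N
  ⌜⌝-N (# x)       g h = h x
  ⌜⌝-N zero        g h = N-I₀ g
  ⌜⌝-N (suc p)     g h = N-Iₛ (⌜⌝-N p g h)
  ⌜⌝-N (rec p b r) g h =
    N-E (N-F g₁) (⌜⌝-N p g h) (⌜⌝-N b g h)
      (⌜⌝-N r g₂ λ { zero          → var-∈ g₂ zero
                    ; (suc zero)    → var-∈ g₂ (suc zero)
                    ; (suc (suc x)) → sub (⊢↑² g₂ g₁) (h x) })
    where
    g₁ = ▸-ctx g (N-F g)
    g₂ = ▸-ctx g₁ (N-F g₁)
  ⌜⌝-N (comp p ps) g h = ⌜⌝-N p g (λ x → ⌜⌝-N (ps x) g h)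

  CT-F : Γ ctx → Γ ⊢ CT type
  CT-F g =
    Π-F (Π-F (N-F g) (N-F (▸-ctx g (N-F g))))
      (Σ-F (N-F g₁) (Π-F (N-F g₂) (Σ-F (N-F g₃)
        (⊗-F (Id-F (N-F g₄) (⌜⌝-N kleeneT g₄ λ { zero             → var-∈ g₄ (suc (suc zero))
                                                 ; (suc zero)       → var-∈ g₄ (suc zero)
                                                 ; (suc (suc zero)) → var-∈ g₄ zero })
                           (N-Iₛ (N-I₀ g₄)))
             (Id-F (N-F g₄) (Π-E (N-F g₄) (N-F (▸-ctx g₄ (N-F g₄))) (var-∈ g₄ (suc (suc (suc zero)))) (var-∈ g₄ (suc zero)))
                   (⌜⌝-N kleeneU g₄ λ { zero → var-∈ g₄ zero }))))))
    where
    g₁ = ▸-ctx g (Π-F (N-F g) (N-F (▸-ctx g (N-F g))))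
    g₂ = ▸-ctx g₁ (N-F g₁)
    g₃ = ▸-ctx g₂ (N-F g₂)
    g₄ = ▸-ctx g₃ (N-F g₃)

  -- Induction on covers under substitution.

  coverᶜ-cong : s ≡ s' → i ≡ i' → c ≡ c' → v ≡ v' → a ≡ a' → coverᶜ s i c v a ≡ coverᶜ s' i' c' v' a'
  coverᶜ-cong refl refl refl refl refl = refl

  positiveᶜ-cong : s ≡ s' → i ≡ i' → c ≡ c' → v ≡ v' → a ≡ a' → positiveᶜ s i c v a ≡ positiveᶜ s' i' c' v' a'
  positiveᶜ-cong refl refl refl refl refl = refl

  coverₛ-sub : (∀ x → σ x [ τ ] ≡ υ x) → ∀ s i c v t → coverₛ σ s i c v t [ τ ] ≡ coverₛ υ s i c v (t [ τ ])
  coverₛ-sub h s i c v t =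
    cong T (coverᶜ-cong (sub-sub h s) (sub-sub (lift-sub h 1) i) (sub-sub (lift-sub h 2) c) (sub-sub h v) refl)

  coverₛ-lift : ∀ k (σ : Sub n m) s i c v (t : Term (k + n)) →
    coverₛ (↑ k) s i c v t [ lift k σ ] ≡ coverₛ (↑ k) (s [ σ ]) (i [ lift 1 σ ]) (c [ lift 2 σ ]) (v [ σ ]) (t [ lift k σ ])
  coverₛ-lift k σ s i c v t =
    trans (coverₛ-sub (lift-↑ʳ k σ) s i c v t) (sym (cong T (coverᶜ-cong
      (sub-sub h s) (sub-sub (lift-sub h 1) i) (sub-sub (lift-sub h 2) c) (sub-sub h v) refl)))
    where h = λ _ → refl

  coverₛ-ids : ∀ s i c v (t : Term n) → coverₛ ids s i c v t ≡ T (coverᶜ s i c v t)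
  coverₛ-ids s i c v t =
    cong T (coverᶜ-cong (sub-ids h s) (sub-ids (lift-ids h 1) i) (sub-ids (lift-ids h 2) c) (sub-ids h v) refl)
    where h = λ _ → refl

  coverₛ-inst : ∀ s i c v t → coverₛ (↑ 1) s i c v t [ ids ▷ a ] ≡ T (coverᶜ s i c v (t [ ids ▷ a ]))
  coverₛ-inst s i c v t =
    trans (coverₛ-sub (λ _ → refl) s i c v t) (coverₛ-ids s i c v _)

  below-cong : ∀ {B B' : Type (2 + n)} → s ≡ s' → d ≡ f → B ≡ B' → below s d B ≡ below s' f B'
  below-cong refl refl refl = refl

  below-sub : ∀ (σ : Sub n m) s d P → below s d P [ σ ] ≡ below (s [ σ ]) (d [ σ ]) (P [ lift 2 σ ])
  below-sub σ s d P = cong (λ e → Π (T (s [ σ ])) (Π (T (ap e v₀)) (P [ lift 2 σ ]))) (wk-lift 1 σ d)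

  below-E : Γ ⊢ below s d P type → Γ ⊢ r ∈ below s d P → Γ ⊢ a ∈ T s → Γ ⊢ u ∈ a ε d →
    Γ ⊢ ap (ap r a) u ∈ P [ ids ▷ a ▷ u ]
  below-E {s = s} {d} {P} {a = a} {u} g hr ha hu =
    cast (sub-sub (λ { zero → refl ; (suc zero) → trans (ren-sub (λ _ → refl) a) (sub-ids (λ _ → refl) a) ; (suc (suc x)) → refl }) P)
      (Π-E-formed (inst ha (proj₂ (premises g))) (Π-E-formed g hr ha)
        (cast (cong (λ e → T (ap e a)) (sym (wk-inst d))) hu))

  AxiomSet-sub : Δ ⊢ˢ σ ∶ Γ → AxiomSet Γ s i c → AxiomSet Δ (s [ σ ]) (i [ lift 1 σ ]) (c [ lift 2 σ ])
  AxiomSet-sub {σ = σ} {s = s} h (axiomSet hs hi hc) =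
    axiomSet (sub h hs) (sub h₁ hi)
      (cast (cong (λ e → T e ⇒ U₀) (wk-lift 2 σ s)) (sub (⊢lift h₁ (T-F hi)) hc))
    where h₁ = ⊢lift h (T-F hs)

  axiom : AxiomSet Γ s i c → Γ ⊢ a ∈ T s → Γ ⊢ j ∈ T (i [ ids ▷ a ]) → Γ ⊢ c [ ids ▷ a ▷ j ] ∈ T s ⇒ U₀
  axiom {s = s} (axiomSet _ _ hc) ha hj =
    cast (cong (λ e → T e ⇒ U₀) (sub-section (λ _ → refl) s)) (sub (⊢▷ (⊢inst (context ha) ha) hj) hc)

  -- The premises of cover elimination are kept together so that they can be substituted as a whole:
  -- the contractum of the `tr` rule repeats the eliminator under two abstractions, and typing it
  -- requires these premises in a weakened context.
  record Induction (Γ : Context n) (s : Term n) (i : Term (1 + n)) (c : Term (2 + n)) (v : Term n)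
                   (P : Type (2 + n)) (q₁ : Term (2 + n)) (q₂ : Term (4 + n)) : Set where
    constructor induction
    field
      axioms : AxiomSet Γ s i c
      subset : Γ ⊢ v ∈ T s ⇒ U₀
      motive : Γ ▸ T s ▸ coverₛ (↑ 1) s i c v v₀ ⊢ P type
      rfCase : Γ ▸ T s ▸ v₀ ε v [ ↑ 1 ] ⊢ q₁ ∈ P [ ↑ 2 ▷ v₁ ▷ rf v₁ v₀ ]
      trCase : Γ ▸ T s ▸ T i ▸ below (s [ ↑ 2 ]) c (coverₛ (↑ 4) s i c v v₁)
                 ▸ below (s [ ↑ 3 ]) (c [ ↑ 1 ]) (P [ ↑ 5 ▷ v₁ ▷ ap (ap v₂ v₁) v₀ ]) ⊢ q₂ ∈ P [ ↑ 4 ▷ v₃ ▷ tr v₃ v₂ v₁ ]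
  open Induction

  ind-E : Induction Γ s i c v P q₁ q₂ → Γ ⊢ a ∈ T s → Γ ⊢ t ∈ T (coverᶜ s i c v a) → Γ ⊢ ind t q₁ q₂ ∈ P [ ids ▷ a ▷ t ]
  ind-E h ha ht = cover-E (axioms h) (subset h) (motive h) ha ht (rfCase h) (trCase h)

  ind-β-rf : Induction Γ s i c v P q₁ q₂ → Γ ⊢ a ∈ T s → Γ ⊢ r ∈ a ε v →
    Γ ⊢ ind (rf a r) q₁ q₂ ≐ q₁ [ ids ▷ a ▷ r ] ∈ P [ ids ▷ a ▷ rf a r ]
  ind-β-rf h ha hr = cover-β-rf (axioms h) (subset h) (motive h) ha hr (rfCase h) (trCase h)

  ▸-≡ : {A A' : Type n} → A ≡ A' → Γ ▸ A ⊢ 𝒥 → Γ ▸ A' ⊢ 𝒥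
  ▸-≡ refl d = d

  motive-lift : ∀ k (σ : Sub n m) (P : Type (2 + n)) (a b : Term (k + n)) →
    P [ ↑ k ▷ a ▷ b ] [ lift k σ ] ≡ P [ lift 2 σ ] [ ↑ k ▷ a [ lift k σ ] ▷ b [ lift k σ ] ]
  motive-lift k σ P a b = sub-square
    (λ { zero → refl ; (suc zero) → refl
       ; (suc (suc x)) → trans (lift-↑ʳ k σ x) (sym (trans (cong (_[ _ ]) (lift-↑ʳ 2 σ x)) (sub-sub (λ _ → refl) (σ x)))) }) P

  -- Each premise is substituted under its own binders. What remains is that `below`, `coverₛ` and
  -- the instances of the motive commute with lifting, so that the results again have the form
  -- prescribed by the rule.
  Induction-sub : Δ ⊢ˢ σ ∶ Γ → Induction Γ s i c v P q₁ q₂ →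
    Induction Δ (s [ σ ]) (i [ lift 1 σ ]) (c [ lift 2 σ ]) (v [ σ ]) (P [ lift 2 σ ]) (q₁ [ lift 2 σ ]) (q₂ [ lift 4 σ ])
  Induction-sub {Δ = Δ} {σ = σ} {s = s} {i} {c} {v} {P} {q₁} {q₂} h (induction ax@(axiomSet hs hi hc) hv hP h₁ h₂) = record
    { axioms = AxiomSet-sub h ax
    ; subset = sub h hv
    ; motive = ▸-≡ (coverₛ-lift 1 σ s i c v v₀) (sub (⊢ext h' hP) hP)
    ; rfCase = cast (motive-lift 2 σ P v₁ (rf v₁ v₀)) (▸-≡ (cong (λ e → T (ap e v₀)) (wk-lift 1 σ v)) (sub (⊢ext h' h₁) h₁))
    ; trCase = cast (motive-lift 4 σ P v₃ (tr v₃ v₂ v₁)) (≡.subst₂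
        (λ A D → Δ ▸ T (s [ σ ]) ▸ T (i [ lift 1 σ ]) ▸ A ▸ D
                   ⊢ q₂ [ lift 4 σ ] ∈ P [ ↑ 4 ▷ v₃ ▷ tr v₃ v₂ v₁ ] [ lift 4 σ ])
        (trans (below-sub (lift 2 σ) (s [ ↑ 2 ]) c (coverₛ (↑ 4) s i c v v₁))
               (below-cong (wk-lift 2 σ s) (refl {x = c [ lift 2 σ ]}) (coverₛ-lift 4 σ s i c v v₁)))
        (trans (below-sub (lift 3 σ) (s [ ↑ 3 ]) (c [ ↑ 1 ]) (P [ ↑ 5 ▷ v₁ ▷ ap (ap v₂ v₁) v₀ ]))
               (below-cong (wk-lift 3 σ s) (wk-lift 1 (lift 2 σ) c) (motive-lift 5 σ P v₁ (ap (ap v₂ v₁) v₀))))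
        (sub (⊢ext (⊢ext (⊢lift h' (T-F hi)) (tail h₂)) h₂) h₂))
    }
    where
    h' = ⊢lift h (T-F hs)
    ⊢ext : ∀ {n m} {Γ : Context n} {Δ : Context m} {σ A 𝒥} → Δ ⊢ˢ σ ∶ Γ → Γ ▸ A ⊢ 𝒥 → Δ ▸ A [ σ ] ⊢ˢ lift₁ σ ∶ Γ ▸ A
    ⊢ext h d with ▸-ctx _ e ← context d = ⊢lift h e
    tail : ∀ {n} {Γ : Context n} {A D 𝒥} → Γ ▸ A ▸ D ⊢ 𝒥 → Γ ▸ A ⊢ D type
    tail d with ▸-ctx _ e ← context d = e

  ind-sub : Δ ⊢ˢ σ ∶ Γ → Induction Γ s i c v P q₁ q₂ → Δ ⊢ a ∈ T (s [ σ ]) → Δ ⊢ t ∈ coverₛ σ s i c v a →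
    Δ ⊢ ind t (q₁ [ lift 2 σ ]) (q₂ [ lift 4 σ ]) ∈ P [ σ ▷ a ▷ t ]
  ind-sub {σ = σ} {P = P} {a = a} {t = t} h hI ha ht =
    cast (sub-sub (λ { zero → refl ; (suc zero) → refl
                     ; (suc (suc x)) → trans (ren-sub (λ _ → refl) (ren suc (σ x)))
                                               (trans (ren-sub (λ _ → refl) (σ x)) (sub-ids (λ _ → refl) (σ x))) }) P)
         (ind-E (Induction-sub h hI) ha ht)

  motive-inst : Induction Γ s i c v P q₁ q₂ → Γ ⊢ a ∈ T s → Γ ⊢ t ∈ T (coverᶜ s i c v a) → Γ ⊢ P [ ids ▷ a ▷ t ] type
  motive-inst {s = s} {i} {c} {v} hI ha ht =
    sub (⊢▷ (⊢inst (context ha) ha) (cast (sym (coverₛ-inst s i c v v₀)) ht)) (motive hI)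

  rfCase-inst : Induction Γ s i c v P q₁ q₂ → Γ ⊢ a ∈ T s → Γ ⊢ r ∈ a ε v →
    Γ ⊢ q₁ [ ids ▷ a ▷ r ] ∈ P [ ids ▷ a ▷ rf a r ]
  rfCase-inst {v = v} {P} {a = a} hI ha hr =
    cast (sub-sub (λ { zero → refl ; (suc zero) → refl ; (suc (suc x)) → refl }) P)
      (sub (⊢▷ (⊢inst (context ha) ha) (cast (cong (λ e → T (ap e a)) (sym (wk-inst v))) hr)) (rfCase hI))

  recursiveCall : Term n → Term (2 + n) → Term (4 + n) → Term n
  recursiveCall r q₁ q₂ = ƛ (ƛ (ind (ap (ap (r [ ↑ 2 ]) v₁) v₀) (q₁ [ lift 2 (↑ 2) ]) (q₂ [ lift 4 (↑ 2) ])))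

  ind-β-tr : Induction Γ s i c v P q₁ q₂ → Γ ⊢ a ∈ T s → Γ ⊢ j ∈ T (i [ ids ▷ a ]) →
    Γ ⊢ r ∈ below s (c [ ids ▷ a ▷ j ]) (coverₛ (↑ 2) s i c v v₁) →
    Γ ⊢ ind (tr a j r) q₁ q₂ ≐ q₂ [ ids ▷ a ▷ j ▷ r ▷ recursiveCall r q₁ q₂ ] ∈ P [ ids ▷ a ▷ tr a j r ]
  ind-β-tr h ha hj hr = cover-β-tr (axioms h) (subset h) (motive h) ha hj hr (rfCase h) (trCase h)

  -- The branch `q₂` receives `recursiveCall` as its inductive hypothesis, which is typed from the
  -- inside out: the subproof at a point by `below-E`, the eliminator on it by `ind-sub`, then the
  -- two abstractions. Formation of the type of `r` is a separate argument because presuppositions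
  -- are only being established by the induction that calls this lemma.
  trCase-inst : Induction Γ s i c v P q₁ q₂ → Γ ⊢ a ∈ T s → Γ ⊢ j ∈ T (i [ ids ▷ a ]) →
    Γ ⊢ below s (c [ ids ▷ a ▷ j ]) (coverₛ (↑ 2) s i c v v₁) type →
    Γ ⊢ r ∈ below s (c [ ids ▷ a ▷ j ]) (coverₛ (↑ 2) s i c v v₁) →
    Γ ⊢ q₂ [ ids ▷ a ▷ j ▷ r ▷ recursiveCall r q₁ q₂ ] ∈ P [ ids ▷ a ▷ tr a j r ]
  trCase-inst {Γ = Γ} {s} {i} {c} {v} {P} {q₁} {q₂} {a = a} {j = j} {r = r} hI ha hj hD hr =
    cast (sub-sub (λ { zero → refl ; (suc zero) → refl ; (suc (suc x)) → refl }) P)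
      (sub (⊢▷ (⊢▷ (⊢▷ (⊢inst (context ha) ha) hj) (cast (sym eq₁) hr)) (cast (sym eq₂) call)) (trCase hI))
    where
    cⱼ = c [ ids ▷ a ▷ j ]
    ◁v = coverₛ (↑ 2) s i c v v₁
    Pᵣ = P [ ↑ 2 ▷ v₁ ▷ ap (ap (r [ ↑ 2 ]) v₁) v₀ ]
    -- `eq₁` and `eq₂` are the last two types in the context of `q₂` after instantiation: the type
    -- of `r` and the type of the recursive call.
    eq₁ : below (s [ ↑ 2 ]) c (coverₛ (↑ 4) s i c v v₁) [ ids ▷ a ▷ j ] ≡ below s cⱼ ◁v
    eq₁ = trans (below-sub (ids ▷ a ▷ j) (s [ ↑ 2 ]) c (coverₛ (↑ 4) s i c v v₁))
      (below-cong (sub-section (λ _ → refl) s) (refl {x = cⱼ}) (coverₛ-sub (λ _ → refl) s i c v v₁))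
    eq₂ : below (s [ ↑ 3 ]) (c [ ↑ 1 ]) (P [ ↑ 5 ▷ v₁ ▷ ap (ap v₂ v₁) v₀ ]) [ ids ▷ a ▷ j ▷ r ] ≡ below s cⱼ Pᵣ
    eq₂ = trans (below-sub (ids ▷ a ▷ j ▷ r) (s [ ↑ 3 ]) (c [ ↑ 1 ]) (P [ ↑ 5 ▷ v₁ ▷ ap (ap v₂ v₁) v₀ ]))
      (below-cong (sub-section (λ _ → refl) s) (wk-▷ c)
        (sub-sub (λ { zero → cong (λ e → ap (ap e v₁) v₀) (lift-↑ʳ 2 (ids ▷ a ▷ j ▷ r) zero)
                    ; (suc zero) → refl ; (suc (suc x)) → refl }) P))
    hs : Γ ⊢ T s type
    hs = proj₁ (premises hD)
    g₁ : Γ ▸ T s ctx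
    g₁ = ▸-ctx (context ha) hs
    hε : Γ ▸ T s ⊢ v₀ ε cⱼ [ ↑ 1 ] type
    hε with axiomSet s∈ _ _ ← axioms hI =
      ε-F {s = s [ ↑ 1 ]} (sub (⊢↑ g₁) s∈) (sub (⊢↑ g₁) (axiom (axioms hI) ha hj)) (var-∈ g₁ zero)
    g₂ : Γ ▸ T s ▸ v₀ ε cⱼ [ ↑ 1 ] ctx
    g₂ = ▸-ctx g₁ hε
    Γ⊢↑² : Γ ▸ T s ▸ v₀ ε cⱼ [ ↑ 1 ] ⊢ˢ ↑ 2 ∶ Γ
    Γ⊢↑² = ⊢↑² g₂ g₁
    eq₃ : below s cⱼ ◁v [ ↑ 2 ] ≡ below (s [ ↑ 2 ]) (cⱼ [ ↑ 2 ]) (◁v [ lift 2 (↑ 2) ])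
    eq₃ = below-sub (↑ 2) s cⱼ ◁v
    eq₄ : ◁v [ lift 2 (↑ 2) ] [ ids ▷ v₁ ▷ v₀ ] ≡ ◁v
    eq₄ = trans (cong (_[ ids ▷ v₁ ▷ v₀ ]) (coverₛ-sub {υ = ↑ 4} (λ _ → refl) s i c v v₁)) (coverₛ-sub (λ _ → refl) s i c v v₁)
    hv₁ : Γ ▸ T s ▸ v₀ ε cⱼ [ ↑ 1 ] ⊢ v₁ ∈ T (s [ ↑ 2 ])
    hv₁ = cast (cong T (sub-sub (λ _ → refl) s)) (var-∈ g₂ (suc zero))
    branch : Γ ▸ T s ▸ v₀ ε cⱼ [ ↑ 1 ] ⊢ ap (ap (r [ ↑ 2 ]) v₁) v₀ ∈ ◁v
    branch = cast eq₄ (below-E (cast-type eq₃ (sub Γ⊢↑² hD)) (cast eq₃ (sub Γ⊢↑² hr)) hv₁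
      (cast (cong (λ e → T (ap e v₁)) (sub-sub (λ _ → refl) cⱼ)) (var-∈ g₂ zero)))
    hE : Γ ▸ T s ▸ v₀ ε cⱼ [ ↑ 1 ] ⊢ ind (ap (ap (r [ ↑ 2 ]) v₁) v₀) (q₁ [ lift 2 (↑ 2) ]) (q₂ [ lift 4 (↑ 2) ]) ∈ Pᵣ
    hE = ind-sub Γ⊢↑² hI hv₁ branch
    hE-type : Γ ▸ T s ▸ v₀ ε cⱼ [ ↑ 1 ] ⊢ Pᵣ type
    hE-type = sub (⊢▷ (⊢▷ Γ⊢↑² hv₁) (cast (sym (coverₛ-sub (λ _ → refl) s i c v v₀)) branch)) (motive hI)
    call : Γ ⊢ recursiveCall r q₁ q₂ ∈ below s cⱼ Pᵣ
    call = Π-I hs (Π-F hε hE-type) (Π-I hε hE-type hE)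

  ⊢Id : Γ ⊢ a ∈ A → Γ ⊢ b ∈ A → Γ ⊢ p ∈ Id A a b → Γ ⊢ˢ ids ▷ a ▷ b ▷ p ∶ Γ ▸ A ▸ A [ ↑ 1 ] ▸ Id (A [ ↑ 2 ]) v₁ v₀
  ⊢Id {a = a} {A = A} {b = b} ha hb hp =
    ⊢▷ (⊢▷ (⊢inst (context ha) ha) (cast (sym (wk-inst A)) hb))
       (cast (cong (λ D → Id D a b) (sym (sub-section (λ _ → refl) A))) hp)

  -- Presuppositions of MLtt_cind.

  WellFormed : Context n → Judgement n → Set
  WellFormed Γ (A type)     = ⊤
  WellFormed Γ (A ≐ B type) = Γ ⊢ A type × Γ ⊢ B type
  WellFormed Γ (a ∈ A)      = Γ ⊢ A type
  WellFormed Γ (a ≐ b ∈ A)  = Γ ⊢ a ∈ A × Γ ⊢ b ∈ A × Γ ⊢ A type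

  WellFormed-sub : Δ ⊢ˢ σ ∶ Γ → ∀ 𝒥 → WellFormed Γ 𝒥 → WellFormed Δ (𝒥 [ σ ]ᴶ)
  WellFormed-sub h (A type)     _           = tt
  WellFormed-sub h (A ≐ B type) (d , e)     = sub h d , sub h e
  WellFormed-sub h (a ∈ A)      d           = sub h d
  WellFormed-sub h (a ≐ b ∈ A)  (d , e , f) = sub h d , sub h e , sub h f

  lookup-type : Γ ctx → ∀ x → Γ ⊢ Γ ‼ x type
  lookup-type (▸-ctx g d) zero    = wk d d
  lookup-type (▸-ctx g d) (suc x) = wk d (lookup-type g x)

  Π-≐-F : Γ ⊢ A type → Γ ⊢ A' type → Γ ⊢ A ≐ A' type → Γ ▸ A ⊢ B' type → Γ ▸ A' ⊢ B' type
  Π-≐-F d d' e = recast (▸-recast (⊢ids (context d)) d' (type-sym e))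

  -- The rules carry their formation premises, so most cases reapply a formation rule or instantiate
  -- a motive. The work is in the computation rules, where the contractum must receive the type of
  -- the redex, and in equalities of binders, where the right-hand family has to be moved to the
  -- other domain.
  wellFormed : Γ ⊢ 𝒥 → WellFormed Γ 𝒥
  wellFormed (type-refl d) = d , d
  wellFormed (type-sym d) = proj₂ (wellFormed d) , proj₁ (wellFormed d)
  wellFormed (type-trans d e) = proj₁ (wellFormed d) , proj₂ (wellFormed e)
  wellFormed (∈-refl d) = d , d , wellFormed d
  wellFormed (∈-sym d) with a , b , A ← wellFormed d = b , a , A
  wellFormed (∈-trans d e) = proj₁ (wellFormed d) , proj₂ (wellFormed e)
  wellFormed (conv d e) = proj₂ (wellFormed e)
  wellFormed (conv-≐ d e) with a , b , _ ← wellFormed d = conv a e , conv b e , proj₂ (wellFormed e)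
  wellFormed (var-∈ g x) = lookup-type g x
  wellFormed (subst {Γ = Γ} {𝒥 = 𝒥} σ d g h) = WellFormed-sub (typedSub {Γ = Γ} g h) 𝒥 (wellFormed d)
  wellFormed (repl-type {Γ = Γ} σ τ d g hσ hτ h) = sub (typedSub {Γ = Γ} g hσ) d , sub (typedSub {Γ = Γ} g hτ) d
  -- The instance along `τ` has its type instantiated along `τ` as well; replacement in that type
  -- brings it back to `σ`.
  wellFormed (repl-∈ {Γ = Γ} σ τ d g hσ hτ h) =
      sub (typedSub {Γ = Γ} g hσ) d
    , conv (sub (typedSub {Γ = Γ} g hτ) d) (type-sym (repl-type σ τ (wellFormed d) g hσ hτ h))
    , sub (typedSub {Γ = Γ} g hσ) (wellFormed d)
  wellFormed (N₀-F g) = tt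
  wellFormed (N₀-E m t) = inst t m
  wellFormed (N₁-F g) = tt
  wellFormed (N₁-I g) = N₁-F g
  wellFormed (N₁-E m t a) = inst t m
  wellFormed (N₁-β m a) = N₁-E m (N₁-I g) a , a , inst (N₁-I g) m
    where g = context a
  wellFormed (N-F g) = tt
  wellFormed (N-I₀ g) = N-F g
  wellFormed (N-Iₛ t) = N-F (context t)
  wellFormed (N-E m t a c) = inst t m
  wellFormed (N-β₀ m a c) = N-E m (N-I₀ (context a)) a c , a , inst (N-I₀ (context a)) m
  wellFormed (N-βₛ {M = M} m t a c) =
      N-E m (N-Iₛ t) a c
    , cast (sub-sub (λ { zero → refl ; (suc x) → refl }) M) (sub (⊢▷ (⊢inst (context t) t) (N-E m t a c)) c)
    , inst (N-Iₛ t) m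
  wellFormed (List-F A) = tt
  wellFormed (List-≐ e) = List-F (proj₁ (wellFormed e)) , List-F (proj₂ (wellFormed e))
  wellFormed (List-I₀ A) = List-F A
  wellFormed (List-Iₛ A a s) = List-F A
  wellFormed (List-E A m t a l) = inst t m
  wellFormed (List-β₀ A m a l) = List-E A m (List-I₀ A) a l , a , inst (List-I₀ A) m
  wellFormed (List-βₛ {A = A} {M = M} hA m b s a l) =
      List-E hA m (List-Iₛ hA b s) a l
    , cast (sub-sub (λ { zero → refl ; (suc x) → refl }) M)
        (sub (⊢▷ (⊢▷ (⊢inst (context b) b) (cast (cong List (sym (wk-inst A))) s))
                 (cast (sym (sub-sub (λ { zero → refl ; (suc x) → refl }) M)) (List-E hA m s a l))) l)
    , inst (List-Iₛ hA b s) m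
  wellFormed (⊕-F A B) = tt
  wellFormed (⊕-≐ d e) = ⊕-F (proj₁ (wellFormed d)) (proj₁ (wellFormed e)) , ⊕-F (proj₂ (wellFormed d)) (proj₂ (wellFormed e))
  wellFormed (⊕-I₁ A B a) = ⊕-F A B
  wellFormed (⊕-I₂ A B b) = ⊕-F A B
  wellFormed (⊕-E A B m d c₁ c₂) = inst d m
  wellFormed (⊕-β₁ {M = M} A B m a c₁ c₂) =
      ⊕-E A B m (⊕-I₁ A B a) c₁ c₂
    , cast (sub-sub (λ { zero → refl ; (suc x) → refl }) M) (inst a c₁)
    , inst (⊕-I₁ A B a) m
  wellFormed (⊕-β₂ {M = M} A B m b c₁ c₂) =
      ⊕-E A B m (⊕-I₂ A B b) c₁ c₂
    , cast (sub-sub (λ { zero → refl ; (suc x) → refl }) M) (inst b c₂)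
    , inst (⊕-I₂ A B b) m
  wellFormed (Σ-F A B) = tt
  wellFormed (Σ-≐ d e) with A , A' ← wellFormed d | B , B' ← wellFormed e =
    Σ-F A B , Σ-F A' (Π-≐-F A A' d B')
  wellFormed (Σ-I A B a b) = Σ-F A B
  wellFormed (Σ-E A B m d c) = inst d m
  wellFormed (Σ-β {M = M} A B m a b c) =
      Σ-E A B m (Σ-I A B a b) c
    , cast (sub-sub (λ { zero → refl ; (suc x) → refl }) M) (sub (⊢▷ (⊢inst (context a) a) b) c)
    , inst (Σ-I A B a b) m
  wellFormed (Π-F A B) = tt
  wellFormed (Π-≐ d e) with A , A' ← wellFormed d | B , B' ← wellFormed e =
    Π-F A B , Π-F A' (Π-≐-F A A' d B')
  wellFormed (Π-I A B b) = Π-F A B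
  wellFormed (Π-E A B f a) = inst a B
  wellFormed (Π-β A B b a) = Π-E A B (Π-I A B b) a , inst a b , inst a B
  wellFormed (Id-F A a b) = tt
  wellFormed (Id-≐ d e f) with A , A' ← wellFormed d | a , a' , _ ← wellFormed e | b , b' , _ ← wellFormed f =
    Id-F A a b , Id-F A' (conv a' d) (conv b' d)
  wellFormed (Id-I A a) = Id-F A a a
  wellFormed (Id-E A q a b p c) = sub (⊢Id a b p) q
  wellFormed (Id-β {Q = Q} A q a c) =
      Id-E A q a a (Id-I A a) c
    , cast (sub-sub (λ { zero → refl ; (suc zero) → refl ; (suc (suc zero)) → refl ; (suc (suc (suc x))) → refl }) Q) (inst a c)
    , sub (⊢Id a a (Id-I A a)) q
  wellFormed (U₀-F g) = tt
  wellFormed (T-F a) = tt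
  wellFormed (T-≐ e) with a , b , _ ← wellFormed e = T-F a , T-F b
  wellFormed (N₀ᶜ-I g) = U₀-F g
  wellFormed (N₁ᶜ-I g) = U₀-F g
  wellFormed (Nᶜ-I g) = U₀-F g
  wellFormed (Listᶜ-I a) = U₀-F (context a)
  wellFormed (⊕ᶜ-I a b) = U₀-F (context a)
  wellFormed (Σᶜ-I a b) = U₀-F (context a)
  wellFormed (Πᶜ-I a b) = U₀-F (context a)
  wellFormed (Idᶜ-I a b d) = U₀-F (context a)
  wellFormed (T-N₀ g) = T-F (N₀ᶜ-I g) , N₀-F g
  wellFormed (T-N₁ g) = T-F (N₁ᶜ-I g) , N₁-F g
  wellFormed (T-N g) = T-F (Nᶜ-I g) , N-F g
  wellFormed (T-List a) = T-F (Listᶜ-I a) , List-F (T-F a)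
  wellFormed (T-⊕ a b) = T-F (⊕ᶜ-I a b) , ⊕-F (T-F a) (T-F b)
  wellFormed (T-Σ a b) = T-F (Σᶜ-I a b) , Σ-F (T-F a) (T-F b)
  wellFormed (T-Π a b) = T-F (Πᶜ-I a b) , Π-F (T-F a) (T-F b)
  wellFormed (T-Id a b d) = T-F (Idᶜ-I a b d) , Id-F (T-F a) b d
  wellFormed (cover-F ax v a) = U₀-F (context a)
  wellFormed (cover-rf ax v a r) = T-F (cover-F ax v a)
  wellFormed (cover-tr ax v a j r) = T-F (cover-F ax v a)
  wellFormed (cover-E ax v P a t q₁ q₂) = motive-inst (induction ax v P q₁ q₂) a t
  wellFormed (cover-β-rf ax v P a r q₁ q₂) =
      ind-E h a (cover-rf ax v a r) , rfCase-inst h a r , motive-inst h a (cover-rf ax v a r)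
    where h = induction ax v P q₁ q₂
  wellFormed (cover-β-tr ax v P a j r q₁ q₂) =
      ind-E h a (cover-tr ax v a j r) , trCase-inst h a j (wellFormed r) r , motive-inst h a (cover-tr ax v a j r)
    where h = induction ax v P q₁ q₂
  wellFormed (positive-F ax v a) = U₀-F (context a)
  wellFormed (positive-ax₁ (axiomSet hs _ _) v a q) = ε-F hs v a
  wellFormed (positive-ax₂ {s = s} {v = v} ax@(axiomSet hs _ _) hv a j q) =
    Σ-F (T-F hs) (⊗-F (ε-F (sub w hs) (sub w (axiom ax a j)) (var-∈ (target w) zero))
                      (T-F (positive-F (AxiomSet-sub w ax) (sub w hv) (var-∈ (target w) zero))))
    where w = ⊢↑ (▸-ctx (context a) (T-F hs))
  wellFormed (positive-ax₃ ax v P a t q₁ q₃) = T-F (positive-F ax v a)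
  wellFormed (CT-ax g) = CT-F g

-- Derived rules: constant motives and products.

module DerivedRules where
  open MLtt
  open MLttProperties

  private variable
    n m : ℕ
    Γ Δ : Context n
    A A' B C D : Type n
    P : Type n
    a b c d p t z c₁ c₂ : Term n
    σ : Sub n m

  Π-I' : Γ ▸ A ⊢ b ∈ B → Γ ⊢ ƛ b ∈ Π A B
  Π-I' d with ▸-ctx _ hA ← context d = Π-I hA (wellFormed d) d

  Π-E' : {B : Type (suc n)} → Γ ⊢ t ∈ Π A B → Γ ⊢ a ∈ A → Γ ⊢ ap t a ∈ B [ ids ▷ a ]
  Π-E' d = Π-E-formed (wellFormed d) d

  -- Propositions of mTT_cind are eliminated towards propositions constant in the proof-term. These
  -- rules specialise the dependent eliminators to weakened motives and read the formation premises
  -- off the presuppositions.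
  Σ-rec : Γ ⊢ D type → Γ ⊢ d ∈ Σ A B → Γ ▸ A ▸ B ⊢ c ∈ D [ ↑ 2 ] → Γ ⊢ split d c ∈ D
  Σ-rec {D = D} hD hd hc with hA , hB ← premises (wellFormed hd) =
    cast (wk-inst D) (Σ-E hA hB (wk (Σ-F hA hB) hD) hd (cast (sym (sub-sub (λ _ → refl) D)) hc))

  Σ-rec-β : {B : Type (suc n)} → Γ ⊢ D type → Γ ⊢ Σ A B type → Γ ⊢ a ∈ A → Γ ⊢ b ∈ B [ ids ▷ a ] → Γ ▸ A ▸ B ⊢ c ∈ D [ ↑ 2 ] →
    Γ ⊢ split (pair a b) c ≐ c [ ids ▷ a ▷ b ] ∈ D
  Σ-rec-β {D = D} hD hΣ ha hb hc with hA , hB ← premises hΣ =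
    ≡.subst (λ X → _ ⊢ _ ≐ _ ∈ X) (wk-inst D)
      (Σ-β hA hB (wk hΣ hD) ha hb (cast (sym (sub-sub (λ _ → refl) D)) hc))

  ⊕-rec : Γ ⊢ D type → Γ ⊢ d ∈ A ⊕ A' → Γ ▸ A ⊢ c₁ ∈ D [ ↑ 1 ] → Γ ▸ A' ⊢ c₂ ∈ D [ ↑ 1 ] → Γ ⊢ case d c₁ c₂ ∈ D
  ⊕-rec {D = D} hD hd h₁ h₂ with hA , hA' ← premises (wellFormed hd) =
    cast (wk-inst D) (⊕-E hA hA' (wk (⊕-F hA hA') hD) hd (cast (sym (sub-sub (λ _ → refl) D)) h₁) (cast (sym (sub-sub (λ _ → refl) D)) h₂))

  ⊕-rec-β₁ : Γ ⊢ D type → Γ ⊢ A' type → Γ ⊢ a ∈ A → Γ ▸ A ⊢ c₁ ∈ D [ ↑ 1 ] → Γ ▸ A' ⊢ c₂ ∈ D [ ↑ 1 ] →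
    Γ ⊢ case (inl a) c₁ c₂ ≐ c₁ [ ids ▷ a ] ∈ D
  ⊕-rec-β₁ {D = D} hD hA' ha h₁ h₂ =
    ≡.subst (λ X → _ ⊢ _ ≐ _ ∈ X) (wk-inst D)
      (⊕-β₁ hA hA' (wk (⊕-F hA hA') hD) ha (cast (sym (sub-sub (λ _ → refl) D)) h₁) (cast (sym (sub-sub (λ _ → refl) D)) h₂))
    where hA = wellFormed ha

  ⊕-rec-β₂ : Γ ⊢ D type → Γ ⊢ A type → Γ ⊢ a ∈ A' → Γ ▸ A ⊢ c₁ ∈ D [ ↑ 1 ] → Γ ▸ A' ⊢ c₂ ∈ D [ ↑ 1 ] →
    Γ ⊢ case (inr a) c₁ c₂ ≐ c₂ [ ids ▷ a ] ∈ D
  ⊕-rec-β₂ {D = D} hD hA ha h₁ h₂ =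
    ≡.subst (λ X → _ ⊢ _ ≐ _ ∈ X) (wk-inst D)
      (⊕-β₂ hA hA' (wk (⊕-F hA hA') hD) ha (cast (sym (sub-sub (λ _ → refl) D)) h₁) (cast (sym (sub-sub (λ _ → refl) D)) h₂))
    where hA' = wellFormed ha

  -- The motive of identity elimination in mTT_cind depends on the two endpoints alone; `J` is used
  -- at its weakening by the identity type.
  Id-motive : Γ ⊢ A type → Γ ▸ A ▸ A [ ↑ 1 ] ⊢ P type → Γ ▸ A ▸ A [ ↑ 1 ] ▸ Id (A [ ↑ 2 ]) v₁ v₀ ⊢ P [ ↑ 1 ] type
  Id-motive {A = A} hA hP = wk (Id-F (cast-type (sub-sub (λ _ → refl) A) (wk h (wk hA hA)))
      (cast (sub-sub (λ _ → refl) A) (var-∈ (context hP) (suc zero))) (cast (sub-sub (λ _ → refl) A) (var-∈ (context hP) zero))) hP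
    where h = wk hA hA

  J-rec : Γ ▸ A ▸ A [ ↑ 1 ] ⊢ P type → Γ ⊢ p ∈ Id A a b → Γ ▸ A ⊢ c ∈ P [ ↑ 1 ▷ v₀ ▷ v₀ ] → Γ ⊢ J p c ∈ P [ ids ▷ a ▷ b ]
  J-rec {P = P} hP hp hc with hA , ha , hb ← premises (wellFormed hp) =
    cast (wk-▷ P) (Id-E hA (Id-motive hA hP) ha hb hp (cast (sym (wk-▷ P)) hc))

  J-rec-β : Γ ▸ A ▸ A [ ↑ 1 ] ⊢ P type → Γ ⊢ a ∈ A → Γ ▸ A ⊢ c ∈ P [ ↑ 1 ▷ v₀ ▷ v₀ ] →
    Γ ⊢ J (rfl a) c ≐ c [ ids ▷ a ] ∈ P [ ids ▷ a ▷ a ]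
  J-rec-β {P = P} hP ha hc =
    ≡.subst (λ X → _ ⊢ _ ≐ _ ∈ X) (wk-▷ P) (Id-β (wellFormed ha) (Id-motive (wellFormed ha) hP) ha (cast (sym (wk-▷ P)) hc))

  ⊗-sub : ∀ (A B : Type n) (σ : Sub n m) → (A ⊗ B) [ σ ] ≡ A [ σ ] ⊗ B [ σ ]
  ⊗-sub A B σ = cong (Σ (A [ σ ])) (wk-lift 1 σ B)

  ⊗-I : Γ ⊢ a ∈ A → Γ ⊢ b ∈ B → Γ ⊢ pair a b ∈ A ⊗ B
  ⊗-I {B = B} ha hb = Σ-I (wellFormed ha) (wk (wellFormed ha) (wellFormed hb)) ha (cast (sym (wk-inst B)) hb)

  ⊗-comm : Γ ⊢ A type → Γ ⊢ B type → Γ ⊢ d ∈ A ⊗ B → Γ ⊢ split d (pair v₀ v₁) ∈ B ⊗ A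
  ⊗-comm {A = A} {B} hA hB hd =
    Σ-rec (⊗-F hB hA) hd (cast (sym (⊗-sub B A (↑ 2)))
      (⊗-I (cast (sub-sub (λ _ → refl) B) (var-∈ g zero)) (cast (sub-sub (λ _ → refl) A) (var-∈ g (suc zero)))))
    where
    g = ▸-ctx (▸-ctx (context hA) hA) (wk hA hB)

  swap-∈ : Γ ▸ A ⊢ B type → Γ ▸ A ⊢ C type → Γ ⊢ t ∈ Σ A (B ⊗ C) → Γ ⊢ swap t ∈ Σ A (C ⊗ B)
  swap-∈ {Γ = Γ} {A} {B} {C} hB hC ht with ▸-ctx _ hA ← context hB =
    Σ-rec (Σ-F hA (⊗-F hC hB)) ht
      (Σ-I (sub ↑² hA) (sub (⊢lift ↑² hA) (⊗-F hC hB)) (cast (sub-sub (λ _ → refl) A) (var-∈ g (suc zero)))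
        (cast (trans (sym (⊗-sub C B (↑ 1))) (sym (sub-sub {τ = ids ▷ v₁} {σ = lift 1 (↑ 2)} (λ { zero → refl ; (suc x) → refl }) (C ⊗ B))))
          (⊗-comm (wk (⊗-F hB hC) hB) (wk (⊗-F hB hC) hC) (cast (⊗-sub B C (↑ 1)) (var-∈ g zero)))))
    where
    g : Γ ▸ A ▸ B ⊗ C ctx
    g = ▸-ctx (context hB) (⊗-F hB hC)
    ↑² : Γ ▸ A ▸ B ⊗ C ⊢ˢ ↑ 2 ∶ Γ
    ↑² = ⊢↑² g (context hB)

  -- The axiom of choice from strong sums.

  repl-last : Δ ⊢ˢ σ ∶ Γ → Γ ▸ A ⊢ P type → Δ ⊢ a ≐ b ∈ A [ σ ] → Δ ⊢ P [ σ ▷ a ] ≐ P [ σ ▷ b ] type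
  repl-last {Δ = Δ} {σ = σ} {Γ = Γ} {A = A} h hP e with ha , hb , _ ← wellFormed e =
    repl-type _ _ hP (target h) (terms (⊢▷ {A = A} h ha)) (terms (⊢▷ {A = A} h hb))
      λ { zero    → ≡.subst (λ X → Δ ⊢ _ ≐ _ ∈ X) (sym (wk-▷ A)) e
        ; (suc x) → ∈-refl (terms (⊢▷ {A = A} h ha) (suc x)) }

  choice-matrix : Γ ▸ A ▸ B ⊢ P type → Γ ▸ Π A B ▸ A [ ↑ 1 ] ⊢ P [ ↑ 2 ▷ v₀ ▷ ap v₁ v₀ ] type
  choice-matrix {A = A} {B} hP with ▸-ctx (▸-ctx g hA) hB ← context hP =
    let g₁  = ▸-ctx g (Π-F hA hB)
        g₂  = ▸-ctx g₁ (wk (Π-F hA hB) hA)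
        hv₀ = cast (sub-sub (λ _ → refl) A) (var-∈ g₂ zero)
    in sub (⊢▷ {A = B} (⊢▷ {A = A} (⊢↑² g₂ g₁) hv₀)
         (cast (sub-sub (λ { zero → refl ; (suc x) → refl }) B)
           (Π-E' (cast (sub-sub (λ _ → refl) (Π A B)) (var-∈ g₂ (suc zero))) hv₀))) hP

  -- `choiceTerm` is `ƛ (choiceOf v₀)`; making the proof of totality a parameter keeps its binder
  -- out of the typing argument.
  choiceOf : Term n → Term n
  choiceOf z = pair (ƛ (split (ap (z [ ↑ 1 ]) v₀) v₁)) (ƛ (split (ap (z [ ↑ 1 ]) v₀) v₀))

  -- The second projection has to lie over the value of the chosen function. Two gaps arise, between
  -- an application of the function and its body, and between the first projection of a literal pair
  -- and its component. Both are computation steps inside a type, so replacement closes them without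
  -- a ξ-rule.
  choiceOf-∈ : Γ ▸ A ▸ B ⊢ P type → Γ ⊢ z ∈ Π A (Σ B P) →
    Γ ⊢ choiceOf z ∈ Σ (Π A B) (Π (A [ ↑ 1 ]) (P [ ↑ 2 ▷ v₀ ▷ ap v₁ v₀ ]))
  choiceOf-∈ {Γ = Γ} {A = A} {B} {P} {z} hP hz with ▸-ctx (▸-ctx g hA) hB ← context hP =
    Σ-I (Π-F hA hB) (Π-F (wk (Π-F hA hB) hA) (choice-matrix hP)) hf
      (cast (cong₂ Π (sym (wk-inst A))
                      (sym (sub-sub (λ { zero → cong (λ e → ap e v₀) (ren-as-sub suc f) ; (suc zero) → refl ; (suc (suc x)) → refl }) P)))
        (Π-I' second))
    where
    g₁ : Γ ▸ A ctx
    g₁ = ▸-ctx g hA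
    g₃ : Γ ▸ A ▸ B ▸ P ctx
    g₃ = ▸-ctx (context hP) hP
    first : Term _
    first = split (ap (z [ ↑ 1 ]) v₀) v₁
    f = ƛ first
    hz₁ : Γ ▸ A ⊢ ap (z [ ↑ 1 ]) v₀ ∈ Σ B P
    hz₁ = cast (sub-section (λ { zero → refl ; (suc x) → refl }) (Σ B P)) (Π-E' (wk hA hz) (var-∈ g₁ zero))
    π₁ : ∀ {m} {Δ : Context m} {B' P' d} → Δ ⊢ d ∈ Σ B' P' → Δ ⊢ split d v₁ ∈ B'
    π₁ {B' = B'} hd with hB , hP ← premises (wellFormed hd) =
      Σ-rec hB hd (cast (sub-sub (λ _ → refl) B') (var-∈ (▸-ctx (context hP) hP) (suc zero)))
    hfirst : Γ ▸ A ⊢ first ∈ B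
    hfirst = π₁ hz₁
    hf : Γ ⊢ f ∈ Π A B
    hf = Π-I' hfirst
    v₀∈ : Γ ▸ A ⊢ˢ ↑ 1 ▷ v₀ ∶ Γ ▸ A
    v₀∈ = ⊢▷ (⊢↑ g₁) (var-∈ g₁ zero)
    f-β : Γ ▸ A ⊢ first ≐ ap (f [ ↑ 1 ]) v₀ ∈ B [ ↑ 1 ▷ v₀ ]
    f-β = ∈-sym (≡.subst₂ (λ t D → Γ ▸ A ⊢ ap (f [ ↑ 1 ]) v₀ ≐ t ∈ D)
      (sub-section (λ { zero → refl ; (suc x) → refl }) first) (sub-sub (λ { zero → refl ; (suc x) → refl }) B)
      (Π-β (wk hA hA) (sub h hB) (sub h hfirst) (var-∈ g₁ zero)))
      where h = ⊢lift (⊢↑ g₁) hA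
    -- The motive for the second projection: `P` over the first projection of the pair being split.
    M : Type _
    M = P [ ↑ 2 ▷ v₁ ▷ split v₀ v₁ ]
    hM : Γ ▸ A ▸ Σ B P ⊢ M type
    hM = sub (⊢▷ {A = B} (⊢▷ {A = A} (⊢↑² g₂ g₁) (cast (sub-sub (λ _ → refl) A) (var-∈ g₂ (suc zero))))
                 (cast (sub-cong (λ { zero → refl ; (suc x) → refl }) B) (π₁ (var-∈ g₂ zero)))) hP
      where g₂ = ▸-ctx g₁ (Σ-F hB hP)
    σ₃ : Γ ▸ A ▸ B ▸ P ⊢ˢ ↑ 3 ▷ v₂ ∶ Γ ▸ A
    σ₃ = ⊢▷ {A = A} (⊢⨟ (⊢↑ g₁) (⊢↑² g₃ (context hP)))
      (cast (trans (cong (_[ ↑ 1 ]) (sub-sub (λ _ → refl) A)) (sub-sub (λ _ → refl) A)) (var-∈ g₃ (suc (suc zero))))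
    ↑2-η : B [ ↑ 1 ] [ ↑ 1 ] ≡ B [ ↑ 3 ▷ v₂ ]
    ↑2-η = sub-sub (λ { zero → refl ; (suc x) → refl }) B
    pair-β : Γ ▸ A ▸ B ▸ P ⊢ v₁ ≐ split (pair v₁ v₀) v₁ ∈ B [ ↑ 3 ▷ v₂ ]
    pair-β = ∈-sym (Σ-rec-β (sub σ₃ hB) (sub σ₃ (Σ-F hB hP)) (cast ↑2-η (var-∈ g₃ (suc zero)))
      (cast (sym (sub-sub (λ { zero → refl ; (suc zero) → refl ; (suc (suc x)) → refl }) P)) (var-∈ g₃ zero))
      (cast (sub-sub (λ _ → refl) (B [ ↑ 3 ▷ v₂ ])) (var-∈ (▸-ctx g₄ (sub (⊢lift σ₃ hB) hP)) (suc zero))))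
      where g₄ = ▸-ctx g₃ (sub σ₃ hB)
    -- On a literal pair the first projection inside the motive reduces to the first component,
    -- where `v₀` already has its type.
    branch : Γ ▸ A ▸ B ▸ P ⊢ v₀ ∈ M [ ↑ 2 ▷ pair v₁ v₀ ]
    branch = conv (cast (sub-cong (λ { zero → refl ; (suc zero) → refl ; (suc (suc x)) → refl }) P) (var-∈ g₃ zero))
      (≡.subst (λ D → Γ ▸ A ▸ B ▸ P ⊢ P [ ↑ 3 ▷ v₂ ▷ v₁ ] ≐ D type)
        (sym (sub-sub (λ { zero → refl ; (suc zero) → refl ; (suc (suc x)) → refl }) P)) (repl-last σ₃ hP pair-β))
    second : Γ ▸ A ⊢ split (ap (z [ ↑ 1 ]) v₀) v₀ ∈ P [ ↑ 1 ▷ v₀ ▷ ap (f [ ↑ 1 ]) v₀ ]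
    second = conv (cast (sub-sub (λ { zero → refl ; (suc zero) → refl ; (suc (suc x)) → refl }) P) (Σ-E hB hP hM hz₁ branch))
      (repl-last v₀∈ hP f-β)

  choiceTerm-∈ : Γ ▸ A ▸ B ⊢ P type →
    Γ ⊢ choiceTerm ∈ Π A (Σ B P) ⇒ Σ (Π A B) (Π (A [ ↑ 1 ]) (P [ ↑ 2 ▷ v₀ ▷ ap v₁ v₀ ]))
  choiceTerm-∈ {A = A} {B} {P} hP with ▸-ctx (▸-ctx g hA) hB ← context hP =
    Π-I' (cast (cong (Σ (Π A B [ ↑ 1 ])) (cong₂ Π (sym (wk-lift 1 (↑ 1) A)) (sym (motive-lift 2 (↑ 1) P v₀ (ap v₁ v₀)))))
      (choiceOf-∈ (sub (⊢lift (⊢lift h hA) hB) hP) (var-∈ (target h) zero)))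
    where h = ⊢↑ (▸-ctx g (Π-F hA (Σ-F hB hP)))

-- Small and large shapes of expressions.

module Soundness where

  open L
  open MLttProperties
  open DerivedRules
  open M using (Size; small; large)
  module MS = Substitution ⊤ tt M.Operator M.arity

  private variable
    n m : ℕ
    z : Size
    k : M.Kind
    Γ Δ : Context n
    A B I C V P M a b j : M.Expr n
    t u : Term n
    X Y : Type n
    𝒥 : Judgement n
    σ : M.Sub n m
    τ : Sub n m

  isFormer : M.Operator tt → Bool
  isFormer M.`N₀    = true
  isFormer M.`N₁    = true
  isFormer M.`N     = true
  isFormer M.`List  = true
  isFormer M.`⊕     = true
  isFormer M.`Σ     = true
  isFormer M.`Π     = true
  isFormer M.`⊥     = true
  isFormer M.`∧     = true
  isFormer M.`∨     = true
  isFormer M.`⇒     = true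
  isFormer M.`∀     = true
  isFormer M.`∃     = true
  isFormer M.`Id    = true
  isFormer M.`Propₛ = true
  isFormer _        = false

  -- In a small type prop_s does not occur as a part of the type: the translation
  -- of prop_s as a term is not a code for its translation as a type.
  data Shape : Size → M.Expr n → Set where
    varˢ   : (x : Fin n) → Shape z (M.var x)
    otherˢ : (o : M.Operator tt) → isFormer o ≡ false → (as : M.Args (M.arity o) n) → Shape z (M.op o as)
    Propₛˢ : Shape {n} large M.Propₛ
    N₀ˢ    : Shape {n} z M.N₀
    N₁ˢ    : Shape {n} z M.N₁
    Nˢ     : Shape {n} z M.N
    ⊥ˢ     : Shape {n} z M.⊥
    Listˢ  : {A : M.Expr n} → Shape z A → Shape z (M.List A)
    ⊕ˢ     : {A B : M.Expr n} → Shape z A → Shape z B → Shape z (A M.⊕ B)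
    Σˢ     : {A : M.Expr n} {B : M.Expr (1 + n)} → Shape z A → Shape z B → Shape z (M.Σ A B)
    Πˢ     : {A : M.Expr n} {B : M.Expr (1 + n)} → Shape z A → Shape z B → Shape z (M.Π A B)
    ∧ˢ     : {A B : M.Expr n} → Shape z A → Shape z B → Shape z (A M.∧ B)
    ∨ˢ     : {A B : M.Expr n} → Shape z A → Shape z B → Shape z (A M.∨ B)
    ⇒ˢ     : {A B : M.Expr n} → Shape z A → Shape z B → Shape z (A M.⇒ B)
    Allˢ   : {A : M.Expr n} {B : M.Expr (1 + n)} → Shape z A → Shape z B → Shape z (M.All A B)
    Exˢ    : {A : M.Expr n} {B : M.Expr (1 + n)} → Shape z A → Shape z B → Shape z (M.Ex A B)
    Idˢ    : {A a b : M.Expr n} → Shape z A → Shape z (M.Id A a b)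

  pattern other = otherˢ _ refl _

  -- At size `large` the predicate acts as a view: it gathers into one case all operators treated by
  -- the last clause of `‖_‖ᵀ`.
  shape : (e : M.Expr n) → Shape large e
  shape (M.var x) = varˢ x
  shape (M.op o as) with isFormer o in eq
  shape (M.op o as) | false = otherˢ o eq as
  shape M.N₀         | true = N₀ˢ
  shape M.N₁         | true = N₁ˢ
  shape M.N          | true = Nˢ
  shape (M.List A)   | true = Listˢ (shape A)
  shape (A M.⊕ B)    | true = ⊕ˢ (shape A) (shape B)
  shape (M.Σ A B)    | true = Σˢ (shape A) (shape B)
  shape (M.Π A B)    | true = Πˢ (shape A) (shape B)
  shape M.⊥          | true = ⊥ˢ
  shape (A M.∧ B)    | true = ∧ˢ (shape A) (shape B)
  shape (A M.∨ B)    | true = ∨ˢ (shape A) (shape B)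
  shape (A M.⇒ B)    | true = ⇒ˢ (shape A) (shape B)
  shape (M.All A B)  | true = Allˢ (shape A) (shape B)
  shape (M.Ex A B)   | true = Exˢ (shape A) (shape B)
  shape (M.Id A a b) | true = Idˢ (shape A)
  shape M.Propₛ      | true = Propₛˢ

  weaken-size : {e : M.Expr n} → Shape small e → Shape z e
  weaken-size {z = small} s = s
  weaken-size {z = large} {e} _ = shape e

  Shape-ren : {e : M.Expr n} (ρ : M.Ren n m) → Shape z e → Shape z (M.ren ρ e)
  Shape-ren ρ (varˢ x)        = varˢ (ρ x)
  Shape-ren ρ (otherˢ o p as) = otherˢ o p _
  Shape-ren ρ Propₛˢ          = Propₛˢ
  Shape-ren ρ N₀ˢ             = N₀ˢ
  Shape-ren ρ N₁ˢ             = N₁ˢ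
  Shape-ren ρ Nˢ              = Nˢ
  Shape-ren ρ ⊥ˢ              = ⊥ˢ
  Shape-ren ρ (Listˢ s)       = Listˢ (Shape-ren ρ s)
  Shape-ren ρ (⊕ˢ s t)        = ⊕ˢ (Shape-ren ρ s) (Shape-ren ρ t)
  Shape-ren ρ (Σˢ s t)        = Σˢ (Shape-ren ρ s) (Shape-ren (M.liftᴿ₁ ρ) t)
  Shape-ren ρ (Πˢ s t)        = Πˢ (Shape-ren ρ s) (Shape-ren (M.liftᴿ₁ ρ) t)
  Shape-ren ρ (∧ˢ s t)        = ∧ˢ (Shape-ren ρ s) (Shape-ren ρ t)
  Shape-ren ρ (∨ˢ s t)        = ∨ˢ (Shape-ren ρ s) (Shape-ren ρ t)
  Shape-ren ρ (⇒ˢ s t)        = ⇒ˢ (Shape-ren ρ s) (Shape-ren ρ t)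
  Shape-ren ρ (Allˢ s t)      = Allˢ (Shape-ren ρ s) (Shape-ren (M.liftᴿ₁ ρ) t)
  Shape-ren ρ (Exˢ s t)       = Exˢ (Shape-ren ρ s) (Shape-ren (M.liftᴿ₁ ρ) t)
  Shape-ren ρ (Idˢ s)         = Idˢ (Shape-ren ρ s)

  Shape-lift : {σ : M.Sub n m} → (∀ x → Shape small (σ x)) → ∀ x → Shape small (M.lift₁ σ x)
  Shape-lift h zero    = varˢ zero
  Shape-lift h (suc x) = Shape-ren suc (h x)

  Shape-sub : {e : M.Expr n} {σ : M.Sub n m} → (∀ x → Shape small (σ x)) → Shape z e → Shape z (e M.[ σ ])
  Shape-sub h (varˢ x)        = weaken-size (h x)
  Shape-sub h (otherˢ o p as) = otherˢ o p _
  Shape-sub h Propₛˢ          = Propₛˢ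
  Shape-sub h N₀ˢ             = N₀ˢ
  Shape-sub h N₁ˢ             = N₁ˢ
  Shape-sub h Nˢ              = Nˢ
  Shape-sub h ⊥ˢ              = ⊥ˢ
  Shape-sub h (Listˢ s)       = Listˢ (Shape-sub h s)
  Shape-sub h (⊕ˢ s t)        = ⊕ˢ (Shape-sub h s) (Shape-sub h t)
  Shape-sub h (Σˢ s t)        = Σˢ (Shape-sub h s) (Shape-sub (Shape-lift h) t)
  Shape-sub h (Πˢ s t)        = Πˢ (Shape-sub h s) (Shape-sub (Shape-lift h) t)
  Shape-sub h (∧ˢ s t)        = ∧ˢ (Shape-sub h s) (Shape-sub h t)
  Shape-sub h (∨ˢ s t)        = ∨ˢ (Shape-sub h s) (Shape-sub h t)
  Shape-sub h (⇒ˢ s t)        = ⇒ˢ (Shape-sub h s) (Shape-sub h t)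
  Shape-sub h (Allˢ s t)      = Allˢ (Shape-sub h s) (Shape-sub (Shape-lift h) t)
  Shape-sub h (Exˢ s t)       = Exˢ (Shape-sub h s) (Shape-sub (Shape-lift h) t)
  Shape-sub h (Idˢ s)         = Idˢ (Shape-sub h s)

  -- Translated terms under substitution.

  -- A proposition used as a term becomes a code, so no decoding equation intervenes and commutation
  -- is strict. The induction is abstract in the relation between the two substitutions because it
  -- is run twice: for renamings, and then for `_⇝_`, whose closure under lifting relies on the
  -- first run.
  module TermSubstitution
    (_~_  : ∀ {n m} → M.Sub n m → Sub n m → Set)
    (~lift : ∀ {n m} {σ : M.Sub n m} {τ : Sub n m} → σ ~ τ → M.lift₁ σ ~ lift₁ τ)
    (~var  : ∀ {n m} {σ : M.Sub n m} {τ : Sub n m} → σ ~ τ → ∀ x → ‖ σ x ‖ₜ ≡ τ x) where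

    liftᶜ : ∀ k {σ : M.Sub n m} {τ : Sub n m} → σ ~ τ → M.lift k σ ~ lift k τ
    liftᶜ zero    h = h
    liftᶜ (suc k) h = ~lift (liftᶜ k h)

    term-sub : (e : M.Expr n) {σ : M.Sub n m} {τ : Sub n m} → σ ~ τ → ‖ e M.[ σ ] ‖ₜ ≡ ‖ e ‖ₜ [ τ ]
    term-sub (M.var x) h = ~var h x
    term-sub M.N₀ h = refl
    term-sub M.N₁ h = refl
    term-sub M.N h = refl
    term-sub (M.List A) h
      rewrite term-sub A h = refl
    term-sub (A M.⊕ B) h
      rewrite term-sub A h | term-sub B h = refl
    term-sub (M.Σ A B) h
      rewrite term-sub A h | term-sub B (liftᶜ 1 h) = refl
    term-sub (M.Π A B) h
      rewrite term-sub A h | term-sub B (liftᶜ 1 h) = refl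
    term-sub M.⊥ h = refl
    -- The translation weakens the second conjunct into the scope of a binder, which the
    -- substitution has to cross.
    term-sub (φ M.∧ ψ) h
      rewrite term-sub φ h | term-sub ψ h = cong (λ e → L.Σᶜ _ e) (sym (wk-lift 1 _ ‖ ψ ‖ₜ))
    term-sub (φ M.∨ ψ) h
      rewrite term-sub φ h | term-sub ψ h = refl
    term-sub (φ M.⇒ ψ) h
      rewrite term-sub φ h | term-sub ψ h = cong (λ e → L.Πᶜ _ e) (sym (wk-lift 1 _ ‖ ψ ‖ₜ))
    term-sub (M.All A φ) h
      rewrite term-sub A h | term-sub φ (liftᶜ 1 h) = refl
    term-sub (M.Ex A φ) h
      rewrite term-sub A h | term-sub φ (liftᶜ 1 h) = refl
    term-sub (M.Id A a b) h
      rewrite term-sub A h | term-sub a h | term-sub b h = refl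
    term-sub M.Propₛ h = refl
    term-sub (M.cover A I C V a) h
      rewrite term-sub A h | term-sub I (liftᶜ 1 h) | term-sub C (liftᶜ 2 h) | term-sub V h | term-sub a h = refl
    term-sub (M.positive A I C V a) h
      rewrite term-sub A h | term-sub I (liftᶜ 1 h) | term-sub C (liftᶜ 2 h) | term-sub V h | term-sub a h = refl
    term-sub (M.abort c) h
      rewrite term-sub c h = refl
    term-sub M.⋆ h = refl
    term-sub (M.ElN₁ t c) h
      rewrite term-sub t h | term-sub c h = refl
    term-sub M.ze h = refl
    term-sub (M.su t) h
      rewrite term-sub t h = refl
    term-sub (M.ElN t c l) h
      rewrite term-sub t h | term-sub c h | term-sub l (liftᶜ 2 h) = refl
    term-sub M.nil h = refl
    term-sub (M.cons a s) h
      rewrite term-sub a h | term-sub s h = refl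
    term-sub (M.ElList t c l) h
      rewrite term-sub t h | term-sub c h | term-sub l (liftᶜ 3 h) = refl
    term-sub (M.inl a) h
      rewrite term-sub a h = refl
    term-sub (M.inr b) h
      rewrite term-sub b h = refl
    term-sub (M.case d c₁ c₂) h
      rewrite term-sub d h | term-sub c₁ (liftᶜ 1 h) | term-sub c₂ (liftᶜ 1 h) = refl
    term-sub (M.pair a b) h
      rewrite term-sub a h | term-sub b h = refl
    term-sub (M.split d c) h
      rewrite term-sub d h | term-sub c (liftᶜ 2 h) = refl
    term-sub (M.ƛ b) h
      rewrite term-sub b (liftᶜ 1 h) = refl
    term-sub (M.ap f a) h
      rewrite term-sub f h | term-sub a h = refl
    term-sub (M.rfl a) h
      rewrite term-sub a h = refl
    term-sub (M.ElId p c) h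
      rewrite term-sub p h | term-sub c (liftᶜ 1 h) = refl
    term-sub (M.rf a r) h
      rewrite term-sub a h | term-sub r h = refl
    term-sub (M.tr a j r) h
      rewrite term-sub a h | term-sub j h | term-sub r h = refl
    term-sub (M.ind m q₁ q₂) h
      rewrite term-sub m h | term-sub q₁ (liftᶜ 2 h) | term-sub q₂ (liftᶜ 4 h) = refl
    term-sub (M.ax₁ a q) h
      rewrite term-sub a h | term-sub q h = refl
    term-sub (M.ax₂ a i q) h
      rewrite term-sub a h | term-sub i h | term-sub q h = refl
    term-sub (M.ax₃ a m q₁ q₂) h
      rewrite term-sub m h | term-sub q₁ (liftᶜ 2 h) | term-sub q₂ (liftᶜ 3 h) = refl
    term-sub M.choice h = refl
    term-sub M.church h = refl

  -- Translated types under renaming.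

  record Renaming (σ : M.Sub n m) (τ : Sub n m) : Set where
    constructor reindexing
    field
      index  : Ren n m
      source : ∀ x → σ x ≡ M.var (index x)
      target : ∀ x → τ x ≡ var (index x)

  ↑ᴿ : ∀ k → Renaming {n} (M.↑ k) (↑ k)
  ↑ᴿ k = reindexing (k ↑ʳ_) (λ _ → refl) (λ _ → refl)

  infixl 5 _▷ᴿ_
  _▷ᴿ_ : {σ : M.Sub n m} {τ : Sub n m} → Renaming σ τ → (x : Fin m) → Renaming (σ M.▷ M.var x) (τ ▷ var x)
  reindexing ρ s t ▷ᴿ x =
    reindexing (λ { zero → x ; (suc i) → ρ i }) (λ { zero → refl ; (suc i) → s i }) (λ { zero → refl ; (suc i) → t i })

  Renaming-lift : {σ : M.Sub n m} {τ : Sub n m} → Renaming σ τ → Renaming (M.lift₁ σ) (lift₁ τ)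
  Renaming-lift (reindexing ρ s t) = reindexing (liftᴿ₁ ρ)
    (λ { zero → refl ; (suc x) → cong (M.ren suc) (s x) })
    (λ { zero → refl ; (suc x) → cong (ren suc) (t x) })

  open TermSubstitution Renaming Renaming-lift (λ (reindexing ρ s t) x → trans (cong ‖_‖ₜ (s x)) (sym (t x)))
    using () renaming (term-sub to term-ren; liftᶜ to liftᴿ-Renaming)

  -- The last clause of `‖_‖ᵀ` computes only on a concrete operator; the enumeration makes it
  -- available for an abstract one.
  decoded : ∀ o → isFormer o ≡ false → (as : M.Args (M.arity o) n) → ‖ M.op o as ‖ᵀ ≡ T ‖ M.op o as ‖ₜ
  decoded M.`cover refl _ = refl
  decoded M.`positive refl _ = refl
  decoded M.`abort refl _ = refl
  decoded M.`⋆ refl _ = refl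
  decoded M.`ElN₁ refl _ = refl
  decoded M.`ze refl _ = refl
  decoded M.`su refl _ = refl
  decoded M.`ElN refl _ = refl
  decoded M.`nil refl _ = refl
  decoded M.`cons refl _ = refl
  decoded M.`ElList refl _ = refl
  decoded M.`inl refl _ = refl
  decoded M.`inr refl _ = refl
  decoded M.`case refl _ = refl
  decoded M.`pair refl _ = refl
  decoded M.`split refl _ = refl
  decoded M.`λ refl _ = refl
  decoded M.`ap refl _ = refl
  decoded M.`rfl refl _ = refl
  decoded M.`ElId refl _ = refl
  decoded M.`rf refl _ = refl
  decoded M.`tr refl _ = refl
  decoded M.`ind refl _ = refl
  decoded M.`ax₁ refl _ = refl
  decoded M.`ax₂ refl _ = refl
  decoded M.`ax₃ refl _ = refl
  decoded M.`choice refl _ = refl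
  decoded M.`church refl _ = refl

  -- A type variable is sent to a type variable, so `T` is never applied to a code former that could
  -- be decoded. No typing is involved, and the equation is strict.
  type-ren : {A : M.Expr n} {σ : M.Sub n m} {τ : Sub n m} → Shape z A → Renaming σ τ → ‖ A M.[ σ ] ‖ᵀ ≡ ‖ A ‖ᵀ [ τ ]
  type-ren (varˢ x) (reindexing ρ s t) = trans (cong ‖_‖ᵀ (s x)) (cong T (sym (t x)))
  type-ren (otherˢ o p as) h =
    trans (decoded o p _) (trans (cong T (term-ren (M.op o as) h)) (cong (_[ _ ]) (sym (decoded o p as))))
  type-ren Propₛˢ     h = refl
  type-ren N₀ˢ        h = refl
  type-ren N₁ˢ        h = refl
  type-ren Nˢ         h = refl
  type-ren ⊥ˢ         h = refl
  type-ren (Listˢ s)  h = cong List (type-ren s h)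
  type-ren (⊕ˢ s t)   h = cong₂ _⊕_ (type-ren s h) (type-ren t h)
  type-ren (Σˢ s t)   h = cong₂ Σ (type-ren s h) (type-ren t (Renaming-lift h))
  type-ren (Πˢ s t)   h = cong₂ Π (type-ren s h) (type-ren t (Renaming-lift h))
  type-ren (∧ˢ {B = B} s t)   h = cong₂ Σ (type-ren s h) (trans (cong (_[ ↑ 1 ]) (type-ren t h)) (sym (wk-lift 1 _ ‖ B ‖ᵀ)))
  type-ren (∨ˢ s t)   h = cong₂ _⊕_ (type-ren s h) (type-ren t h)
  type-ren (⇒ˢ {B = B} s t)   h = cong₂ Π (type-ren s h) (trans (cong (_[ ↑ 1 ]) (type-ren t h)) (sym (wk-lift 1 _ ‖ B ‖ᵀ)))
  type-ren (Allˢ s t) h = cong₂ Π (type-ren s h) (type-ren t (Renaming-lift h))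
  type-ren (Exˢ s t)  h = cong₂ Σ (type-ren s h) (type-ren t (Renaming-lift h))
  type-ren (Idˢ {a = a} {b} s) h rewrite type-ren s h | term-ren a h | term-ren b h = refl

  wkᵀ : ∀ k (A : M.Expr n) → ‖ A M.[ M.↑ k ] ‖ᵀ ≡ ‖ A ‖ᵀ [ ↑ k ]
  wkᵀ k A = type-ren (shape A) (↑ᴿ k)

  infix 4 _⇝_
  record _⇝_ (σ : M.Sub n m) (τ : Sub n m) : Set where
    constructor _&_
    field
      equal  : ∀ x → ‖ σ x ‖ₜ ≡ τ x
      shapes : ∀ x → Shape small (σ x)
  open _⇝_ public

  ⇝-lift : {σ : M.Sub n m} {τ : Sub n m} → σ ⇝ τ → M.lift₁ σ ⇝ lift₁ τ
  ⇝-lift h .equal zero = refl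
  ⇝-lift {σ = σ} h .equal (suc x) =
    trans (cong ‖_‖ₜ (MS.ren-as-sub suc (σ x)))
      (trans (term-ren (σ x) (reindexing suc (λ _ → refl) (λ _ → refl)))
        (trans (sym (ren-as-sub suc ‖ σ x ‖ₜ)) (cong (ren suc) (equal h x))))
  ⇝-lift h .shapes = Shape-lift (shapes h)

  open TermSubstitution _⇝_ ⇝-lift equal using (term-sub)

  ⇝ids : M.ids {n} ⇝ ids
  ⇝ids = (λ _ → refl) & varˢ

  ⇝↑ : ∀ k → M.↑ {n} k ⇝ ↑ k
  ⇝↑ k = (λ _ → refl) & (λ _ → varˢ _)

  infixl 5 _⇝▷_
  _⇝▷_ : {σ : M.Sub n m} {τ : Sub n m} {a : M.Expr m} → σ ⇝ τ → Shape small a → σ M.▷ a ⇝ τ ▷ ‖ a ‖ₜ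
  (h ⇝▷ s) .equal zero     = refl
  (h ⇝▷ s) .equal (suc x)  = equal h x
  (h ⇝▷ s) .shapes zero    = s
  (h ⇝▷ s) .shapes (suc x) = shapes h x

  ⇝‖‖ : {σ : M.Sub n m} → (∀ x → Shape small (σ x)) → σ ⇝ (λ x → ‖ σ x ‖ₜ)
  ⇝‖‖ h = (λ _ → refl) & h

  -- Decoding of codes and types under substitution.

  cast-≐ : {A A' B B' : Type n} → A ≡ A' → B ≡ B' → Γ ⊢ A ≐ B type → Γ ⊢ A' ≐ B' type
  cast-≐ refl refl d = d

  sub-wk-lift : ∀ {s} (σ : Sub n m) (e : Exp s n) → e [ ↑ 1 ] [ lift 1 σ ] ≡ e [ (λ x → σ x [ ↑ 1 ]) ]
  sub-wk-lift σ = sub-sub (λ x → ren-as-sub suc (σ x))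

  -- An arbitrary, not necessarily typed σ lets the induction pass under the
  -- weakening in the translations of ∧ and ⇒; similarly in type-sub.
  decode-sub : {e : M.Expr n} → Shape small e → (σ : Sub n m) → Γ ⊢ ‖ e ‖ₜ [ σ ] ∈ U₀ → Γ ⊢ T (‖ e ‖ₜ [ σ ]) ≐ ‖ e ‖ᵀ [ σ ] type
  decode-sub-wk : {e : M.Expr n} → Shape small e → (σ : Sub n m) → Γ ⊢ ‖ e ‖ₜ [ ↑ 1 ] [ lift 1 σ ] ∈ U₀ →
    Γ ⊢ T (‖ e ‖ₜ [ ↑ 1 ] [ lift 1 σ ]) ≐ ‖ e ‖ᵀ [ ↑ 1 ] [ lift 1 σ ] type
  decode-sub (varˢ x) σ d = type-refl (T-F d)
  decode-sub (otherˢ o p as) σ d =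
    cast-≐ refl (cong (_[ σ ]) (sym (decoded o p as))) (type-refl (T-F d))
  decode-sub N₀ˢ σ d = T-N₀ (context d)
  decode-sub N₁ˢ σ d = T-N₁ (context d)
  decode-sub Nˢ  σ d = T-N (context d)
  decode-sub ⊥ˢ  σ d = T-N₀ (context d)
  decode-sub (Listˢ s) σ d with premises d
  ... | Listᶜ-premises a = type-trans (T-List a) (List-≐ (decode-sub s σ a))
  ... | no-code ()
  decode-sub (⊕ˢ s t) σ d with premises d
  ... | ⊕ᶜ-premises a b = type-trans (T-⊕ a b) (⊕-≐ (decode-sub s σ a) (decode-sub t σ b))
  ... | no-code ()
  decode-sub (Σˢ s t) σ d with premises d
  ... | Σᶜ-premises a b = type-trans (T-Σ a b) (Σ-≐ (decode-sub s σ a) (decode-sub t (lift 1 σ) b))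
  ... | no-code ()
  decode-sub (Πˢ s t) σ d with premises d
  ... | Πᶜ-premises a b = type-trans (T-Π a b) (Π-≐ (decode-sub s σ a) (decode-sub t (lift 1 σ) b))
  ... | no-code ()
  decode-sub (∧ˢ s t) σ d with premises d
  ... | Σᶜ-premises a b = type-trans (T-Σ a b) (Σ-≐ (decode-sub s σ a) (decode-sub-wk t σ b))
  ... | no-code ()
  decode-sub (∨ˢ s t) σ d with premises d
  ... | ⊕ᶜ-premises a b = type-trans (T-⊕ a b) (⊕-≐ (decode-sub s σ a) (decode-sub t σ b))
  ... | no-code ()
  decode-sub (⇒ˢ s t) σ d with premises d
  ... | Πᶜ-premises a b = type-trans (T-Π a b) (Π-≐ (decode-sub s σ a) (decode-sub-wk t σ b))
  ... | no-code ()
  decode-sub (Allˢ s t) σ d with premises d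
  ... | Πᶜ-premises a b = type-trans (T-Π a b) (Π-≐ (decode-sub s σ a) (decode-sub t (lift 1 σ) b))
  ... | no-code ()
  decode-sub (Exˢ s t) σ d with premises d
  ... | Σᶜ-premises a b = type-trans (T-Σ a b) (Σ-≐ (decode-sub s σ a) (decode-sub t (lift 1 σ) b))
  ... | no-code ()
  decode-sub (Idˢ s) σ d with premises d
  ... | Idᶜ-premises a b c = type-trans (T-Id a b c) (Id-≐ (decode-sub s σ a) (∈-refl b) (∈-refl c))
  ... | no-code ()
  decode-sub-wk {e = e} s σ d =
    cast-≐ (cong T (sym (sub-wk-lift σ ‖ e ‖ₜ))) (sym (sub-wk-lift σ ‖ e ‖ᵀ))
      (decode-sub s _ (≡.subst (λ t → _ ⊢ t ∈ U₀) (sub-wk-lift σ ‖ e ‖ₜ) d))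

  decode : {e : M.Expr n} → Shape small e → Γ ⊢ ‖ e ‖ₜ ∈ U₀ → Γ ⊢ T ‖ e ‖ₜ ≐ ‖ e ‖ᵀ type
  decode {Γ = Γ} {e} s d =
    cast-≐ (cong T (sub-ids (λ _ → refl) _)) (sub-ids (λ _ → refl) _)
      (decode-sub s ids (≡.subst (λ t → Γ ⊢ t ∈ U₀) (sym (sub-ids (λ _ → refl) ‖ e ‖ₜ)) d))

  -- The two sides differ only at type variables, where `T` of a code meets the translated type, and
  -- `decode` compares them. The hypothesis that the left side is a type is inverted along the
  -- expression until, at each variable, it yields the membership in `U₀` that `decode` requires.
  type-sub : {A : M.Expr n} {σ : M.Sub n m} {τ : Sub n m} → Shape z A → σ ⇝ τ →
    Δ ⊢ ‖ A ‖ᵀ [ τ ] type → Δ ⊢ ‖ A ‖ᵀ [ τ ] ≐ ‖ A M.[ σ ] ‖ᵀ type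
  type-sub-wk : {A : M.Expr n} {σ : M.Sub n m} {τ : Sub n m} → Shape z A → σ ⇝ τ →
    Δ ⊢ ‖ A ‖ᵀ [ ↑ 1 ] [ lift 1 τ ] type → Δ ⊢ ‖ A ‖ᵀ [ ↑ 1 ] [ lift 1 τ ] ≐ ‖ A M.[ σ ] ‖ᵀ [ ↑ 1 ] type
  type-sub {Δ = Δ} {σ = σ} (varˢ x) h d =
    cast-≐ (cong T (equal h x)) refl
      (decode (shapes h x) (≡.subst (λ t → Δ ⊢ t ∈ U₀) (sym (equal h x)) (premises d)))
  type-sub (otherˢ o p as) h d =
    cast-≐ refl (trans (cong (_[ _ ]) (decoded o p as)) (trans (cong T (sym (term-sub (M.op o as) h))) (sym (decoded o p _))))
      (type-refl d)
  type-sub Propₛˢ     h d = type-refl d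
  type-sub N₀ˢ        h d = type-refl d
  type-sub N₁ˢ        h d = type-refl d
  type-sub Nˢ         h d = type-refl d
  type-sub ⊥ˢ         h d = type-refl d
  type-sub (Listˢ s)  h d = List-≐ (type-sub s h (premises d))
  type-sub (⊕ˢ s t)   h d with a , b ← premises d = ⊕-≐ (type-sub s h a) (type-sub t h b)
  type-sub (Σˢ s t)   h d with a , b ← premises d = Σ-≐ (type-sub s h a) (type-sub t (⇝-lift h) b)
  type-sub (Πˢ s t)   h d with a , b ← premises d = Π-≐ (type-sub s h a) (type-sub t (⇝-lift h) b)
  type-sub (∧ˢ s t)   h d with a , b ← premises d = Σ-≐ (type-sub s h a) (type-sub-wk t h b)
  type-sub (∨ˢ s t)   h d with a , b ← premises d = ⊕-≐ (type-sub s h a) (type-sub t h b)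
  type-sub (⇒ˢ s t)   h d with a , b ← premises d = Π-≐ (type-sub s h a) (type-sub-wk t h b)
  type-sub (Allˢ s t) h d with a , b ← premises d = Π-≐ (type-sub s h a) (type-sub t (⇝-lift h) b)
  type-sub (Exˢ s t)  h d with a , b ← premises d = Σ-≐ (type-sub s h a) (type-sub t (⇝-lift h) b)
  type-sub (Idˢ {a = a'} {b'} s) h d with a , b , c ← premises d =
    Id-≐ (type-sub s h a) (≐-term (sym (term-sub a' h)) b) (≐-term (sym (term-sub b' h)) c)
    where
    ≐-term : ∀ {n} {Γ : Context n} {a b A} → a ≡ b → Γ ⊢ a ∈ A → Γ ⊢ a ≐ b ∈ A
    ≐-term refl d = ∈-refl d
  type-sub-wk {A = A} {σ} {τ} s h d =
    cast-≐ (sym (sub-wk-lift _ ‖ A ‖ᵀ)) (trans (cong ‖_‖ᵀ (sym (MS.sub-sub (λ _ → refl) A))) (wkᵀ 1 (A M.[ σ ])))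
      (type-sub s h↑ (cast-type (sub-wk-lift _ ‖ A ‖ᵀ) d))
    where
    h↑ : (λ x → σ x M.[ M.↑ 1 ]) ⇝ (λ x → τ x [ ↑ 1 ])
    h↑ .equal x  = trans (term-ren (σ x) (↑ᴿ 1)) (cong (_[ ↑ 1 ]) (equal h x))
    h↑ .shapes x = Shape-sub (λ _ → varˢ _) (shapes h x)

  to : (A : M.Expr n) {σ : M.Sub n m} {τ : Sub n m} → σ ⇝ τ → Δ ⊢ t ∈ ‖ A ‖ᵀ [ τ ] → Δ ⊢ t ∈ ‖ A M.[ σ ] ‖ᵀ
  to A h d = conv d (type-sub (shape A) h (wellFormed d))

  -- Formation of the strict instance is supplied by the caller, because `type-sub` reads its typing
  -- information off that side and the other side does not give it back.
  from : (A : M.Expr n) {σ : M.Sub n m} {τ : Sub n m} → σ ⇝ τ → Δ ⊢ ‖ A ‖ᵀ [ τ ] type →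
    Δ ⊢ t ∈ ‖ A M.[ σ ] ‖ᵀ → Δ ⊢ t ∈ ‖ A ‖ᵀ [ τ ]
  from A h hA d = conv d (type-sym (type-sub (shape A) h hA))

  to-≐ : (A : M.Expr n) {σ : M.Sub n m} {τ : Sub n m} → σ ⇝ τ → Δ ⊢ t ≐ u ∈ ‖ A ‖ᵀ [ τ ] → Δ ⊢ t ≐ u ∈ ‖ A M.[ σ ] ‖ᵀ
  to-≐ A h d = conv-≐ d (type-sub (shape A) h (proj₂ (proj₂ (wellFormed d))))

  ≐-reduct : ∀ {k} (b : M.Expr k) {ρ : M.Sub k m} {ρ' : Sub k m} → ρ ⇝ ρ' →
    Δ ⊢ t ≐ ‖ b ‖ₜ [ ρ' ] ∈ X → Δ ⊢ t ≐ ‖ b M.[ ρ ] ‖ₜ ∈ X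
  ≐-reduct {Δ = Δ} b h d = ≡.subst (λ u → Δ ⊢ _ ≐ u ∈ _) (sym (term-sub b h)) d

  ⊢conv : Δ ⊢ˢ ids ∶ Γ → Γ ⊢ X ≐ Y type → Δ ▸ Y ⊢ˢ ids ∶ Γ ▸ X
  ⊢conv h e = ▸-recast h (recast h (proj₂ (wellFormed e))) (recast h (type-sym e))

  v₁∈ : Γ ▸ X ▸ Y ctx → Γ ▸ X ▸ Y ⊢ v₁ ∈ X [ ↑ 2 ]
  v₁∈ {X = X} g = cast (sub-sub (λ _ → refl) X) (var-∈ g (suc zero))

  tail : Γ ▸ X ctx → Γ ctx
  tail (▸-ctx g _) = g

  last : Γ ▸ X ctx → Γ ⊢ X type
  last (▸-ctx _ d) = d

  -- Codes of small types and branches of eliminators.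

  infix 3 _⊢code_
  _⊢code_ : Context n → M.Expr n → Set
  Γ ⊢code A = Γ ⊢ ‖ A ‖ₜ ∈ U₀ × Shape small A

  decoding : Γ ⊢code A → Γ ⊢ T ‖ A ‖ₜ ≐ ‖ A ‖ᵀ type
  decoding (d , s) = decode s d

  code-type : Γ ⊢code A → Γ ⊢ ‖ A ‖ᵀ type
  code-type c = proj₂ (wellFormed (decoding c))

  code-sub : (A : M.Expr n) {σ : M.Sub n m} {τ : Sub n m} → σ ⇝ τ → Δ ⊢ˢ τ ∶ Γ → Γ ⊢code A → Δ ⊢code A M.[ σ ]
  code-sub {Δ = Δ} A h hτ (d , s) =
    ≡.subst (λ e → Δ ⊢ e ∈ U₀) (sym (term-sub A h)) (sub hτ d) , Shape-sub (shapes h) s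

  element : Γ ⊢code A → Γ ⊢ t ∈ ‖ A ‖ᵀ → Γ ⊢ t ∈ T ‖ A ‖ₜ
  element c d = conv d (type-sym (decoding c))

  element-inst : Γ ▸ ‖ A ‖ᵀ ⊢code I → Shape small a → Γ ⊢ ‖ a ‖ₜ ∈ ‖ A ‖ᵀ → Γ ⊢ t ∈ ‖ I M.[ M.ids M.▷ a ] ‖ᵀ →
    Γ ⊢ t ∈ T (‖ I ‖ₜ [ ids ▷ ‖ a ‖ₜ ])
  element-inst {I = I} c s ha ht =
    cast (cong T (term-sub I (⇝ids ⇝▷ s)))
      (element (code-sub I (⇝ids ⇝▷ s) (⊢inst (context ha) ha) c) ht)

  -- Codes of binders take families over `T ‖ A ‖ₜ`, whereas interpreted contexts contain `‖ A ‖ᵀ`.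
  over-code : Γ ⊢code A → Γ ▸ ‖ A ‖ᵀ ⊢ 𝒥 → Γ ▸ T ‖ A ‖ₜ ⊢ 𝒥
  over-code c = recast (⊢conv (⊢ids (context (proj₁ c))) (type-sym (decoding c)))

  -- A branch has the motive at a constructor, which is not a variable, so translation and
  -- substitution agree there only up to `≐`. This lemma and its analogues for the other types
  -- convert a branch to the form that the rule of MLtt_cind expects.
  N-step : Γ ▸ N ⊢ ‖ M ‖ᵀ type → Γ ▸ N ▸ ‖ M ‖ᵀ ⊢ t ∈ ‖ M M.[ M.↑ 2 M.▷ M.su M.v₁ ] ‖ᵀ →
    Γ ▸ N ▸ ‖ M ‖ᵀ ⊢ t ∈ ‖ M ‖ᵀ [ ↑ 2 ▷ su v₁ ]
  N-step {M = M} hM d = from M (⇝↑ 2 ⇝▷ other)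
    (sub (⊢▷ {A = N} (⊢↑² g (tail g)) (N-Iₛ (v₁∈ g))) hM) d
    where g = context d

  List-step : Γ ⊢ ‖ A ‖ᵀ type → Γ ▸ List ‖ A ‖ᵀ ⊢ ‖ M ‖ᵀ type →
    Γ ▸ ‖ A ‖ᵀ ▸ List ‖ A M.[ M.↑ 1 ] ‖ᵀ ▸ ‖ M M.[ M.↑ 2 M.▷ M.v₀ ] ‖ᵀ ⊢ t ∈ ‖ M M.[ M.↑ 3 M.▷ M.cons M.v₂ M.v₁ ] ‖ᵀ →
    Γ ▸ ‖ A ‖ᵀ ▸ List (‖ A ‖ᵀ [ ↑ 1 ]) ▸ ‖ M ‖ᵀ [ ↑ 2 ▷ v₀ ] ⊢ t ∈ ‖ M ‖ᵀ [ ↑ 3 ▷ cons v₂ v₁ ]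
  List-step {Γ = Γ} {A = A} {M = M} {t = t} hA hM d = from M (⇝↑ 3 ⇝▷ other)
    (sub (⊢▷ {A = List ‖ A ‖ᵀ} ↑³ (List-Iₛ (sub ↑³ hA)
      (cast (trans (cong (_[ ↑ 1 ]) (sub-sub (λ _ → refl) ‖ A ‖ᵀ)) (sub-sub (λ _ → refl) ‖ A ‖ᵀ)) (var-∈ g (suc (suc zero))))
      (cast (cong List (trans (sub-sub (λ _ → refl) (‖ A ‖ᵀ [ ↑ 1 ])) (sub-sub (λ _ → refl) ‖ A ‖ᵀ))) (var-∈ g (suc zero))))) hM) d'
    where
    -- The instances in the context come from renamings, so they are rewritten strictly before the
    -- type of the branch is converted.
    d' : Γ ▸ ‖ A ‖ᵀ ▸ List (‖ A ‖ᵀ [ ↑ 1 ]) ▸ ‖ M ‖ᵀ [ ↑ 2 ▷ v₀ ] ⊢ t ∈ ‖ M M.[ M.↑ 3 M.▷ M.cons M.v₂ M.v₁ ] ‖ᵀ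
    d' = ≡.subst₂ (λ X Y → Γ ▸ ‖ A ‖ᵀ ▸ List X ▸ Y ⊢ t ∈ ‖ M M.[ M.↑ 3 M.▷ M.cons M.v₂ M.v₁ ] ‖ᵀ)
           (wkᵀ 1 A) (type-ren (shape M) (↑ᴿ 2 ▷ᴿ zero)) d
    g = context d'
    ↑³ : Γ ▸ ‖ A ‖ᵀ ▸ List (‖ A ‖ᵀ [ ↑ 1 ]) ▸ ‖ M ‖ᵀ [ ↑ 2 ▷ v₀ ] ⊢ˢ ↑ 3 ∶ Γ
    ↑³ = ⊢⨟ (⊢↑ (tail (tail g))) (⊢↑² g (tail g))

  inl-step : Γ ▸ X ⊕ Y ⊢ ‖ M ‖ᵀ type → Γ ⊢ X type → Γ ⊢ Y type →
    Γ ▸ X ⊢ t ∈ ‖ M M.[ M.↑ 1 M.▷ M.inl M.v₀ ] ‖ᵀ → Γ ▸ X ⊢ t ∈ ‖ M ‖ᵀ [ ↑ 1 ▷ inl v₀ ]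
  inl-step {X = X} {Y = Y} {M = M} hM hX hY d = from M (⇝↑ 1 ⇝▷ other)
    (sub (⊢▷ {A = X ⊕ Y} (⊢↑ g) (⊕-I₁ (wk hX hX) (wk hX hY) (var-∈ g zero))) hM) d
    where g = context d

  inr-step : Γ ▸ X ⊕ Y ⊢ ‖ M ‖ᵀ type → Γ ⊢ X type → Γ ⊢ Y type →
    Γ ▸ Y ⊢ t ∈ ‖ M M.[ M.↑ 1 M.▷ M.inr M.v₀ ] ‖ᵀ → Γ ▸ Y ⊢ t ∈ ‖ M ‖ᵀ [ ↑ 1 ▷ inr v₀ ]
  inr-step {X = X} {Y = Y} {M = M} hM hX hY d = from M (⇝↑ 1 ⇝▷ other)
    (sub (⊢▷ {A = X ⊕ Y} (⊢↑ g) (⊕-I₂ (wk hY hX) (wk hY hY) (var-∈ g zero))) hM) d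
    where g = context d

  pair-step : {Y : Type (suc n)} → Γ ▸ Σ X Y ⊢ ‖ M ‖ᵀ type → Γ ▸ X ⊢ Y type →
    Γ ▸ X ▸ Y ⊢ t ∈ ‖ M M.[ M.↑ 2 M.▷ M.pair M.v₁ M.v₀ ] ‖ᵀ → Γ ▸ X ▸ Y ⊢ t ∈ ‖ M ‖ᵀ [ ↑ 2 ▷ pair v₁ v₀ ]
  pair-step {Γ = Γ} {X = X} {M = M} {Y = Y} hM hY d = from M (⇝↑ 2 ⇝▷ other)
    (sub (⊢▷ {A = Σ X Y} ↑² (Σ-I (sub ↑² hX) (sub (⊢lift ↑² hX) hY) (v₁∈ g)
      (cast (sym (sub-sub (λ { zero → refl ; (suc x) → refl }) Y)) (var-∈ g zero)))) hM) d
    where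
    g = context d
    hX = last (tail g)
    ↑² : Γ ▸ X ▸ Y ⊢ˢ ↑ 2 ∶ Γ
    ↑² = ⊢↑² g (tail g)

  -- Axiom sets, covers and positivity relations.

  -- An axiom set as the interpretation delivers it, over translated types. The rules of MLtt_cind
  -- ask for the same data over decodings of codes; `axioms` passes from one to the other.
  record Axioms (Γ : Context n) (A : M.Expr n) (I : M.Expr (1 + n)) (C : M.Expr (2 + n)) : Set where
    field
      points  : Γ ⊢code A
      indices : Γ ▸ ‖ A ‖ᵀ ⊢code I
      covered : Γ ▸ ‖ A ‖ᵀ ▸ ‖ I ‖ᵀ ⊢ ‖ C ‖ₜ ∈ Π ‖ A M.[ M.↑ 2 ] ‖ᵀ U₀
  open Axioms

  points-conv : (S : Axioms Γ A I C) → Γ ▸ T ‖ A ‖ₜ ⊢ˢ ids ∶ Γ ▸ ‖ A ‖ᵀ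
  points-conv S = ⊢conv (⊢ids (context (proj₁ (points S)))) (type-sym (decoding (points S)))

  indices-conv : (S : Axioms Γ A I C) → Γ ▸ T ‖ A ‖ₜ ▸ T ‖ I ‖ₜ ⊢ˢ ids ∶ Γ ▸ ‖ A ‖ᵀ ▸ ‖ I ‖ᵀ
  indices-conv S = ⊢conv (points-conv S) (type-sym (decoding (indices S)))

  subset-conv : Γ ⊢code A → Γ ⊢ t ∈ Π ‖ A ‖ᵀ U₀ → Γ ⊢ t ∈ T ‖ A ‖ₜ ⇒ U₀
  subset-conv c d with hA , hU ← premises (wellFormed d) = conv d (Π-≐ (type-sym (decoding c)) (type-refl hU))

  axioms : Axioms Γ A I C → AxiomSet Γ ‖ A ‖ₜ ‖ I ‖ₜ ‖ C ‖ₜ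
  axioms {Γ = Γ} {A = A} {I = I} {C = C} S = axiomSet (proj₁ (points S)) (recast (points-conv S) (proj₁ (indices S)))
    (cast (cong (λ e → T e ⇒ U₀) (term-ren A (↑ᴿ 2)))
      (recast (indices-conv S) (subset-conv A↑² (covered S))))
    where
    g = context (covered S)
    A↑² : Γ ▸ ‖ A ‖ᵀ ▸ ‖ I ‖ᵀ ⊢code A M.[ M.↑ 2 ]
    A↑² = code-sub A (⇝↑ 2) (⊢↑² g (tail g)) (points S)

  -- The quantifier ranges over the translated set on one side and over the decoding of its code on
  -- the other. The weakening of `φ` comes from the implication, whose proof the conclusion does not
  -- mention.
  below-≐ : Γ ⊢code A → (D : M.Expr n) (φ : M.Expr (1 + n)) → Γ ⊢ ‖ M.below A D φ ‖ᵀ type →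
    Γ ⊢ ‖ M.below A D φ ‖ᵀ ≐ below ‖ A ‖ₜ ‖ D ‖ₜ (‖ φ ‖ᵀ [ ↑ 1 ]) type
  below-≐ c D φ d = Π-≐ (type-sym (decoding c))
    (cast-≐ refl (cong (λ e → Π (T (ap e v₀)) (‖ φ ‖ᵀ [ ↑ 1 ])) (term-ren D (↑ᴿ 1))) (type-refl (proj₂ (premises d))))

  cover-≡ : ∀ A I C V t {σ : M.Sub n m} {τ : Sub n m} → Renaming σ τ →
    ‖ M.coverₛ σ A I C V t ‖ᵀ ≡ coverₛ τ ‖ A ‖ₜ ‖ I ‖ₜ ‖ C ‖ₜ ‖ V ‖ₜ ‖ t ‖ₜ
  cover-≡ A I C V t h = cong T (coverᶜ-cong (term-ren A h) (term-ren I (liftᴿ-Renaming 1 h))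
    (term-ren C (liftᴿ-Renaming 2 h)) (term-ren V h) refl)

  positive-≡ : ∀ A I C V t {σ : M.Sub n m} {τ : Sub n m} → Renaming σ τ →
    ‖ M.positiveₛ σ A I C V t ‖ᵀ ≡ positiveₛ τ ‖ A ‖ₜ ‖ I ‖ₜ ‖ C ‖ₜ ‖ V ‖ₜ ‖ t ‖ₜ
  positive-≡ A I C V t h = cong T (positiveᶜ-cong (term-ren A h) (term-ren I (liftᴿ-Renaming 1 h))
    (term-ren C (liftᴿ-Renaming 2 h)) (term-ren V h) refl)

  cover-≡-wk : ∀ k A I C V {t : M.Expr (k + n)} →
    ‖ M.coverₛ (M.↑ k) A I C V t ‖ᵀ [ ↑ 1 ] ≡ coverₛ (↑ (suc k)) ‖ A ‖ₜ ‖ I ‖ₜ ‖ C ‖ₜ ‖ V ‖ₜ (‖ t ‖ₜ [ ↑ 1 ])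
  cover-≡-wk k A I C V {t} =
    trans (cong (_[ ↑ 1 ]) (cover-≡ A I C V t (↑ᴿ k))) (coverₛ-sub (λ _ → refl) ‖ A ‖ₜ ‖ I ‖ₜ ‖ C ‖ₜ ‖ V ‖ₜ ‖ t ‖ₜ)

  ⟦tr⟧-premise : ∀ V → Axioms Γ A I C → Shape small a → Shape small j →
    Γ ⊢ t ∈ ‖ M.below A (C M.[ M.ids M.▷ a M.▷ j ]) (M.coverₛ (M.↑ 1) A I C V M.v₀) ‖ᵀ →
    Γ ⊢ t ∈ below ‖ A ‖ₜ (‖ C ‖ₜ [ ids ▷ ‖ a ‖ₜ ▷ ‖ j ‖ₜ ]) (coverₛ (↑ 2) ‖ A ‖ₜ ‖ I ‖ₜ ‖ C ‖ₜ ‖ V ‖ₜ v₁)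
  ⟦tr⟧-premise {A = A} {I} {C} V S aˢ jˢ d =
    cast (below-cong refl (term-sub C (⇝ids ⇝▷ aˢ ⇝▷ jˢ)) (cover-≡-wk 1 A I C V))
      (conv d (below-≐ (points S) (C M.[ _ ]) (M.coverₛ (M.↑ 1) A I C V M.v₀) (wellFormed d)))

  -- Motives of mTT_cind depend on the point alone, so the dependent eliminator is used at `P`
  -- weakened by the proof of the cover. The contexts of the branches are then converted entry by
  -- entry from translated types to decodings.
  ⟦induction⟧ : Axioms Γ A I C → Γ ⊢ ‖ V ‖ₜ ∈ Π ‖ A ‖ᵀ U₀ → Γ ▸ ‖ A ‖ᵀ ⊢ ‖ P ‖ᵀ type →
    ∀ {q₁ q₂} → Γ ▸ ‖ A ‖ᵀ ▸ ‖ M.v₀ M.ε V M.[ M.↑ 1 ] ‖ᵀ ⊢ q₁ ∈ ‖ P M.[ M.↑ 2 M.▷ M.v₁ ] ‖ᵀ →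
    Γ ▸ ‖ A ‖ᵀ ▸ ‖ I ‖ᵀ ▸ ‖ M.below (A M.[ M.↑ 2 ]) C (M.coverₛ (M.↑ 3) A I C V M.v₀) ‖ᵀ
      ▸ ‖ M.below (A M.[ M.↑ 3 ]) (C M.[ M.↑ 1 ]) (P M.[ M.↑ 4 M.▷ M.v₀ ]) ‖ᵀ ⊢ q₂ ∈ ‖ P M.[ M.↑ 4 M.▷ M.v₃ ] ‖ᵀ →
    Induction Γ ‖ A ‖ₜ ‖ I ‖ₜ ‖ C ‖ₜ ‖ V ‖ₜ (‖ P ‖ᵀ [ ↑ 1 ]) q₁ q₂
  ⟦induction⟧ {Γ = Γ} {A = A} {I} {C} {V} {P} S hV hP h₁ h₂ = record
    { axioms = ax
    ; subset = hv
    ; motive = wk (T-F (cover-F (AxiomSet-sub w ax) (sub w hv) (var-∈ (target w) zero))) (recast (points-conv S) hP)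
    ; rfCase = cast (trans (type-ren (shape P) (↑ᴿ 2 ▷ᴿ suc zero)) (sym (wk-▷ ‖ P ‖ᵀ)))
        (recast (⊢conv (points-conv S) (cast-≐ refl (cong (λ e → T (ap e v₀)) (term-ren V (↑ᴿ 1))) (type-refl (last (context h₁))))) h₁)
    ; trCase = cast (trans (type-ren (shape P) (↑ᴿ 4 ▷ᴿ suc (suc (suc zero)))) (sym (wk-▷ ‖ P ‖ᵀ)))
        (recast (⊢conv (⊢conv (indices-conv S)
          (cast-≐ refl (below-cong (term-ren A (↑ᴿ 2)) (refl {x = ‖ C ‖ₜ}) (cover-≡-wk 3 A I C V))
            (below-≐ (code-sub A (⇝↑ 2) ↑² (points S)) C (M.coverₛ (M.↑ 3) A I C V M.v₀) (last (tail g)))))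
          (cast-≐ refl (below-cong (term-ren A (↑ᴿ 3)) (term-ren C (↑ᴿ 1))
                         (trans (cong (_[ ↑ 1 ]) (type-ren (shape P) (↑ᴿ 4 ▷ᴿ zero)))
                           (trans (sub-sub (λ _ → refl) ‖ P ‖ᵀ)
                             (trans (sub-cong (λ { zero → refl ; (suc x) → refl }) ‖ P ‖ᵀ) (sym (sub-sub (λ _ → refl) ‖ P ‖ᵀ))))))
            (below-≐ (code-sub A (⇝↑ 3) (⊢⨟ ↑² (⊢↑ (tail g))) (points S)) (C M.[ M.↑ 1 ]) (P M.[ M.↑ 4 M.▷ M.v₀ ]) (last g)))) h₂)
    }
    where
    ax = axioms S
    hv = subset-conv (points S) hV
    g = context h₂
    ↑² : Γ ▸ ‖ A ‖ᵀ ▸ ‖ I ‖ᵀ ⊢ˢ ↑ 2 ∶ Γ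
    ↑² = ⊢↑² (tail (tail g)) (tail (tail (tail g)))
    w : Γ ▸ T ‖ A ‖ₜ ⊢ˢ ↑ 1 ∶ Γ
    w = ⊢↑ (▸-ctx (context hV) (T-F (proj₁ (points S))))

  -- The agreement has to be syntactic, as there is no ξ-rule to convert under the two abstractions.
  recursiveCall-≡ : ∀ (r : M.Expr n) q₁ q₂ →
    ‖ M.ƛ (M.ƛ (M.ind (M.ap (M.ap (r M.[ M.↑ 2 ]) M.v₁) M.v₀) (q₁ M.[ M.lift 2 (M.↑ 2) ]) (q₂ M.[ M.lift 4 (M.↑ 2) ]))) ‖ₜ
      ≡ recursiveCall ‖ r ‖ₜ ‖ q₁ ‖ₜ ‖ q₂ ‖ₜ
  recursiveCall-≡ r q₁ q₂
    rewrite term-ren r (↑ᴿ 2) | term-ren q₁ (liftᴿ-Renaming 2 (↑ᴿ 2)) | term-ren q₂ (liftᴿ-Renaming 4 (↑ᴿ 2)) = refl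

  ⟦ax₂⟧ : ∀ (V : M.Expr n) → Axioms Γ A I C → Shape small a → Shape small j →
    Γ ⊢ t ∈ Σ (T ‖ A ‖ₜ) (v₀ ε ‖ C ‖ₜ [ ids ▷ ‖ a ‖ₜ ▷ ‖ j ‖ₜ ] [ ↑ 1 ] ⊗ positiveₛ (↑ 1) ‖ A ‖ₜ ‖ I ‖ₜ ‖ C ‖ₜ ‖ V ‖ₜ v₀) →
    Γ ⊢ t ∈ ‖ M.Ex A (M.v₀ M.ε C M.[ M.ids M.▷ a M.▷ j ] M.[ M.↑ 1 ] M.∧ M.positiveₛ (M.↑ 1) A I C V M.v₀) ‖ᵀ
  ⟦ax₂⟧ {A = A} {I} {C} V S aˢ jˢ d =
    conv d (Σ-≐ (decoding (points S)) (cast-≐ refl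
      (cong₂ (λ e p → T (ap e v₀) ⊗ p)
        (sym (trans (term-ren (C M.[ _ ]) (↑ᴿ 1)) (cong (_[ ↑ 1 ]) (term-sub C (⇝ids ⇝▷ aˢ ⇝▷ jˢ)))))
        (sym (positive-≡ A I C V M.v₀ (↑ᴿ 1))))
      (type-refl (proj₂ (premises (wellFormed d))))))

  -- Besides the passage from translated types to decodings, the conjuncts of the last premise have
  -- to be exchanged by `swap`, whose typing needs both of them as families over the decoded set of
  -- points.
  ⟦ax₃⟧ : Axioms Γ A I C → Γ ⊢ ‖ V ‖ₜ ∈ Π ‖ A ‖ᵀ U₀ → Γ ▸ ‖ A ‖ᵀ ⊢ ‖ P ‖ᵀ type → Γ ⊢ ‖ a ‖ₜ ∈ ‖ A ‖ᵀ → Shape small a →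
    Γ ⊢ t ∈ ‖ P M.[ M.ids M.▷ a ] ‖ᵀ →
    ∀ {q₁ q₃} → Γ ▸ ‖ A ‖ᵀ ▸ ‖ P ‖ᵀ ⊢ q₁ ∈ ‖ M.v₁ M.ε V M.[ M.↑ 2 ] ‖ᵀ →
    Γ ▸ ‖ A ‖ᵀ ▸ ‖ I ‖ᵀ ▸ ‖ P M.[ M.↑ 2 M.▷ M.v₁ ] ‖ᵀ ⊢ q₃
      ∈ ‖ M.Ex (A M.[ M.↑ 3 ]) (P M.[ M.↑ 4 M.▷ M.v₀ ] M.∧ M.v₀ M.ε C M.[ M.↑ 2 ]) ‖ᵀ →
    Γ ⊢ ax₃ t q₁ (swap q₃) ∈ T (positiveᶜ ‖ A ‖ₜ ‖ I ‖ₜ ‖ C ‖ₜ ‖ V ‖ₜ ‖ a ‖ₜ)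
  ⟦ax₃⟧ {Γ = Γ} {A = A} {I} {C} {V} {P} {a} S hV hP ha aˢ ht {q₁} {q₃} h₁ h₃ =
    positive-ax₃ (axioms S) (subset-conv (points S) hV) (recast (points-conv S) hP) (element (points S) ha)
      (from P (⇝ids ⇝▷ aˢ) (inst ha hP) ht)
      (recast (⊢conv (points-conv S) (type-refl hP)) (cast (cong (λ e → T (ap e v₁)) (term-ren V (↑ᴿ 2))) h₁))
      (swap-∈ hP₄ hC₄ h₃')
    where
    Γ₃ = Γ ▸ T ‖ A ‖ₜ ▸ T ‖ I ‖ₜ ▸ ‖ P ‖ᵀ [ ↑ 2 ▷ v₁ ]
    g = context h₃
    P↑² : ‖ P M.[ M.↑ 2 M.▷ M.v₁ ] ‖ᵀ ≡ ‖ P ‖ᵀ [ ↑ 2 ▷ v₁ ]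
    P↑² = type-ren (shape P) (↑ᴿ 2 ▷ᴿ suc zero)
    A↑³ : Γ ▸ ‖ A ‖ᵀ ▸ ‖ I ‖ᵀ ▸ ‖ P M.[ M.↑ 2 M.▷ M.v₁ ] ‖ᵀ ⊢code A M.[ M.↑ 3 ]
    A↑³ = code-sub A (⇝↑ 3) (⊢⨟ (⊢⨟ (⊢↑ (tail (tail g))) (⊢↑ (tail g))) (⊢↑ g)) (points S)
    h₃' : Γ₃ ⊢ q₃ ∈ Σ (T (‖ A ‖ₜ [ ↑ 3 ])) (‖ P ‖ᵀ [ ↑ 4 ▷ v₀ ] ⊗ v₀ ε ‖ C ‖ₜ [ ↑ 2 ])
    h₃' = recast (⊢conv (indices-conv S) (cast-≐ refl P↑² (type-refl (last g))))
      (cast (cong₂ Σ (cong T (term-ren A (↑ᴿ 3))) (cong₂ (λ p e → p ⊗ v₀ ε e) (type-ren (shape P) (↑ᴿ 4 ▷ᴿ zero)) (term-ren C (↑ᴿ 2))))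
        (conv h₃ (Σ-≐ (type-sym (decoding A↑³)) (type-refl (proj₂ (premises (wellFormed h₃)))))))
    hΣ = premises (wellFormed h₃')
    g₄ : Γ₃ ▸ T (‖ A ‖ₜ [ ↑ 3 ]) ctx
    g₄ = context (proj₂ hΣ)
    hP₄ : Γ₃ ▸ T (‖ A ‖ₜ [ ↑ 3 ]) ⊢ ‖ P ‖ᵀ [ ↑ 4 ▷ v₀ ] type
    hP₄ = proj₁ (premises (proj₂ hΣ))
    -- Inversion of the product would give this family only weakened by the first factor, so it is
    -- formed afresh from the axiom set.
    hC₄ : Γ₃ ▸ T (‖ A ‖ₜ [ ↑ 3 ]) ⊢ v₀ ε ‖ C ‖ₜ [ ↑ 2 ] type
    hC₄ with axiomSet hs _ hc ← axioms S =
      ε-F {s = ‖ A ‖ₜ [ ↑ 2 ] [ ↑ 2 ]}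
        (sub (⊢↑² g₄ (tail g₄)) (sub (⊢↑² (tail (tail g₄)) (tail (tail (tail g₄)))) hs))
        (sub (⊢↑² g₄ (tail g₄)) hc)
        (cast (cong T (sub-square (λ _ → refl) ‖ A ‖ₜ)) (var-∈ g₄ zero))

  -- CT and AC.

  -- Being uniform in the primitive recursive term, the equation applies to `kleeneT` and `kleeneU`
  -- without unfolding them.
  ⌜⌝-≡ : ∀ {k} (p : Kleene.PR k) {ρ : Fin k → M.Expr n} {ρ' : Fin k → Term n} →
    (∀ x → ‖ ρ x ‖ₜ ≡ ρ' x) → ‖ M.⌜ p ⌝ ρ ‖ₜ ≡ ⌜ p ⌝ ρ'
  ⌜⌝-≡ (Kleene.# x)       h = h x
  ⌜⌝-≡ Kleene.zero        h = refl
  ⌜⌝-≡ (Kleene.suc p)     h = cong (λ t → su t) (⌜⌝-≡ p h)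
  ⌜⌝-≡ (Kleene.rec p b r) {ρ} {ρ'} h
    rewrite ⌜⌝-≡ p h | ⌜⌝-≡ b h
          | ⌜⌝-≡ r {(λ i → ρ i M.[ M.↑ 2 ]) M.▷ M.v₁ M.▷ M.v₀} {(λ i → ρ' i [ ↑ 2 ]) ▷ v₁ ▷ v₀}
              (λ { zero → refl ; (suc zero) → refl
                 ; (suc (suc x)) → trans (term-ren (ρ x) (↑ᴿ 2)) (cong (_[ ↑ 2 ]) (h x)) }) = refl
  ⌜⌝-≡ (Kleene.comp p ps) h = ⌜⌝-≡ p (λ x → ⌜⌝-≡ (ps x) h)

  CT-≡ : ‖ M.CT {n} ‖ᵀ ≡ CT
  CT-≡ = cong₂ (λ t u → Π (Π N N) (Σ N (Π N (Σ N (Id N t (su ze) ⊗ Id N (ap v₃ v₁) u)))))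
    (⌜⌝-≡ Kleene.kleeneT λ { zero → refl ; (suc zero) → refl ; (suc (suc zero)) → refl })
    (⌜⌝-≡ Kleene.kleeneU λ { zero → refl })

  -- The matrix is instantiated at the application `ap v₁ v₀`, which is not a variable, so the
  -- strict form and the translation of AC agree only up to `≐`.
  AC-≐ : ∀ A B R → Γ ▸ ‖ A ‖ᵀ ▸ ‖ B ‖ᵀ ⊢ ‖ R ‖ᵀ type →
    Γ ⊢ Σ (Π ‖ A ‖ᵀ ‖ B ‖ᵀ) (Π (‖ A ‖ᵀ [ ↑ 1 ]) (‖ R ‖ᵀ [ ↑ 2 ▷ v₀ ▷ ap v₁ v₀ ]))
      ≐ ‖ M.Ex (M.Π A B) (M.All (A M.[ M.↑ 1 ]) (R M.[ M.↑ 2 M.▷ M.v₀ M.▷ M.ap M.v₁ M.v₀ ])) ‖ᵀ type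
  AC-≐ A B R hR with ▸-ctx (▸-ctx g hA) hB ← context hR =
    Σ-≐ (type-refl (Π-F hA hB)) (Π-≐ (cast-≐ refl (sym (wkᵀ 1 A)) (type-refl (wk (Π-F hA hB) hA)))
      (type-sub (shape R) (⇝↑ 2 ⇝▷ varˢ _ ⇝▷ other) (choice-matrix hR)))

  ⟦AC⟧ : ∀ A B R → Γ ▸ ‖ A ‖ᵀ ▸ ‖ B ‖ᵀ ⊢ ‖ R ‖ᵀ type → Γ ⊢ choiceTerm ∈ ‖ M.AC A B R ‖ᵀ
  ⟦AC⟧ A B R hR with ▸-ctx (▸-ctx g hA) hB ← context hR =
    conv (choiceTerm-∈ hR) (Π-≐ (type-refl hΠ) (sub (⊢↑ (▸-ctx g hΠ)) (AC-≐ A B R hR)))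
    where hΠ = Π-F hA (Σ-F hB hR)

  cast-∈≐ : X ≡ Y → Γ ⊢ t ≐ u ∈ X → Γ ⊢ t ≐ u ∈ Y
  cast-∈≐ refl d = d

  ≐-last : (b : Term (1 + n)) {t' u : Term m} → t ≡ t' → Γ ⊢ u ≐ b [ τ ▷ t ] ∈ X → Γ ⊢ u ≐ b [ τ ▷ t' ] ∈ X
  ≐-last b refl d = d

  from-inst : (A : M.Expr (1 + n)) → Γ ▸ X ⊢ ‖ A ‖ᵀ type → Shape small a → Γ ⊢ ‖ a ‖ₜ ∈ X →
    Γ ⊢ t ∈ ‖ A M.[ M.ids M.▷ a ] ‖ᵀ → Γ ⊢ t ∈ ‖ A ‖ᵀ [ ids ▷ ‖ a ‖ₜ ]
  from-inst A hA s ha d = from A (⇝ids ⇝▷ s) (inst ha hA) d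

  -- Contexts and their substitutions.

  lookup-≡ : (Γ : M.Context n) (x : Fin n) → ‖ Γ M.‼ x ‖ᵀ ≡ ‖ Γ ‖ᶜ ‼ x
  lookup-≡ (Γ M.▸ A) zero    = wkᵀ 1 A
  lookup-≡ (Γ M.▸ A) (suc x) = trans (wkᵀ 1 (Γ M.‼ x)) (cong (_[ ↑ 1 ]) (lookup-≡ Γ x))

  -- The types of the components of σ depend on σ itself, hence the induction on Γ.
  ⟦substitution⟧ : (Γ : M.Context n) → ‖ Γ ‖ᶜ ctx → Δ ctx → (∀ x → Δ ⊢ ‖ σ x ‖ₜ ∈ ‖ (Γ M.‼ x) M.[ σ ] ‖ᵀ) →
    (∀ x → Shape small (σ x)) → Δ ⊢ˢ (λ x → ‖ σ x ‖ₜ) ∶ ‖ Γ ‖ᶜ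
  ⟦substitution⟧ M.∙ _ g h s = typedSub g λ ()
  ⟦substitution⟧ {σ = σ} (Γ M.▸ A) (▸-ctx gΓ hA) g h s =
    ⊢cong (λ { zero → refl ; (suc x) → refl })
      (⊢▷ hσ (from A (⇝‖‖ (s ∘ suc)) (sub hσ hA) (cast (cong ‖_‖ᵀ (MS.sub-sub (λ _ → refl) A)) (h zero))))
    where
    hσ = ⟦substitution⟧ Γ gΓ g (λ x → cast (cong ‖_‖ᵀ (MS.sub-sub (λ _ → refl) (Γ M.‼ x))) (h (suc x))) (s ∘ suc)

  component-≐ : (Γ : M.Context n) → ‖ Γ ‖ᶜ ctx → (∀ x → Shape small (σ x)) → Δ ⊢ˢ (λ x → ‖ σ x ‖ₜ) ∶ ‖ Γ ‖ᶜ →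
    ∀ x → Δ ⊢ t ≐ u ∈ ‖ (Γ M.‼ x) M.[ σ ] ‖ᵀ → Δ ⊢ t ≐ u ∈ (‖ Γ ‖ᶜ ‼ x) [ (λ x → ‖ σ x ‖ₜ) ]
  component-≐ Γ g s h x e =
    cast-∈≐ (cong (_[ _ ]) (lookup-≡ Γ x))
      (conv-≐ e (type-sym (type-sub (shape (Γ M.‼ x)) (⇝‖‖ s) (cast-type (cong (_[ _ ]) (sym (lookup-≡ Γ x))) (sub h (lookup-type g x))))))

  -- Semantic judgements.

  size : M.Kind → Size
  size (M.ty z) = z
  size (M.pr z) = z

  -- With the code and the shape recorded for small types, the meanings of `φ is propₛ` and of
  -- `φ ∈ Propₛ` coincide definitionally, which is what the universe à la Russell demands.
  IsType : Size → Context n → M.Expr n → Set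
  IsType small Γ A = Γ ⊢code A
  IsType large Γ A = Γ ⊢ ‖ A ‖ᵀ type

  isType : ∀ z → IsType z Γ A → Γ ⊢ ‖ A ‖ᵀ type
  isType small c = code-type c
  isType large d = d

  -- A strengthening of `‖_‖ᴶ` that survives the induction. Equality of small types stays equality
  -- of the translated types: equality of codes such as `Σᶜ a b` in the bound argument would be a
  -- ξ-rule for `U₀`.
  Sem : Context n → M.Judgement n → Set
  Sem Γ (A M.is k)     = IsType (size k) Γ A
  Sem Γ (A M.≐ B is k) = Γ ⊢ ‖ A ‖ᵀ ≐ ‖ B ‖ᵀ type
  Sem Γ (a M.∈ A)      = Γ ⊢ ‖ a ‖ₜ ∈ ‖ A ‖ᵀ × Shape small a
  Sem Γ (a M.≐ b ∈ A)  = Γ ⊢ ‖ a ‖ₜ ≐ ‖ b ‖ₜ ∈ ‖ A ‖ᵀ × Shape small a × Shape small b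

  sem-⊢ : (J : M.Judgement n) → Sem Γ J → Γ ⊢ ‖ J ‖ᴶ
  sem-⊢ (A M.is k)     h = isType (size k) h
  sem-⊢ (A M.≐ B is k) h = h
  sem-⊢ (a M.∈ A)      h = proj₁ h
  sem-⊢ (a M.≐ b ∈ A)  h = proj₁ h

  -- Judgements are first substituted strictly in MLtt_cind; `type-sub` then links each strict
  -- instance of a type to its translated instance, at both ends in the case of a type equality.
  Sem-sub : (J : M.Judgement n) → σ ⇝ τ → Δ ⊢ˢ τ ∶ Γ → Sem Γ J → Sem Δ (J M.[ σ ]ᴶ)
  Sem-sub (A M.is k) h hτ d with size k
  ... | small = code-sub A h hτ d
  ... | large = proj₂ (wellFormed (type-sub (shape A) h (sub hτ d)))
  Sem-sub (A M.≐ B is k) h hτ d with hA , hB ← wellFormed d =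
    type-trans (type-sym (type-sub (shape A) h (sub hτ hA))) (type-trans (sub hτ d) (type-sub (shape B) h (sub hτ hB)))
  Sem-sub {Δ = Δ} (a M.∈ A) h hτ (d , s) =
    to A h (≡.subst (λ t → Δ ⊢ t ∈ _) (sym (term-sub a h)) (sub hτ d)) , Shape-sub (shapes h) s
  Sem-sub {Δ = Δ} (a M.≐ b ∈ A) h hτ (d , s , s') =
    to-≐ A h (≡.subst₂ (λ t u → Δ ⊢ t ≐ u ∈ _) (sym (term-sub a h)) (sym (term-sub b h)) (sub hτ d)) ,
    Shape-sub (shapes h) s , Shape-sub (shapes h) s'

  Σ-IsType : ∀ z {B} → IsType z Γ A → IsType z (Γ ▸ ‖ A ‖ᵀ) B → IsType z Γ (M.Σ A B)
  Σ-IsType small a b = Σᶜ-I (proj₁ a) (over-code a (proj₁ b)) , Σˢ (proj₂ a) (proj₂ b)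
  Σ-IsType large a b = Σ-F a b

  Ex-IsType : ∀ z {B} → IsType z Γ A → IsType z (Γ ▸ ‖ A ‖ᵀ) B → IsType z Γ (M.Ex A B)
  Ex-IsType small a b = Σᶜ-I (proj₁ a) (over-code a (proj₁ b)) , Exˢ (proj₂ a) (proj₂ b)
  Ex-IsType large a b = Σ-F a b

  All-IsType : ∀ z {B} → IsType z Γ A → IsType z (Γ ▸ ‖ A ‖ᵀ) B → IsType z Γ (M.All A B)
  All-IsType small a b = Πᶜ-I (proj₁ a) (over-code a (proj₁ b)) , Allˢ (proj₂ a) (proj₂ b)
  All-IsType large a b = Π-F a b

  ∧-IsType : ∀ z → IsType z Γ A → IsType z Γ B → IsType z Γ (A M.∧ B)
  ∧-IsType small a b = Σᶜ-I (proj₁ a) (wk (T-F (proj₁ a)) (proj₁ b)) , ∧ˢ (proj₂ a) (proj₂ b)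
  ∧-IsType large a b = ⊗-F a b

  ⇒-IsType : ∀ z → IsType z Γ A → IsType z Γ B → IsType z Γ (A M.⇒ B)
  ⇒-IsType small a b = Πᶜ-I (proj₁ a) (wk (T-F (proj₁ a)) (proj₁ b)) , ⇒ˢ (proj₂ a) (proj₂ b)
  ⇒-IsType large a b = ⇒-F a b

  ∨-IsType : ∀ z → IsType z Γ A → IsType z Γ B → IsType z Γ (A M.∨ B)
  ∨-IsType small a b = ⊕ᶜ-I (proj₁ a) (proj₁ b) , ∨ˢ (proj₂ a) (proj₂ b)
  ∨-IsType large a b = ⊕-F a b

  Id-IsType : ∀ z → IsType z Γ A → Γ ⊢ ‖ a ‖ₜ ∈ ‖ A ‖ᵀ → Γ ⊢ ‖ b ‖ₜ ∈ ‖ A ‖ᵀ → IsType z Γ (M.Id A a b)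
  Id-IsType small c a b = Idᶜ-I (proj₁ c) (element c a) (element c b) , Idˢ (proj₂ c)
  Id-IsType large d a b = Id-F d a b

  ∧-branch : ∀ (ψ A : M.Expr n) → Γ ▸ X ▸ ‖ ψ M.[ M.↑ 1 ] ‖ᵀ ⊢ t ∈ ‖ A M.[ M.↑ 2 ] ‖ᵀ → Γ ▸ X ▸ ‖ ψ ‖ᵀ [ ↑ 1 ] ⊢ t ∈ ‖ A ‖ᵀ [ ↑ 2 ]
  ∧-branch ψ A d = cast (wkᵀ 2 A) (▸-≡ (wkᵀ 1 ψ) d)

  wk-domain : ∀ (A : M.Expr n) → Γ ▸ ‖ A ‖ᵀ ▸ ‖ A M.[ M.↑ 1 ] ‖ᵀ ⊢ 𝒥 → Γ ▸ ‖ A ‖ᵀ ▸ ‖ A ‖ᵀ [ ↑ 1 ] ⊢ 𝒥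
  wk-domain A = ▸-≡ (wkᵀ 1 A)

  diagonal : ∀ (Q : M.Expr (2 + n)) {t : Term (1 + n)} → Γ ⊢ t ∈ ‖ Q M.[ M.↑ 1 M.▷ M.v₀ M.▷ M.v₀ ] ‖ᵀ → Γ ⊢ t ∈ ‖ Q ‖ᵀ [ ↑ 1 ▷ v₀ ▷ v₀ ]
  diagonal Q = cast (type-ren (shape Q) (↑ᴿ 1 ▷ᴿ zero ▷ᴿ zero))

  -- Interpretation of derivations.

  ⟦_⟧ᶜ : {Γ : M.Context n} → Γ M.ctx → ‖ Γ ‖ᶜ ctx
  ⟦_⟧  : {Γ : M.Context n} {J : M.Judgement n} → Γ M.⊢ J → Sem ‖ Γ ‖ᶜ J
  ⟦_⟧ᴬ : {Γ : M.Context n} {A : M.Expr n} {I : M.Expr (1 + n)} {C : M.Expr (2 + n)} → M.AxiomSet Γ A I C → Axioms ‖ Γ ‖ᶜ A I C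

  type⟦_⟧ : {Γ : M.Context n} {A : M.Expr n} → Γ M.⊢ A M.is k → ‖ Γ ‖ᶜ ⊢ ‖ A ‖ᵀ type
  type⟦_⟧ {k = k} d = isType (size k) ⟦ d ⟧

  term⟦_⟧ : {Γ : M.Context n} {a A : M.Expr n} → Γ M.⊢ a M.∈ A → ‖ Γ ‖ᶜ ⊢ ‖ a ‖ₜ ∈ ‖ A ‖ᵀ
  term⟦ d ⟧ = proj₁ ⟦ d ⟧

  shape⟦_⟧ : {Γ : M.Context n} {a A : M.Expr n} → Γ M.⊢ a M.∈ A → Shape small a
  shape⟦ d ⟧ = proj₂ ⟦ d ⟧

  ⟦ M.∙-ctx ⟧ᶜ     = ∙-ctx
  ⟦ M.▸-ctx g d ⟧ᶜ = ▸-ctx ⟦ g ⟧ᶜ ⟦ d ⟧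

  ⟦ M.axiomSet a i c ⟧ᴬ = record { points = ⟦ a ⟧ ; indices = ⟦ i ⟧ ; covered = term⟦ c ⟧ }

  ⟦ M.pr⊆ty d ⟧     = ⟦ d ⟧
  ⟦ M.set⊆col d ⟧   = type⟦ d ⟧
  ⟦ M.prₛ⊆pr d ⟧    = type⟦ d ⟧
  ⟦ M.pr⊆ty-≐ d ⟧   = ⟦ d ⟧
  ⟦ M.set⊆col-≐ d ⟧ = ⟦ d ⟧
  ⟦ M.prₛ⊆pr-≐ d ⟧  = ⟦ d ⟧
  ⟦ M.is-refl d ⟧    = type-refl type⟦ d ⟧
  ⟦ M.is-sym d ⟧     = type-sym ⟦ d ⟧
  ⟦ M.is-trans d e ⟧ = type-trans ⟦ d ⟧ ⟦ e ⟧
  ⟦ M.∈-refl d ⟧     = ∈-refl term⟦ d ⟧ , shape⟦ d ⟧ , shape⟦ d ⟧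
  ⟦ M.∈-sym d ⟧ with e , s , s' ← ⟦ d ⟧ = ∈-sym e , s' , s
  ⟦ M.∈-trans d d' ⟧ with e , s , _ ← ⟦ d ⟧ | e' , _ , s' ← ⟦ d' ⟧ = ∈-trans e e' , s , s'
  ⟦ M.conv d e ⟧     = conv term⟦ d ⟧ ⟦ e ⟧ , shape⟦ d ⟧
  ⟦ M.conv-≐ d e ⟧   = conv-≐ (proj₁ ⟦ d ⟧) ⟦ e ⟧ , proj₂ ⟦ d ⟧
  ⟦ M.var-∈ {Γ = Γ} g x ⟧ = cast (sym (lookup-≡ Γ x)) (var-∈ ⟦ g ⟧ᶜ x) , varˢ x
  ⟦ M.subst {Γ = Γ} {J = 𝒥} σ d g h ⟧ =
    -- Validity of the source context is read off the interpreted premise by `context`.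
    Sem-sub 𝒥 (⇝‖‖ s) (⟦substitution⟧ Γ (context (sem-⊢ 𝒥 ⟦ d ⟧)) ⟦ g ⟧ᶜ (λ x → term⟦ h x ⟧) s) ⟦ d ⟧
    where s = λ x → shape⟦ h x ⟧
  ⟦ M.repl-is {Γ = Γ} {A = A} σ τ d g hσ hτ h ⟧ =
    type-trans (type-sym (type-sub (shape A) (⇝‖‖ sσ) (sub ⊢σ type⟦ d ⟧)))
      (type-trans (repl-type _ _ type⟦ d ⟧ ⟦ g ⟧ᶜ (terms ⊢σ) (terms ⊢τ) (λ x → component-≐ Γ gΓ sσ ⊢σ x (proj₁ ⟦ h x ⟧)))
        (type-sub (shape A) (⇝‖‖ sτ) (sub ⊢τ type⟦ d ⟧)))
    where
    gΓ = context type⟦ d ⟧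
    sσ = λ x → shape⟦ hσ x ⟧
    sτ = λ x → shape⟦ hτ x ⟧
    ⊢σ = ⟦substitution⟧ Γ gΓ ⟦ g ⟧ᶜ (λ x → term⟦ hσ x ⟧) sσ
    ⊢τ = ⟦substitution⟧ Γ gΓ ⟦ g ⟧ᶜ (λ x → term⟦ hτ x ⟧) sτ
  ⟦ M.repl-∈ {Γ = Γ} {a = a} {A = A} σ τ d g hσ hτ h ⟧ =
      to-≐ A (⇝‖‖ sσ) (≡.subst₂ (λ t u → _ ⊢ t ≐ u ∈ _) (sym (term-sub a (⇝‖‖ sσ))) (sym (term-sub a (⇝‖‖ sτ)))
        (repl-∈ _ _ term⟦ d ⟧ ⟦ g ⟧ᶜ (terms ⊢σ) (terms ⊢τ) (λ x → component-≐ Γ gΓ sσ ⊢σ x (proj₁ ⟦ h x ⟧))))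
    , Shape-sub sσ shape⟦ d ⟧ , Shape-sub sτ shape⟦ d ⟧
    where
    gΓ = context term⟦ d ⟧
    sσ = λ x → shape⟦ hσ x ⟧
    sτ = λ x → shape⟦ hτ x ⟧
    ⊢σ = ⟦substitution⟧ Γ gΓ ⟦ g ⟧ᶜ (λ x → term⟦ hσ x ⟧) sσ
    ⊢τ = ⟦substitution⟧ Γ gΓ ⟦ g ⟧ᶜ (λ x → term⟦ hτ x ⟧) sτ

  ⟦ M.N₀-F g ⟧ = N₀ᶜ-I ⟦ g ⟧ᶜ , N₀ˢ
  ⟦ M.N₀-E {M = M} m t ⟧ = to M (⇝ids ⇝▷ shape⟦ t ⟧) (N₀-E ⟦ m ⟧ term⟦ t ⟧) , other

  ⟦ M.N₁-F g ⟧ = N₁ᶜ-I ⟦ g ⟧ᶜ , N₁ˢ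
  ⟦ M.N₁-I g ⟧ = N₁-I ⟦ g ⟧ᶜ , other
  ⟦ M.N₁-E {M = M} m t a ⟧ =
    to M (⇝ids ⇝▷ shape⟦ t ⟧)
      (N₁-E ⟦ m ⟧ term⟦ t ⟧ (from-inst M ⟦ m ⟧ other (N₁-I (context term⟦ t ⟧)) term⟦ a ⟧)) , other
  ⟦ M.N₁-β {M = M} m a ⟧ =
    to-≐ M (⇝ids ⇝▷ other) (N₁-β ⟦ m ⟧ (from-inst M ⟦ m ⟧ other (N₁-I (context term⟦ a ⟧)) term⟦ a ⟧)) ,
    other , shape⟦ a ⟧

  ⟦ M.N-F g ⟧  = Nᶜ-I ⟦ g ⟧ᶜ , Nˢ
  ⟦ M.N-I₀ g ⟧ = N-I₀ ⟦ g ⟧ᶜ , other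
  ⟦ M.N-Iₛ t ⟧ = N-Iₛ term⟦ t ⟧ , other
  ⟦ M.N-E {M = M} m t a c ⟧ =
    to M (⇝ids ⇝▷ shape⟦ t ⟧)
      (N-E ⟦ m ⟧ term⟦ t ⟧ (from-inst M ⟦ m ⟧ other (N-I₀ (context term⟦ t ⟧)) term⟦ a ⟧) (N-step {M = M} ⟦ m ⟧ term⟦ c ⟧)) , other
  ⟦ M.N-β₀ {M = M} m a c ⟧ =
    to-≐ M (⇝ids ⇝▷ other)
      (N-β₀ ⟦ m ⟧ (from-inst M ⟦ m ⟧ other (N-I₀ (context term⟦ a ⟧)) term⟦ a ⟧) (N-step {M = M} ⟦ m ⟧ term⟦ c ⟧)) ,
    other , shape⟦ a ⟧
  ⟦ M.N-βₛ {M = M} {c₃ = c₃} m t a c ⟧ =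
    to-≐ M (⇝ids ⇝▷ other) (≐-reduct c₃ (⇝ids ⇝▷ shape⟦ t ⟧ ⇝▷ other)
      (N-βₛ ⟦ m ⟧ term⟦ t ⟧ (from-inst M ⟦ m ⟧ other (N-I₀ (context term⟦ t ⟧)) term⟦ a ⟧) (N-step {M = M} ⟦ m ⟧ term⟦ c ⟧))) ,
    other , Shape-sub (shapes (⇝ids ⇝▷ shape⟦ t ⟧ ⇝▷ other)) shape⟦ c ⟧

  ⟦ M.List-F A ⟧  = Listᶜ-I (proj₁ ⟦ A ⟧) , Listˢ (proj₂ ⟦ A ⟧)
  ⟦ M.List-≐ e ⟧  = List-≐ ⟦ e ⟧
  ⟦ M.List-I₀ A ⟧ = List-I₀ type⟦ A ⟧ , other
  ⟦ M.List-Iₛ A a s ⟧ = List-Iₛ type⟦ A ⟧ term⟦ a ⟧ term⟦ s ⟧ , other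
  ⟦ M.List-E {A = A} {M = M} hA m t a l ⟧ =
    to M (⇝ids ⇝▷ shape⟦ t ⟧)
      (List-E type⟦ hA ⟧ ⟦ m ⟧ term⟦ t ⟧ (from-inst M ⟦ m ⟧ other (List-I₀ type⟦ hA ⟧) term⟦ a ⟧)
        (List-step {A = A} {M = M} type⟦ hA ⟧ ⟦ m ⟧ term⟦ l ⟧)) , other
  ⟦ M.List-β₀ {A = A} {M = M} hA m a l ⟧ =
    to-≐ M (⇝ids ⇝▷ other)
      (List-β₀ type⟦ hA ⟧ ⟦ m ⟧ (from-inst M ⟦ m ⟧ other (List-I₀ type⟦ hA ⟧) term⟦ a ⟧)
        (List-step {A = A} {M = M} type⟦ hA ⟧ ⟦ m ⟧ term⟦ l ⟧)) ,
    other , shape⟦ a ⟧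
  ⟦ M.List-βₛ {A = A} {M = M} {l = l} hA m b s a hl ⟧ =
    to-≐ M (⇝ids ⇝▷ other) (≐-reduct l (⇝ids ⇝▷ shape⟦ b ⟧ ⇝▷ shape⟦ s ⟧ ⇝▷ other)
      (List-βₛ type⟦ hA ⟧ ⟦ m ⟧ term⟦ b ⟧ term⟦ s ⟧ (from-inst M ⟦ m ⟧ other (List-I₀ type⟦ hA ⟧) term⟦ a ⟧)
        (List-step {A = A} {M = M} type⟦ hA ⟧ ⟦ m ⟧ term⟦ hl ⟧))) ,
    other , Shape-sub (shapes (⇝ids ⇝▷ shape⟦ b ⟧ ⇝▷ shape⟦ s ⟧ ⇝▷ other)) shape⟦ hl ⟧

  ⟦ M.⊕-F A B ⟧ = ⊕ᶜ-I (proj₁ ⟦ A ⟧) (proj₁ ⟦ B ⟧) , ⊕ˢ (proj₂ ⟦ A ⟧) (proj₂ ⟦ B ⟧)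
  ⟦ M.⊕-≐ d e ⟧ = ⊕-≐ ⟦ d ⟧ ⟦ e ⟧
  ⟦ M.⊕-I₁ A B a ⟧ = ⊕-I₁ type⟦ A ⟧ type⟦ B ⟧ term⟦ a ⟧ , other
  ⟦ M.⊕-I₂ A B b ⟧ = ⊕-I₂ type⟦ A ⟧ type⟦ B ⟧ term⟦ b ⟧ , other
  ⟦ M.⊕-E {M = M} A B m d c₁ c₂ ⟧ =
    to M (⇝ids ⇝▷ shape⟦ d ⟧)
      (⊕-E type⟦ A ⟧ type⟦ B ⟧ ⟦ m ⟧ term⟦ d ⟧ (inl-step {M = M} ⟦ m ⟧ type⟦ A ⟧ type⟦ B ⟧ term⟦ c₁ ⟧)
        (inr-step {M = M} ⟦ m ⟧ type⟦ A ⟧ type⟦ B ⟧ term⟦ c₂ ⟧)) , other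
  ⟦ M.⊕-β₁ {M = M} {c₁ = c} A B m a c₁ c₂ ⟧ =
    to-≐ M (⇝ids ⇝▷ other) (≐-reduct c (⇝ids ⇝▷ shape⟦ a ⟧)
      (⊕-β₁ type⟦ A ⟧ type⟦ B ⟧ ⟦ m ⟧ term⟦ a ⟧ (inl-step {M = M} ⟦ m ⟧ type⟦ A ⟧ type⟦ B ⟧ term⟦ c₁ ⟧)
        (inr-step {M = M} ⟦ m ⟧ type⟦ A ⟧ type⟦ B ⟧ term⟦ c₂ ⟧))) ,
    other , Shape-sub (shapes (⇝ids ⇝▷ shape⟦ a ⟧)) shape⟦ c₁ ⟧
  ⟦ M.⊕-β₂ {M = M} {c₂ = c} A B m b c₁ c₂ ⟧ =
    to-≐ M (⇝ids ⇝▷ other) (≐-reduct c (⇝ids ⇝▷ shape⟦ b ⟧)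
      (⊕-β₂ type⟦ A ⟧ type⟦ B ⟧ ⟦ m ⟧ term⟦ b ⟧ (inl-step {M = M} ⟦ m ⟧ type⟦ A ⟧ type⟦ B ⟧ term⟦ c₁ ⟧)
        (inr-step {M = M} ⟦ m ⟧ type⟦ A ⟧ type⟦ B ⟧ term⟦ c₂ ⟧))) ,
    other , Shape-sub (shapes (⇝ids ⇝▷ shape⟦ b ⟧)) shape⟦ c₂ ⟧

  ⟦ M.Σ-F {z = z} A B ⟧ = Σ-IsType z ⟦ A ⟧ ⟦ B ⟧
  ⟦ M.Σ-≐ d e ⟧ = Σ-≐ ⟦ d ⟧ ⟦ e ⟧
  ⟦ M.Σ-I {B = B} A hB a b ⟧ =
    Σ-I ⟦ A ⟧ ⟦ hB ⟧ term⟦ a ⟧ (from-inst B ⟦ hB ⟧ shape⟦ a ⟧ term⟦ a ⟧ term⟦ b ⟧) , other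
  ⟦ M.Σ-E {M = M} A B m d c ⟧ =
    to M (⇝ids ⇝▷ shape⟦ d ⟧) (Σ-E ⟦ A ⟧ ⟦ B ⟧ ⟦ m ⟧ term⟦ d ⟧ (pair-step {M = M} ⟦ m ⟧ ⟦ B ⟧ term⟦ c ⟧)) , other
  ⟦ M.Σ-β {B = B} {M = M} {c₃ = c₃} A hB m a b c ⟧ =
    to-≐ M (⇝ids ⇝▷ other) (≐-reduct c₃ (⇝ids ⇝▷ shape⟦ a ⟧ ⇝▷ shape⟦ b ⟧)
      (Σ-β ⟦ A ⟧ ⟦ hB ⟧ ⟦ m ⟧ term⟦ a ⟧ (from-inst B ⟦ hB ⟧ shape⟦ a ⟧ term⟦ a ⟧ term⟦ b ⟧) (pair-step {M = M} ⟦ m ⟧ ⟦ hB ⟧ term⟦ c ⟧))) ,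
    other , Shape-sub (shapes (⇝ids ⇝▷ shape⟦ a ⟧ ⇝▷ shape⟦ b ⟧)) shape⟦ c ⟧

  ⟦ M.Π-F A B ⟧ = Πᶜ-I (proj₁ ⟦ A ⟧) (over-code ⟦ A ⟧ (proj₁ ⟦ B ⟧)) , Πˢ (proj₂ ⟦ A ⟧) (proj₂ ⟦ B ⟧)
  ⟦ M.Π-F-prop A ⟧ = Π-F type⟦ A ⟧ (U₀-F (▸-ctx (context type⟦ A ⟧) type⟦ A ⟧))
  ⟦ M.Π-≐ d e ⟧ = Π-≐ ⟦ d ⟧ ⟦ e ⟧
  ⟦ M.Π-≐-prop d ⟧ = Π-≐ ⟦ d ⟧ (type-refl (U₀-F (▸-ctx (context ⟦ d ⟧) (proj₁ (wellFormed ⟦ d ⟧)))))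
  ⟦ M.Π-I A B _ b ⟧ = Π-I ⟦ A ⟧ ⟦ B ⟧ term⟦ b ⟧ , other
  ⟦ M.Π-E {B = B} A hB _ f a ⟧ = to B (⇝ids ⇝▷ shape⟦ a ⟧) (Π-E ⟦ A ⟧ ⟦ hB ⟧ term⟦ f ⟧ term⟦ a ⟧) , other
  ⟦ M.Π-β {B = B} {b₁ = b₁} A hB _ b a ⟧ =
    to-≐ B (⇝ids ⇝▷ shape⟦ a ⟧) (≐-reduct b₁ (⇝ids ⇝▷ shape⟦ a ⟧) (Π-β ⟦ A ⟧ ⟦ hB ⟧ term⟦ b ⟧ term⟦ a ⟧)) ,
    other , Shape-sub (shapes (⇝ids ⇝▷ shape⟦ a ⟧)) shape⟦ b ⟧

  ⟦ M.Prop-F g ⟧ = U₀-F ⟦ g ⟧ᶜ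
  ⟦ M.Prop-I d ⟧ = ⟦ d ⟧
  ⟦ M.Prop-E d ⟧ = ⟦ d ⟧
  -- An equality of elements of prop_s gives equal decodings by `T-≐`; decoding both ends turns it
  -- into an equality of the translated propositions.
  ⟦ M.Prop-E-≐ d ⟧ with e , s , s' ← ⟦ d ⟧ | a , b , _ ← wellFormed (proj₁ ⟦ d ⟧) =
    type-trans (type-sym (decode s a)) (type-trans (T-≐ e) (decode s' b))

  ⟦ M.⊥-F g ⟧ = N₀ᶜ-I ⟦ g ⟧ᶜ , ⊥ˢ
  ⟦ M.⊥-E {φ = φ} p t ⟧ =
    cast (wk-inst ‖ φ ‖ᵀ) (N₀-E (wk (N₀-F (context ⟦ p ⟧)) ⟦ p ⟧) term⟦ t ⟧) , other

  ⟦ M.∧-F {z = z} p q ⟧ = ∧-IsType z ⟦ p ⟧ ⟦ q ⟧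
  ⟦ M.∧-≐ d e ⟧ = Σ-≐ ⟦ d ⟧ (sub (⊢↑ (▸-ctx (context ⟦ d ⟧) (proj₁ (wellFormed ⟦ d ⟧)))) ⟦ e ⟧)
  ⟦ M.∧-I p q a b ⟧ = ⊗-I term⟦ a ⟧ term⟦ b ⟧ , other
  ⟦ M.∧-E {ψ = ψ} {A = A} p q r d c ⟧ = Σ-rec ⟦ r ⟧ term⟦ d ⟧ (∧-branch ψ A term⟦ c ⟧) , other
  ⟦ M.∧-β {ψ = ψ} {A = A} {c₃ = c₃} p q r a b c ⟧ =
    ≐-reduct c₃ (⇝ids ⇝▷ shape⟦ a ⟧ ⇝▷ shape⟦ b ⟧)
      (Σ-rec-β ⟦ r ⟧ (⊗-F ⟦ p ⟧ ⟦ q ⟧) term⟦ a ⟧ (cast (sym (wk-inst ‖ ψ ‖ᵀ)) term⟦ b ⟧) (∧-branch ψ A term⟦ c ⟧)) ,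
    other , Shape-sub (shapes (⇝ids ⇝▷ shape⟦ a ⟧ ⇝▷ shape⟦ b ⟧)) shape⟦ c ⟧

  ⟦ M.∨-F {z = z} p q ⟧ = ∨-IsType z ⟦ p ⟧ ⟦ q ⟧
  ⟦ M.∨-≐ d e ⟧ = ⊕-≐ ⟦ d ⟧ ⟦ e ⟧
  ⟦ M.∨-I₁ p q a ⟧ = ⊕-I₁ ⟦ p ⟧ ⟦ q ⟧ term⟦ a ⟧ , other
  ⟦ M.∨-I₂ p q b ⟧ = ⊕-I₂ ⟦ p ⟧ ⟦ q ⟧ term⟦ b ⟧ , other
  ⟦ M.∨-E {A = A} p q r d c₁ c₂ ⟧ =
    ⊕-rec ⟦ r ⟧ term⟦ d ⟧ (cast (wkᵀ 1 A) term⟦ c₁ ⟧) (cast (wkᵀ 1 A) term⟦ c₂ ⟧) , other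
  ⟦ M.∨-β₁ {A = A} {c₁ = c} p q r a c₁ c₂ ⟧ =
    ≐-reduct c (⇝ids ⇝▷ shape⟦ a ⟧) (⊕-rec-β₁ ⟦ r ⟧ ⟦ q ⟧ term⟦ a ⟧ (cast (wkᵀ 1 A) term⟦ c₁ ⟧) (cast (wkᵀ 1 A) term⟦ c₂ ⟧)) ,
    other , Shape-sub (shapes (⇝ids ⇝▷ shape⟦ a ⟧)) shape⟦ c₁ ⟧
  ⟦ M.∨-β₂ {A = A} {c₂ = c} p q r b c₁ c₂ ⟧ =
    ≐-reduct c (⇝ids ⇝▷ shape⟦ b ⟧) (⊕-rec-β₂ ⟦ r ⟧ ⟦ p ⟧ term⟦ b ⟧ (cast (wkᵀ 1 A) term⟦ c₁ ⟧) (cast (wkᵀ 1 A) term⟦ c₂ ⟧)) ,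
    other , Shape-sub (shapes (⇝ids ⇝▷ shape⟦ b ⟧)) shape⟦ c₂ ⟧

  ⟦ M.⇒-F {z = z} p q ⟧ = ⇒-IsType z ⟦ p ⟧ ⟦ q ⟧
  ⟦ M.⇒-≐ d e ⟧ = Π-≐ ⟦ d ⟧ (sub (⊢↑ (▸-ctx (context ⟦ d ⟧) (proj₁ (wellFormed ⟦ d ⟧)))) ⟦ e ⟧)
  ⟦ M.⇒-I {ψ = ψ} p q b ⟧ = Π-I' (cast (wkᵀ 1 ψ) term⟦ b ⟧) , other
  ⟦ M.⇒-E {ψ = ψ} p q f a ⟧ = cast (wk-inst ‖ ψ ‖ᵀ) (Π-E' term⟦ f ⟧ term⟦ a ⟧) , other
  ⟦ M.⇒-β {ψ = ψ} {b₁ = b₁} p q b a ⟧ =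
    ≐-reduct b₁ (⇝ids ⇝▷ shape⟦ a ⟧)
      (cast-∈≐ (wk-inst ‖ ψ ‖ᵀ) (Π-β ⟦ p ⟧ (wk ⟦ p ⟧ ⟦ q ⟧) (cast (wkᵀ 1 ψ) term⟦ b ⟧) term⟦ a ⟧)) ,
    other , Shape-sub (shapes (⇝ids ⇝▷ shape⟦ a ⟧)) shape⟦ b ⟧

  ⟦ M.All-F {z = z} A p ⟧ = All-IsType z ⟦ A ⟧ ⟦ p ⟧
  ⟦ M.All-≐ d e ⟧ = Π-≐ ⟦ d ⟧ ⟦ e ⟧
  ⟦ M.All-I A p b ⟧ = Π-I ⟦ A ⟧ ⟦ p ⟧ term⟦ b ⟧ , other
  ⟦ M.All-E {χ = χ} A p f a ⟧ = to χ (⇝ids ⇝▷ shape⟦ a ⟧) (Π-E ⟦ A ⟧ ⟦ p ⟧ term⟦ f ⟧ term⟦ a ⟧) , other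
  ⟦ M.All-β {χ = χ} {b₁ = b₁} A p b a ⟧ =
    to-≐ χ (⇝ids ⇝▷ shape⟦ a ⟧) (≐-reduct b₁ (⇝ids ⇝▷ shape⟦ a ⟧) (Π-β ⟦ A ⟧ ⟦ p ⟧ term⟦ b ⟧ term⟦ a ⟧)) ,
    other , Shape-sub (shapes (⇝ids ⇝▷ shape⟦ a ⟧)) shape⟦ b ⟧

  ⟦ M.Ex-F {z = z} A p ⟧ = Ex-IsType z ⟦ A ⟧ ⟦ p ⟧
  ⟦ M.Ex-≐ d e ⟧ = Σ-≐ ⟦ d ⟧ ⟦ e ⟧
  ⟦ M.Ex-I {χ = χ} A p a b ⟧ =
    Σ-I ⟦ A ⟧ ⟦ p ⟧ term⟦ a ⟧ (from-inst χ ⟦ p ⟧ shape⟦ a ⟧ term⟦ a ⟧ term⟦ b ⟧) , other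
  ⟦ M.Ex-E {φ = φ} A p r d c ⟧ = Σ-rec ⟦ r ⟧ term⟦ d ⟧ (cast (wkᵀ 2 φ) term⟦ c ⟧) , other
  ⟦ M.Ex-β {χ = χ} {φ = φ} {c₃ = c₃} A p r a b c ⟧ =
    ≐-reduct c₃ (⇝ids ⇝▷ shape⟦ a ⟧ ⇝▷ shape⟦ b ⟧)
      (Σ-rec-β ⟦ r ⟧ (Σ-F ⟦ A ⟧ ⟦ p ⟧) term⟦ a ⟧ (from-inst χ ⟦ p ⟧ shape⟦ a ⟧ term⟦ a ⟧ term⟦ b ⟧) (cast (wkᵀ 2 φ) term⟦ c ⟧)) ,
    other , Shape-sub (shapes (⇝ids ⇝▷ shape⟦ a ⟧ ⇝▷ shape⟦ b ⟧)) shape⟦ c ⟧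

  ⟦ M.Id-F {z = z} A a b ⟧ = Id-IsType z ⟦ A ⟧ term⟦ a ⟧ term⟦ b ⟧
  ⟦ M.Id-≐ d e f ⟧ = Id-≐ ⟦ d ⟧ (proj₁ ⟦ e ⟧) (proj₁ ⟦ f ⟧)
  ⟦ M.Id-I A a ⟧ = Id-I ⟦ A ⟧ term⟦ a ⟧ , other
  ⟦ M.Id-E {A = A} {Q = Q} _ q a b p c ⟧ =
    to Q (⇝ids ⇝▷ shape⟦ a ⟧ ⇝▷ shape⟦ b ⟧) (J-rec (wk-domain A ⟦ q ⟧) term⟦ p ⟧ (diagonal Q term⟦ c ⟧)) , other
  ⟦ M.Id-β {A = A} {Q = Q} {c₁ = c₁} _ q a c ⟧ =
    to-≐ Q (⇝ids ⇝▷ shape⟦ a ⟧ ⇝▷ shape⟦ a ⟧) (≐-reduct c₁ (⇝ids ⇝▷ shape⟦ a ⟧)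
      (J-rec-β (wk-domain A ⟦ q ⟧) term⟦ a ⟧ (diagonal Q term⟦ c ⟧))) ,
    other , Shape-sub (shapes (⇝ids ⇝▷ shape⟦ a ⟧)) shape⟦ c ⟧

  ⟦ M.cover-F S v a ⟧ =
    cover-F (axioms ⟦ S ⟧ᴬ) (subset-conv (points ⟦ S ⟧ᴬ) term⟦ v ⟧) (element (points ⟦ S ⟧ᴬ) term⟦ a ⟧) , other
  ⟦ M.cover-rf S v a r ⟧ =
    cover-rf (axioms ⟦ S ⟧ᴬ) (subset-conv (points ⟦ S ⟧ᴬ) term⟦ v ⟧) (element (points ⟦ S ⟧ᴬ) term⟦ a ⟧) term⟦ r ⟧ , other
  ⟦ M.cover-tr {V = V} S v a j r ⟧ =
    cover-tr (axioms ⟦ S ⟧ᴬ) (subset-conv (points ⟦ S ⟧ᴬ) term⟦ v ⟧) (element (points ⟦ S ⟧ᴬ) term⟦ a ⟧)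
      (element-inst (indices ⟦ S ⟧ᴬ) shape⟦ a ⟧ term⟦ a ⟧ term⟦ j ⟧) (⟦tr⟧-premise V ⟦ S ⟧ᴬ shape⟦ a ⟧ shape⟦ j ⟧ term⟦ r ⟧) , other
  ⟦ M.cover-E {V = V} {P = P} S v p a t q₁ q₂ ⟧ =
    to P (⇝ids ⇝▷ shape⟦ a ⟧) (cast (wk-▷ ‖ P ‖ᵀ)
      (ind-E (⟦induction⟧ {V = V} {P = P} ⟦ S ⟧ᴬ term⟦ v ⟧ ⟦ p ⟧ term⟦ q₁ ⟧ term⟦ q₂ ⟧) (element (points ⟦ S ⟧ᴬ) term⟦ a ⟧) term⟦ t ⟧)) , other
  ⟦ M.cover-β-rf {V = V} {P = P} {q₁ = q} S v p a r q₁ q₂ ⟧ =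
    to-≐ P (⇝ids ⇝▷ shape⟦ a ⟧) (≐-reduct q (⇝ids ⇝▷ shape⟦ a ⟧ ⇝▷ shape⟦ r ⟧) (cast-∈≐ (wk-▷ ‖ P ‖ᵀ)
      (ind-β-rf (⟦induction⟧ {V = V} {P = P} ⟦ S ⟧ᴬ term⟦ v ⟧ ⟦ p ⟧ term⟦ q₁ ⟧ term⟦ q₂ ⟧) (element (points ⟦ S ⟧ᴬ) term⟦ a ⟧) term⟦ r ⟧))) ,
    other , Shape-sub (shapes (⇝ids ⇝▷ shape⟦ a ⟧ ⇝▷ shape⟦ r ⟧)) shape⟦ q₁ ⟧
  ⟦ M.cover-β-tr {V = V} {P = P} {a = a} {j = j} {r = r} {q₁ = p₁} {q₂ = p₂} S v p ha hj hr q₁ q₂ ⟧ =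
    to-≐ P (⇝ids ⇝▷ shape⟦ ha ⟧) (≐-reduct p₂ h (cast-∈≐ (wk-▷ ‖ P ‖ᵀ)
      (≐-last ‖ p₂ ‖ₜ (sym (recursiveCall-≡ r p₁ p₂))
        (ind-β-tr (⟦induction⟧ {V = V} {P = P} ⟦ S ⟧ᴬ term⟦ v ⟧ ⟦ p ⟧ term⟦ q₁ ⟧ term⟦ q₂ ⟧) (element (points ⟦ S ⟧ᴬ) term⟦ ha ⟧)
          (element-inst (indices ⟦ S ⟧ᴬ) shape⟦ ha ⟧ term⟦ ha ⟧ term⟦ hj ⟧) (⟦tr⟧-premise V ⟦ S ⟧ᴬ shape⟦ ha ⟧ shape⟦ hj ⟧ term⟦ hr ⟧))))) ,
    other , Shape-sub (shapes h) shape⟦ q₂ ⟧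
    where h = ⇝ids ⇝▷ shape⟦ ha ⟧ ⇝▷ shape⟦ hj ⟧ ⇝▷ shape⟦ hr ⟧ ⇝▷ other

  ⟦ M.positive-F S v a ⟧ =
    positive-F (axioms ⟦ S ⟧ᴬ) (subset-conv (points ⟦ S ⟧ᴬ) term⟦ v ⟧) (element (points ⟦ S ⟧ᴬ) term⟦ a ⟧) , other
  ⟦ M.positive-ax₁ S v a q ⟧ =
    positive-ax₁ (axioms ⟦ S ⟧ᴬ) (subset-conv (points ⟦ S ⟧ᴬ) term⟦ v ⟧) (element (points ⟦ S ⟧ᴬ) term⟦ a ⟧) term⟦ q ⟧ , other
  ⟦ M.positive-ax₂ {V = V} S v a i q ⟧ =
    ⟦ax₂⟧ V ⟦ S ⟧ᴬ shape⟦ a ⟧ shape⟦ i ⟧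
      (positive-ax₂ (axioms ⟦ S ⟧ᴬ) (subset-conv (points ⟦ S ⟧ᴬ) term⟦ v ⟧) (element (points ⟦ S ⟧ᴬ) term⟦ a ⟧)
        (element-inst (indices ⟦ S ⟧ᴬ) shape⟦ a ⟧ term⟦ a ⟧ term⟦ i ⟧) term⟦ q ⟧) , other
  ⟦ M.positive-ax₃ {V = V} {P = P} S v p a t q₁ q₃ ⟧ =
    ⟦ax₃⟧ {V = V} {P = P} ⟦ S ⟧ᴬ term⟦ v ⟧ ⟦ p ⟧ term⟦ a ⟧ shape⟦ a ⟧ term⟦ t ⟧ term⟦ q₁ ⟧ term⟦ q₃ ⟧ , other

  ⟦ M.AC-ax {A = A} {B = B} {R = R} _ _ _ r ⟧ = ⟦AC⟧ A B R ⟦ r ⟧ , other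
  ⟦ M.CT-ax g ⟧ = cast (sym CT-≡) (CT-ax ⟦ g ⟧ᶜ) , other

proposition3p1 : (∀ {n} (Γ : mTT.Context n) → Γ mTT.ctx → ‖ Γ ‖ᶜ MLtt.ctx)
    × (∀ {n} (Γ : mTT.Context n) (J : mTT.Judgement n) → Γ mTT.⊢ J → ‖ Γ ‖ᶜ MLtt.⊢ ‖ J ‖ᴶ)
    × (MLtt.Consistent → mTT.Consistent)
proposition3p1 =
    (λ Γ g → Soundness.⟦ g ⟧ᶜ)
  , (λ Γ J d → Soundness.sem-⊢ J Soundness.⟦ d ⟧)
  -- `‖_‖ᵀ` sends `⊥` to `N₀` and `‖_‖ᶜ` sends the empty context to the empty one by computation, so
  -- a closed proof of falsum is already a closed element of `N₀`.
  , (λ consistent t d → consistent ‖ t ‖ₜ Soundness.term⟦ d ⟧)
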